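{- Let $M$ be a regular, loopless matroid of rank $n$ on a finite set $E$ and let $R\subseteq E$. Suppose that $\widetilde{N}_0>0$ and $\widetilde{N}_n>0$. Then $\widetilde{N}_1^n=\widetilde{N}_0^{n-1}\widetilde{N}_n$ if and only if $\widetilde{N}_k^2=\widetilde{N}_{k-1}\widetilde{N}_{k+1}$ for some $k\in\{1,\dots,n-1\}$.
   Context: For $0\le k\le n$, $N_k$ is the number of bases of $M$ with exactly $k$ elements in $R$, and $\widetilde{N}_k=N_k/\binom{n}{k}$. A matroid is regular if it is representable over $\mathbb{R}$ by a totally unimodular matrix (equivalently, representable over every field).
   Formalization: The rank n is assumed to be at least 2: for n = 1 the first equality always holds while no k in {1,…,n−1} exists, so the equivalence fails, and for n = 0 the number Ñ₁ is undefined. -}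

module Defs where

open import Algebra.Bundles using (CommutativeRing)
open import Data.Fin using (Fin; zero; suc; toℕ; punchIn)
import Data.Fin as Fin
open import Data.Fin.Subset
  using (Subset; inside; outside; _∈_; _∉_; _⊆_; _⊂_; _∪_; _∩_; ⊥; ⁅_⁆)
  renaming (∣_∣ to card)
open import Data.Fin.Subset.Properties using (anySubset?; _⊂?_)
import Data.Integer as ℤ
open import Data.List using (List; []; _∷_; _++_; map; filter; length)
open import Data.Nat as ℕ using (ℕ; zero; suc; z≤n; s≤s)
open import Data.Nat.Combinatorics using (_C_; nCk≡n!/k![n-k]!; k![n∸k]!∣n!)
open import Data.Nat.Divisibility using (∣⇒≤)
open import Data.Nat.DivMod using (m≥n⇒m/n>0)
import Data.Nat.Properties as ℕ
open import Data.Product using (Σ; ∃-syntax; _×_; _,_)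
open import Data.Rational as ℚ using (ℚ; 0ℚ; 1ℚ; ½)
import Data.Rational.Properties as ℚ
open import Data.Rational.Solver using (module +-*-Solver)
open import Data.Sum using (_⊎_)
import Data.Vec as Vec
open import Function using (_⇔_)
open import Level using (0ℓ; _⊔_)
open import Relation.Binary using (_Preserves_⟶_)
open import Relation.Binary.PropositionalEquality
  using (_≡_; refl; sym; trans; cong; subst; subst₂)
open import Relation.Nullary using (¬_; ¬?)
open import Relation.Nullary.Decidable using (_×-dec_)
open import Relation.Unary using (Decidable)

import Algebra.Properties.Semiring.Exp as Exp
import Algebra.Properties.Semiring.Sum as Sum
import Algebra.Definitions.RawSemiring as RawSemiringDefs

open RawSemiringDefs ℚ.+-*-rawSemiring public using (_^_)

-- The real numbers as Cauchy sequences of rationals; real equality is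
-- _≈_, i.e. the difference tends to zero.

module Real where

  open import Data.Rational using (_+_; _*_; -_; _-_; ∣_∣; _<_; _≤_)

  Cauchy : (ℕ → ℚ) → Set
  Cauchy u = ∀ ε → 0ℚ < ε →
    ∃[ N ] (∀ m n → N ℕ.≤ m → N ℕ.≤ n → ∣ u m - u n ∣ < ε)

  record ℝ : Set where
    constructor mkℝ
    field
      seq    : ℕ → ℚ
      cauchy : Cauchy seq

  open ℝ public

  infix 4 _≈_

  record _≈_ (x y : ℝ) : Set where
    constructor mk≈
    field
      close : ∀ ε → 0ℚ < ε → ∃[ N ] (∀ n → N ℕ.≤ n → ∣ seq x n - seq y n ∣ < ε)

  open _≈_ public

  private

    open +-*-Solver using (solve; _:+_; _:*_; :-_; _:-_; _:=_)

    half : ∀ {ε} → 0ℚ < ε → 0ℚ < ½ * ε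
    half {ε} 0<ε = subst (_< ½ * ε) (ℚ.*-zeroʳ ½) (ℚ.*-monoʳ-<-pos ½ 0<ε)

    half+half : ∀ ε → ½ * ε + ½ * ε ≡ ε
    half+half ε = trans (sym (ℚ.*-distribʳ-+ ε ½ ½)) (ℚ.*-identityˡ ε)

    ∣-∣-triangle : ∀ {x y ε} → ∣ x ∣ < ½ * ε → ∣ y ∣ < ½ * ε → ∣ x + y ∣ < ε
    ∣-∣-triangle {x} {y} {ε} p q = ℚ.≤-<-trans (ℚ.∣p+q∣≤∣p∣+∣q∣ x y)
      (subst (∣ x ∣ + ∣ y ∣ <_) (half+half ε) (ℚ.+-mono-< p q))

    +-close : ∀ a b c d {ε} → ∣ a - c ∣ < ½ * ε → ∣ b - d ∣ < ½ * ε →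
              ∣ (a + b) - (c + d) ∣ < ε
    +-close a b c d {ε} p q = subst (λ z → ∣ z ∣ < ε)
      (solve 4 (λ a b c d → (a :- c) :+ (b :- d) := (a :+ b) :- (c :+ d)) refl a b c d)
      (∣-∣-triangle p q)

    -‿close : ∀ a b {ε} → ∣ a - b ∣ < ε → ∣ - a - - b ∣ < ε
    -‿close a b {ε} = subst (_< ε) (trans (sym (ℚ.∣-p∣≡∣p∣ (a - b)))
      (cong ∣_∣ (solve 2 (λ a b → :- (a :- b) := :- a :- :- b) refl a b)))

    sym-close : ∀ a b {ε} → ∣ a - b ∣ < ε → ∣ b - a ∣ < ε
    sym-close a b {ε} = subst (_< ε) (trans (sym (ℚ.∣-p∣≡∣p∣ (a - b)))
      (cong ∣_∣ (solve 2 (λ a b → :- (a :- b) := b :- a) refl a b)))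

    trans-close : ∀ a b c {ε} → ∣ a - b ∣ < ½ * ε → ∣ b - c ∣ < ½ * ε → ∣ a - c ∣ < ε
    trans-close a b c {ε} p q = subst (λ z → ∣ z ∣ < ε)
      (solve 3 (λ a b c → (a :- b) :+ (b :- c) := a :- c) refl a b c)
      (∣-∣-triangle p q)

    refl-close : ∀ {a b ε} → a ≡ b → 0ℚ < ε → ∣ a - b ∣ < ε
    refl-close {a} {ε = ε} refl = subst (λ z → ∣ z ∣ < ε) (sym (ℚ.+-inverseʳ a))

    ∣*∣< : ∀ x y {r s} → 0ℚ < r → ∣ x ∣ < r → ∣ y ∣ < s → ∣ x * y ∣ < r * s
    ∣*∣< x y {r} {s} 0<r p q = subst (_< r * s) (sym (ℚ.∣p*q∣≡∣p∣*∣q∣ x y))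
      (ℚ.≤-<-trans
        (ℚ.*-monoʳ-≤-nonNeg ∣ y ∣ {{ℚ.∣-∣-nonNeg y}} (ℚ.<⇒≤ p))
        (ℚ.*-monoʳ-<-pos r {{ℚ.positive 0<r}} q))

    *-close : ∀ {A D ε} → 0ℚ < A → 0ℚ < D → 0ℚ < ε →
      ∃[ δ ] 0ℚ < δ × (∀ a b c d → ∣ a ∣ < A → ∣ d ∣ < D →
        ∣ a - c ∣ < δ → ∣ b - d ∣ < δ → ∣ a * b - c * d ∣ < ε)
    *-close {A} {D} {ε} 0<A 0<D 0<ε = δ , 0<δ , go
      where
      0<B : 0ℚ < A + D
      0<B = ℚ.+-mono-< 0<A 0<D
      instance
        B-pos : ℚ.Positive (A + D)
        B-pos = ℚ.positive 0<B
        B-nonZero : ℚ.NonZero (A + D)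
        B-nonZero = ℚ.pos⇒nonZero (A + D)
      δ : ℚ
      δ = ℚ.1/ (A + D) * ε
      0<δ : 0ℚ < δ
      0<δ = ℚ.positive⁻¹ δ {{ℚ.pos*pos⇒pos (ℚ.1/ (A + D)) {{ℚ.1/pos⇒pos (A + D)}} ε {{ℚ.positive 0<ε}}}}
      Aδ+Dδ : A * δ + D * δ ≡ ε
      Aδ+Dδ = trans (sym (ℚ.*-distribʳ-+ δ A D))
        (trans (sym (ℚ.*-assoc (A + D) (ℚ.1/ (A + D)) ε))
          (trans (cong (_* ε) (ℚ.*-inverseʳ (A + D))) (ℚ.*-identityˡ ε)))
      go : ∀ a b c d → ∣ a ∣ < A → ∣ d ∣ < D →
           ∣ a - c ∣ < δ → ∣ b - d ∣ < δ → ∣ a * b - c * d ∣ < ε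
      go a b c d p q r s = subst₂ (λ z w → ∣ z ∣ < w)
        (solve 4 (λ a b c d → a :* (b :- d) :+ d :* (a :- c) := a :* b :- c :* d) refl a b c d)
        Aδ+Dδ
        (ℚ.≤-<-trans (ℚ.∣p+q∣≤∣p∣+∣q∣ (a * (b - d)) (d * (a - c)))
          (ℚ.+-mono-< (∣*∣< a (b - d) 0<A p s) (∣*∣< d (a - c) 0<D q r)))

    ⊔≤ˡ : ∀ {k} a b → a ℕ.⊔ b ℕ.≤ k → a ℕ.≤ k
    ⊔≤ˡ a b = ℕ.≤-trans (ℕ.m≤m⊔n a b)

    ⊔≤ʳ : ∀ {k} a b → a ℕ.⊔ b ℕ.≤ k → b ℕ.≤ k
    ⊔≤ʳ a b = ℕ.≤-trans (ℕ.m≤n⊔m a b)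

    pointwise : ∀ {x y} → (∀ n → seq x n ≡ seq y n) → x ≈ y
    pointwise eq = mk≈ λ ε 0<ε → 0 , λ n _ → refl-close (eq n) 0<ε

  0<1 : 0ℚ < 1ℚ
  0<1 = ℚ.positive⁻¹ 1ℚ

  bounded : ∀ x → ∃[ K ] 0ℚ < K × (∃[ N ] (∀ n → N ℕ.≤ n → ∣ seq x n ∣ < K))
  bounded (mkℝ u cu) with cu 1ℚ 0<1
  ... | N , h = 1ℚ + ∣ u N ∣
              , ℚ.+-mono-<-≤ 0<1 (ℚ.0≤∣p∣ (u N))
              , N , λ n N≤n → subst (λ z → ∣ z ∣ < 1ℚ + ∣ u N ∣)
                  (solve 2 (λ a b → (a :- b) :+ b := a) refl (u n) (u N))
                  (ℚ.≤-<-trans (ℚ.∣p+q∣≤∣p∣+∣q∣ (u n - u N) (u N))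
                    (ℚ.+-monoˡ-< ∣ u N ∣ (h n N N≤n ℕ.≤-refl)))

  fromℚ : ℚ → ℝ
  fromℚ q = mkℝ (λ _ → q) λ ε 0<ε → 0 , λ _ _ _ _ → refl-close {q} {q} refl 0<ε

  infixl 6 _+ᴿ_
  infixl 7 _*ᴿ_
  infix  8 -ᴿ_

  _+ᴿ_ : ℝ → ℝ → ℝ
  x +ᴿ y = mkℝ (λ n → seq x n + seq y n) λ ε 0<ε →
    let N₁ , h₁ = cauchy x (½ * ε) (half 0<ε)
        N₂ , h₂ = cauchy y (½ * ε) (half 0<ε)
    in N₁ ℕ.⊔ N₂ , λ m n p q → +-close (seq x m) (seq y m) (seq x n) (seq y n)
         (h₁ m n (⊔≤ˡ N₁ N₂ p) (⊔≤ˡ N₁ N₂ q)) (h₂ m n (⊔≤ʳ N₁ N₂ p) (⊔≤ʳ N₁ N₂ q))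

  -ᴿ_ : ℝ → ℝ
  -ᴿ x = mkℝ (λ n → - seq x n) λ ε 0<ε →
    let N , h = cauchy x ε 0<ε
    in N , λ m n p q → -‿close (seq x m) (seq x n) (h m n p q)

  _*ᴿ_ : ℝ → ℝ → ℝ
  x *ᴿ y = mkℝ (λ n → seq x n * seq y n) λ ε 0<ε →
    let A , 0<A , K₁ , b₁ = bounded x
        D , 0<D , K₂ , b₂ = bounded y
        δ , 0<δ , close   = *-close 0<A 0<D 0<ε
        N₁ , h₁ = cauchy x δ 0<δ
        N₂ , h₂ = cauchy y δ 0<δ
        K = K₁ ℕ.⊔ K₂
        N = N₁ ℕ.⊔ N₂
    in K ℕ.⊔ N , λ m n p q → close (seq x m) (seq y m) (seq x n) (seq y n)
         (b₁ m (⊔≤ˡ K₁ K₂ (⊔≤ˡ K N p))) (b₂ n (⊔≤ʳ K₁ K₂ (⊔≤ˡ K N q)))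
         (h₁ m n (⊔≤ˡ N₁ N₂ (⊔≤ʳ K N p)) (⊔≤ˡ N₁ N₂ (⊔≤ʳ K N q)))
         (h₂ m n (⊔≤ʳ N₁ N₂ (⊔≤ʳ K N p)) (⊔≤ʳ N₁ N₂ (⊔≤ʳ K N q)))

  +ᴿ-cong : ∀ {x x′ y y′} → x ≈ x′ → y ≈ y′ → x +ᴿ y ≈ x′ +ᴿ y′
  +ᴿ-cong {x} {x′} {y} {y′} x≈x′ y≈y′ = mk≈ λ ε 0<ε →
    let N₁ , h₁ = close x≈x′ (½ * ε) (half 0<ε)
        N₂ , h₂ = close y≈y′ (½ * ε) (half 0<ε)
    in N₁ ℕ.⊔ N₂ , λ n p → +-close (seq x n) (seq y n) (seq x′ n) (seq y′ n)
         (h₁ n (⊔≤ˡ N₁ N₂ p)) (h₂ n (⊔≤ʳ N₁ N₂ p))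

  -ᴿ-cong : ∀ {x y} → x ≈ y → -ᴿ x ≈ -ᴿ y
  -ᴿ-cong {x} {y} x≈y = mk≈ λ ε 0<ε →
    let N , h = close x≈y ε 0<ε
    in N , λ n p → -‿close (seq x n) (seq y n) (h n p)

  *ᴿ-cong : ∀ {x x′ y y′} → x ≈ x′ → y ≈ y′ → x *ᴿ y ≈ x′ *ᴿ y′
  *ᴿ-cong {x} {x′} {y} {y′} x≈x′ y≈y′ = mk≈ λ ε 0<ε →
    let A , 0<A , K₁ , b₁ = bounded x
        D , 0<D , K₂ , b₂ = bounded y′
        δ , 0<δ , cl      = *-close 0<A 0<D 0<ε
        N₁ , h₁ = close x≈x′ δ 0<δ
        N₂ , h₂ = close y≈y′ δ 0<δ
        K = K₁ ℕ.⊔ K₂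
        N = N₁ ℕ.⊔ N₂
    in K ℕ.⊔ N , λ n p → cl (seq x n) (seq y n) (seq x′ n) (seq y′ n)
         (b₁ n (⊔≤ˡ K₁ K₂ (⊔≤ˡ K N p))) (b₂ n (⊔≤ʳ K₁ K₂ (⊔≤ˡ K N p)))
         (h₁ n (⊔≤ˡ N₁ N₂ (⊔≤ʳ K N p))) (h₂ n (⊔≤ʳ N₁ N₂ (⊔≤ʳ K N p)))

  ≈-refl : ∀ {x} → x ≈ x
  ≈-refl = pointwise λ _ → refl

  ≈-sym : ∀ {x y} → x ≈ y → y ≈ x
  ≈-sym {x} {y} x≈y = mk≈ λ ε 0<ε →
    let N , h = close x≈y ε 0<ε
    in N , λ n p → sym-close (seq x n) (seq y n) (h n p)

  ≈-trans : ∀ {x y z} → x ≈ y → y ≈ z → x ≈ z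
  ≈-trans {x} {y} {z} x≈y y≈z = mk≈ λ ε 0<ε →
    let N₁ , h₁ = close x≈y (½ * ε) (half 0<ε)
        N₂ , h₂ = close y≈z (½ * ε) (half 0<ε)
    in N₁ ℕ.⊔ N₂ , λ n p → trans-close (seq x n) (seq y n) (seq z n)
         (h₁ n (⊔≤ˡ N₁ N₂ p)) (h₂ n (⊔≤ʳ N₁ N₂ p))

  ℝ-commutativeRing : CommutativeRing 0ℓ 0ℓ
  ℝ-commutativeRing = record
    { Carrier = ℝ
    ; _≈_ = _≈_
    ; _+_ = _+ᴿ_
    ; _*_ = _*ᴿ_
    ; -_ = -ᴿ_
    ; 0# = fromℚ 0ℚ
    ; 1# = fromℚ 1ℚ
    ; isCommutativeRing = record
      { isRing = record
        { +-isAbelianGroup = record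
          { isGroup = record
            { isMonoid = record
              { isSemigroup = record
                { isMagma = record
                  { isEquivalence = record { refl = ≈-refl ; sym = ≈-sym ; trans = ≈-trans }
                  ; ∙-cong = +ᴿ-cong
                  }
                ; assoc = λ x y z → pointwise λ n → ℚ.+-assoc (seq x n) (seq y n) (seq z n)
                }
              ; identity = (λ x → pointwise λ n → ℚ.+-identityˡ (seq x n))
                         , (λ x → pointwise λ n → ℚ.+-identityʳ (seq x n))
              }
            ; inverse = (λ x → pointwise λ n → ℚ.+-inverseˡ (seq x n))
                      , (λ x → pointwise λ n → ℚ.+-inverseʳ (seq x n))
            ; ⁻¹-cong = -ᴿ-cong
            }
          ; comm = λ x y → pointwise λ n → ℚ.+-comm (seq x n) (seq y n)
          }
        ; *-cong = *ᴿ-cong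
        ; *-assoc = λ x y z → pointwise λ n → ℚ.*-assoc (seq x n) (seq y n) (seq z n)
        ; *-identity = (λ x → pointwise λ n → ℚ.*-identityˡ (seq x n))
                     , (λ x → pointwise λ n → ℚ.*-identityʳ (seq x n))
        ; distrib = (λ x y z → pointwise λ n → ℚ.*-distribˡ-+ (seq x n) (seq y n) (seq z n))
                  , (λ x y z → pointwise λ n → ℚ.*-distribʳ-+ (seq x n) (seq y n) (seq z n))
        }
      ; *-comm = λ x y → pointwise λ n → ℚ.*-comm (seq x n) (seq y n)
      }
    }

module Matrices {c ℓ} (K : CommutativeRing c ℓ) where

  open CommutativeRing K
    using (Carrier; _≈_; _*_; -_; 0#; 1#; semiring)
  open Exp semiring using () renaming (_^_ to _^ᴷ_)
  open Sum semiring using (sum)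

  Matrix : ℕ → ℕ → Set c
  Matrix r m = Fin r → Fin m → Carrier

  minor : ∀ {n} → Matrix (suc n) (suc n) → Fin (suc n) → Matrix n n
  minor A j i k = A (suc i) (punchIn j k)

  -- Laplace expansion along the first row.
  det : ∀ {n} → Matrix n n → Carrier
  det {zero}  A = 1#
  det {suc n} A = sum λ j → (- 1#) ^ᴷ toℕ j * (A zero j * det (minor A j))

  TotallyUnimodular : ∀ {r m} → Matrix r m → Set ℓ
  TotallyUnimodular {r} {m} A =
    ∀ {k} (ρ : Fin k → Fin r) (κ : Fin k → Fin m) →
    ρ Preserves Fin._<_ ⟶ Fin._<_ → κ Preserves Fin._<_ ⟶ Fin._<_ →
    let d = det (λ i j → A (ρ i) (κ j)) in d ≈ 0# ⊎ d ≈ 1# ⊎ d ≈ - 1#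

  -- Linear independence of the family of columns indexed by S, so that equal
  -- columns with distinct indices are dependent.
  ColumnsIndependent : ∀ {r m} → Matrix r m → Subset m → Set (c ⊔ ℓ)
  ColumnsIndependent {r} {m} A S =
    (a : Fin m → Carrier) → (∀ e → e ∉ S → a e ≈ 0#) →
    (∀ i → sum (λ e → a e * A i e) ≈ 0#) → ∀ e → a e ≈ 0#

-- Matroids on the ground set Fin m. Decidability of independence, automatic
-- classically, makes it possible to count bases.

record Matroid (m : ℕ) : Set₁ where
  field
    Indep        : Subset m → Set
    indep?       : Decidable Indep
    indep-⊥      : Indep ⊥
    hereditary   : ∀ {I J} → I ⊆ J → Indep J → Indep I
    augmentation : ∀ {I J} → Indep I → Indep J → card I ℕ.< card J →
                   ∃[ e ] e ∈ J × e ∉ I × Indep (I ∪ ⁅ e ⁆)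

module _ {m} (M : Matroid m) where

  open Matroid M

  IsBasis : Subset m → Set
  IsBasis B = Indep B × ¬ (∃[ J ] Indep J × B ⊂ J)

  isBasis? : Decidable IsBasis
  isBasis? B = indep? B ×-dec ¬? (anySubset? λ J → indep? J ×-dec B ⊂? J)

  -- All bases have the same cardinality, so one basis determines the rank.
  HasRank : ℕ → Set
  HasRank n = ∃[ B ] IsBasis B × card B ≡ n

  Loopless : Set
  Loopless = ∀ e → Indep ⁅ e ⁆

  open Matrices Real.ℝ-commutativeRing

  Regular : Set
  Regular = ∃[ r ] Σ (Matrix r m) λ A →
    TotallyUnimodular A × (∀ S → Indep S ⇔ ColumnsIndependent A S)

subsets : ∀ m → List (Subset m)
subsets zero    = Vec.[] ∷ []
subsets (suc m) = map (inside Vec.∷_) (subsets m) ++ map (outside Vec.∷_) (subsets m)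

N : ∀ {m} → Matroid m → Subset m → ℕ → ℕ
N {m} M R k = length (filter (λ B → isBasis? M B ×-dec card (B ∩ R) ℕ.≟ k) (subsets m))

nCk-nonZero : ∀ {n k} → k ℕ.≤ n → ℕ.NonZero (n C k)
nCk-nonZero {n} {k} k≤n = subst ℕ.NonZero (sym (nCk≡n!/k![n-k]! k≤n))
  (ℕ.>-nonZero (m≥n⇒m/n>0 (∣⇒≤ (k![n∸k]!∣n! k≤n))))
  where
  instance
    _ = k ℕ.!* n ℕ.∸ k !≢0
    _ = n ℕ.!≢0

-- The number Nₖ / (n choose k).
Ñ : ∀ {m} → Matroid m → Subset m → (n k : ℕ) → .(k ℕ.≤ n) → ℚ
Ñ M R n k k≤n = ℚ._/_ (ℤ.+ N M R k) (n C k) {{nCk-nonZero k≤n}}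

{-# OPTIONS --safe #-}

module Submission where

-- Up to the factor n!, Ñₖ is the mixed discriminant D(R,…,R,Rᶜ,…,Rᶜ) of the
-- basis generating polynomial, with k copies of the indicator weight of R.
-- Write H(x, y) = D(x, y, c₁, …, cⱼ) with each cᵢ one of the indicators of R and
-- Rᶜ, after contraction of an independent set.  By induction on j, H satisfies
-- the reverse Cauchy–Schwarz inequality H(x,x) H(c,c) ≤ H(x,c)²: in rank two H
-- is (Σ x)² minus the sum of the squares of x over the parallel classes, and
-- the inductive step is a Bochner argument in which a Laplacian equation takes
-- the place of an eigenvector.  Hence k ↦ Ñₖ is log-concave, and the equation
-- Ñ₁ⁿ = Ñ₀ⁿ⁻¹ Ñₙ forces Ñ₁² = Ñ₀ Ñ₂.
--
-- Conversely, equality at k makes w = R − c Rᶜ isotropic, and the Bochner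
-- argument passes this to contractions until, in rank two, all parallel
-- classes have w-weight zero.  Total unimodularity makes functionals agree up
-- to sign on parallel elements, so the form X(φ,ψ) = Σ wₑ φ(e) ψ(e) vanishes on
-- the functionals that vanish on the contracted set; by dual functionals of
-- three independent elements this ascends to X = 0.  Then w has weight zero off
-- every hyperplane, which gives Ñⱼ₊₁ = c Ñⱼ for all j.

open import Defs
open import Algebra.Bundles using (CommutativeRing)
open import Data.Bool using (Bool; true; false; if_then_else_)
import Data.Bool.Properties as Bool
open import Data.Fin using (Fin; zero; suc; toℕ; punchIn; punchOut; inject₁; _≟_)
import Data.Fin as Fin
import Data.Fin.Properties as Fin
open import Data.Fin.Subset using (Subset; _∈_; _∉_; _⊆_; _⊂_; _∪_; _∩_; ⁅_⁆) renaming (∣_∣ to card; ⊥ to ∅)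
import Data.Fin.Subset.Properties as Sub
import Data.Integer as ℤ
import Data.Integer.Properties as ℤ
open import Data.List using (List; []; _∷_; _++_; map; filter; length; replicate)
open import Data.List.Relation.Binary.Permutation.Propositional using (_↭_)
import Data.List.Relation.Binary.Permutation.Propositional as Perm
import Data.List.Relation.Binary.Permutation.Propositional.Properties as Perm
import Data.List.Properties as List
open import Data.Nat using (ℕ; zero; suc; _∸_; _≤_; _<_; z≤n; s≤s)
import Data.Nat as ℕ
open import Data.Nat.Properties using (≤-refl; ≤-trans; <⇒≤; m∸n≤m)
import Data.Nat.Properties as ℕ
open import Data.Nat.Combinatorics using (nCk≡n!/k![n-k]!; k![n∸k]!∣n!) renaming (_C_ to _choose_)
open import Data.Nat.DivMod using (m/n*n≡m)
open import Data.Product using (Σ-syntax; ∃-syntax; _×_; _,_; proj₁; proj₂)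
open import Data.Rational using (ℚ; 0ℚ; 1ℚ; _+_; _*_; -_; _-_) renaming (_<_ to _<ℚ_; _≤_ to _≤ℚ_)
import Data.Rational as ℚ
import Data.Rational.Properties as ℚ
open import Data.Rational.Solver using (module +-*-Solver)
open import Data.Sum using (_⊎_; inj₁; inj₂)
open import Data.Vec using (lookup)
import Data.Vec as Vec
import Data.Vec.Properties as Vec
open import Function using (_⇔_; _∘_; case_of_; mk⇔; Equivalence)
open import Level using (_⊔_)
open import Relation.Binary using (_Preserves_⟶_; Tri; tri<; tri≈; tri>)
open import Relation.Binary.PropositionalEquality using (_≡_; _≢_; refl; sym; trans; cong; cong₂; subst; subst₂; module ≡-Reasoning)
open import Relation.Nullary using (¬_; ¬?; Dec; yes; no; does; contradiction)
open import Relation.Nullary.Decidable using (_×-dec_; dec-true; dec-false)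
open import Algebra.Properties.Semiring.Sum (CommutativeRing.semiring ℚ.+-*-commutativeRing)
  using (sum; sum-cong-≗; sum-replicate-zero; sum-remove; ∑-distrib-+; ∑-comm; *-distribˡ-sum)
open +-*-Solver using (solve; con; _:=_; _:+_; _:*_; _:-_; :-_)
import Data.Rational.Unnormalised as ℚᵘ
import Data.Rational.Unnormalised.Properties as ℚᵘ
import Data.List.Relation.Unary.All as All
import Data.List.Relation.Unary.All.Properties as All

-- For a regular matroid the basis generating polynomial is det(Σ xₑ vₑ vₑᵀ), where the vₑ are the
-- columns of a totally unimodular matrix of full row rank. The theorem is thus an equality case of
-- Alexandrov's inequality for mixed discriminants: `X` is the bilinear form of the matrix Σ wₑ vₑ
-- vₑᵀ, and its vanishing says that the matrices of R and of its complement are proportional.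
-- Positivity of Ñ₀ and Ñₙ gives a basis inside R and a basis inside the complement, so every
-- independent set with fewer than n elements can be enlarged by an element of either colour. Hence
-- each full-length mixed discriminant of indicators over an independent set is strictly positive,
-- which provides the nonzero divisors and the connectedness that the Bochner argument needs. All
-- linear algebra takes place over ℚ, where eigenvectors need not exist but linear systems can be
-- decided; a totally unimodular real matrix has entries 0 and ±1, so its column dependences can be
-- tested rationally.

-- Arithmetic of the ordered field ℚ and finite sums

0≤sq : ∀ q → 0ℚ ≤ℚ q * q
0≤sq q with ℚ.≤-total 0ℚ q
... | inj₁ 0≤q = ℚ.nonNegative⁻¹ (q * q) {{ℚ.nonNeg*nonNeg⇒nonNeg q {{ℚ.nonNegative 0≤q}} q {{ℚ.nonNegative 0≤q}}}}
... | inj₂ q≤0 = ℚ.nonNegative⁻¹ (q * q) {{ℚ.nonPos*nonPos⇒nonPos q {{ℚ.nonPositive q≤0}} q {{ℚ.nonPositive q≤0}}}}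

0≤* : ∀ {p q} → 0ℚ ≤ℚ p → 0ℚ ≤ℚ q → 0ℚ ≤ℚ p * q
0≤* {p} {q} 0≤p 0≤q =
  ℚ.nonNegative⁻¹ (p * q) {{ℚ.nonNeg*nonNeg⇒nonNeg p {{ℚ.nonNegative 0≤p}} q {{ℚ.nonNegative 0≤q}}}}

0<* : ∀ {p q} → 0ℚ <ℚ p → 0ℚ <ℚ q → 0ℚ <ℚ p * q
0<* {p} {q} 0<p 0<q = ℚ.positive⁻¹ (p * q) {{ℚ.pos*pos⇒pos p {{ℚ.positive 0<p}} q {{ℚ.positive 0<q}}}}

0≤+ : ∀ {p q} → 0ℚ ≤ℚ p → 0ℚ ≤ℚ q → 0ℚ ≤ℚ p + q
0≤+ = ℚ.+-mono-≤

p≤q⇒0≤q-p : ∀ {p q} → p ≤ℚ q → 0ℚ ≤ℚ q - p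
p≤q⇒0≤q-p {p} {q} p≤q = subst (_≤ℚ q - p) (ℚ.+-inverseʳ p) (ℚ.+-monoˡ-≤ (- p) p≤q)

0≤q-p⇒p≤q : ∀ {p q} → 0ℚ ≤ℚ q - p → p ≤ℚ q
0≤q-p⇒p≤q {p} {q} 0≤q-p = subst₂ _≤ℚ_ (ℚ.+-identityˡ p)
  (solve 2 (λ p q → (q :- p) :+ p := q) refl p q) (ℚ.+-monoˡ-≤ p 0≤q-p)

p<q⇒0<q-p : ∀ {p q} → p <ℚ q → 0ℚ <ℚ q - p
p<q⇒0<q-p {p} {q} p<q = subst (_<ℚ q - p) (ℚ.+-inverseʳ p) (ℚ.+-monoˡ-< (- p) p<q)

0<q-p⇒p<q : ∀ {p q} → 0ℚ <ℚ q - p → p <ℚ q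
0<q-p⇒p<q {p} {q} 0<q-p = subst₂ _<ℚ_ (ℚ.+-identityˡ p)
  (solve 2 (λ p q → (q :- p) :+ p := q) refl p q) (ℚ.+-monoˡ-< p 0<q-p)

inverse : ∀ {q} → q ≢ 0ℚ → ∃[ r ] q * r ≡ 1ℚ
inverse {q} q≢0 = ℚ.1/ q , ℚ.*-inverseʳ q
  where instance _ = ℚ.≢-nonZero q≢0

positive-inverse : ∀ {q} → 0ℚ <ℚ q → ∃[ r ] 0ℚ <ℚ r × q * r ≡ 1ℚ
positive-inverse {q} 0<q = ℚ.1/ q , ℚ.positive⁻¹ _ {{ℚ.1/pos⇒pos q}} , ℚ.*-inverseʳ q
  where
  instance
    _ = ℚ.positive 0<q
    _ = ℚ.pos⇒nonZero q

*-cancel-0 : ∀ {p q} → p ≢ 0ℚ → p * q ≡ 0ℚ → q ≡ 0ℚ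
*-cancel-0 {p} {q} p≢0 pq≡0 = begin
  q ≡⟨ ℚ.*-identityˡ q ⟨
  1ℚ * q ≡⟨ cong (_* q) pr≡1 ⟨
  p * r * q ≡⟨ solve 3 (λ p q r → p :* r :* q := r :* (p :* q)) refl p q r ⟩
  r * (p * q) ≡⟨ cong (r *_) pq≡0 ⟩
  r * 0ℚ ≡⟨ ℚ.*-zeroʳ r ⟩
  0ℚ ∎
  where
  open ≡-Reasoning
  r = inverse p≢0 .proj₁
  pr≡1 = inverse p≢0 .proj₂

*-cancelˡ : ∀ {p q r} → p ≢ 0ℚ → p * q ≡ p * r → q ≡ r
*-cancelˡ {p} {q} {r} p≢0 pq≡pr = begin
  q ≡⟨ solve 2 (λ q r → q := (q :- r) :+ r) refl q r ⟩
  (q - r) + r ≡⟨ cong (_+ r) (*-cancel-0 p≢0 p[q-r]≡0) ⟩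
  0ℚ + r ≡⟨ ℚ.+-identityˡ r ⟩
  r ∎
  where
  open ≡-Reasoning
  p[q-r]≡0 : p * (q - r) ≡ 0ℚ
  p[q-r]≡0 = begin
    p * (q - r) ≡⟨ solve 3 (λ p q r → p :* (q :- r) := p :* q :- p :* r) refl p q r ⟩
    p * q - p * r ≡⟨ cong (_- p * r) pq≡pr ⟩
    p * r - p * r ≡⟨ ℚ.+-inverseʳ (p * r) ⟩
    0ℚ ∎

*-≡0ʳ : ∀ p {q} → q ≡ 0ℚ → p * q ≡ 0ℚ
*-≡0ʳ p refl = ℚ.*-zeroʳ p

*-≡0ˡ : ∀ q {p} → p ≡ 0ℚ → p * q ≡ 0ℚ
*-≡0ˡ q refl = ℚ.*-zeroˡ q

-- The scalar behind every projection below: a vector is shifted along a direction of nonzero value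
-- `b` until a linear functional vanishes on it.
eliminate : ∀ a {b r} → b * r ≡ 1ℚ → a + (- (a * r)) * b ≡ 0ℚ
eliminate a {b} {r} br≡1 = begin
  a + (- (a * r)) * b ≡⟨ solve 3 (λ a b r → a :+ (:- (a :* r)) :* b := a :- a :* (b :* r)) refl a b r ⟩
  a - a * (b * r) ≡⟨ cong (λ u → a - a * u) br≡1 ⟩
  a - a * 1ℚ ≡⟨ solve 1 (λ a → a :- a :* con 1ℚ := con 0ℚ) refl a ⟩
  0ℚ ∎
  where open ≡-Reasoning

sq≡0 : ∀ {q} → q * q ≡ 0ℚ → q ≡ 0ℚ
sq≡0 {q} qq≡0 with q ℚ.≟ 0ℚ
... | yes q≡0 = q≡0
... | no q≢0 = *-cancel-0 q≢0 qq≡0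

pos⇒≢0 : ∀ {q} → 0ℚ <ℚ q → q ≢ 0ℚ
pos⇒≢0 0<q q≡0 = ℚ.<⇒≢ 0<q (sym q≡0)

≤-cancel-pos : ∀ {c p} → 0ℚ <ℚ c → c * p ≤ℚ 0ℚ → p ≤ℚ 0ℚ
≤-cancel-pos {c} {p} 0<c cp≤0 =
  ℚ.*-cancelˡ-≤-pos c {{ℚ.positive 0<c}} (subst (c * p ≤ℚ_) (sym (ℚ.*-zeroʳ c)) cp≤0)

0≤∧+≤0⇒≡0 : ∀ {p q} → 0ℚ ≤ℚ p → 0ℚ ≤ℚ q → p + q ≤ℚ 0ℚ → p ≡ 0ℚ × q ≡ 0ℚ
0≤∧+≤0⇒≡0 {p} {q} 0≤p 0≤q p+q≤0 =
    ℚ.≤-antisym (ℚ.≤-trans (subst (_≤ℚ p + q) (ℚ.+-identityʳ p) (ℚ.+-monoʳ-≤ p 0≤q)) p+q≤0) 0≤p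
  , ℚ.≤-antisym (ℚ.≤-trans (subst (_≤ℚ p + q) (ℚ.+-identityˡ q) (ℚ.+-monoˡ-≤ q 0≤p)) p+q≤0) 0≤q

-- Opaque, so that the unifier can read the summand off a sum.
opaque

  ∑ : ∀ {n} → (Fin n → ℚ) → ℚ
  ∑ = sum

  ∑≡sum : ∀ {n} (f : Fin n → ℚ) → ∑ f ≡ sum f
  ∑≡sum f = refl

  ∑-empty : ∀ (f : Fin 0 → ℚ) → ∑ f ≡ 0ℚ
  ∑-empty f = refl

  ∑-suc : ∀ {n} (f : Fin (suc n) → ℚ) → ∑ f ≡ f zero + ∑ (λ i → f (suc i))
  ∑-suc f = refl

  ∑-cong : ∀ {n} {f g : Fin n → ℚ} → (∀ i → f i ≡ g i) → ∑ f ≡ ∑ g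
  ∑-cong = sum-cong-≗

  ∑-0 : ∀ n → ∑ {n} (λ _ → 0ℚ) ≡ 0ℚ
  ∑-0 = sum-replicate-zero

  *-∑ : ∀ {n} t (f : Fin n → ℚ) → t * ∑ f ≡ ∑ (λ i → t * f i)
  *-∑ = *-distribˡ-sum

  ∑-swap : ∀ {m n} (f : Fin m → Fin n → ℚ) → ∑ (λ i → ∑ (λ j → f i j)) ≡ ∑ (λ j → ∑ (λ i → f i j))
  ∑-swap = ∑-comm

  ∑-+ : ∀ {n} (f g : Fin n → ℚ) → ∑ (λ i → f i + g i) ≡ ∑ f + ∑ g
  ∑-+ = ∑-distrib-+

  ∑-mono : ∀ {n} {f g : Fin n → ℚ} → (∀ i → f i ≤ℚ g i) → ∑ f ≤ℚ ∑ g
  ∑-mono {zero} f≤g = ℚ.≤-refl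
  ∑-mono {suc n} f≤g = ℚ.+-mono-≤ (f≤g zero) (∑-mono (λ i → f≤g (suc i)))

∑-zero : ∀ {n} {f : Fin n → ℚ} → (∀ i → f i ≡ 0ℚ) → ∑ f ≡ 0ℚ
∑-zero {n} f≡0 = trans (∑-cong f≡0) (∑-0 n)

∑-linear : ∀ {n} (f g : Fin n → ℚ) t → ∑ (λ i → f i + t * g i) ≡ ∑ f + t * ∑ g
∑-linear f g t = trans (∑-+ f _) (cong (∑ f +_) (sym (*-∑ t g)))

∑-nonNeg : ∀ {n} {f : Fin n → ℚ} → (∀ i → 0ℚ ≤ℚ f i) → 0ℚ ≤ℚ ∑ f
∑-nonNeg {n} {f} 0≤f = subst (_≤ℚ ∑ f) (∑-0 n) (∑-mono 0≤f)

∑-nonNeg≤0 : ∀ {n} {f : Fin n → ℚ} → (∀ i → 0ℚ ≤ℚ f i) → ∑ f ≤ℚ 0ℚ → ∀ i → f i ≡ 0ℚ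
∑-nonNeg≤0 {suc n} {f} 0≤f ∑≤0 = λ
  { zero → split .proj₁
  ; (suc i) → ∑-nonNeg≤0 (λ i → 0≤f (suc i)) (ℚ.≤-reflexive (split .proj₂)) i
  }
  where
  split : f zero ≡ 0ℚ × ∑ (λ i → f (suc i)) ≡ 0ℚ
  split = 0≤∧+≤0⇒≡0 (0≤f zero) (∑-nonNeg λ i → 0≤f (suc i)) (subst (_≤ℚ 0ℚ) (∑-suc f) ∑≤0)

∑-pos : ∀ {n} {f : Fin n → ℚ} → (∀ i → 0ℚ ≤ℚ f i) → ∀ i → 0ℚ <ℚ f i → 0ℚ <ℚ ∑ f
∑-pos {f = f} 0≤f i 0<fi with ℚ.<-cmp 0ℚ (∑ f)
... | tri< 0<∑ _ _ = 0<∑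
... | tri≈ _ 0≡∑ _ = contradiction (∑-nonNeg≤0 0≤f (ℚ.≤-reflexive (sym 0≡∑)) i) (pos⇒≢0 0<fi)
... | tri> _ _ ∑<0 = contradiction (∑-nonNeg≤0 0≤f (ℚ.<⇒≤ ∑<0) i) (pos⇒≢0 0<fi)

𝟙 : ∀ {a} {A : Set a} → Dec A → ℚ
𝟙 d = if does d then 1ℚ else 0ℚ

𝟙-yes : ∀ {a} {A : Set a} (d : Dec A) → A → 𝟙 d ≡ 1ℚ
𝟙-yes d a = cong (if_then 1ℚ else 0ℚ) (dec-true d a)

𝟙-no : ∀ {a} {A : Set a} (d : Dec A) → ¬ A → 𝟙 d ≡ 0ℚ
𝟙-no d ¬a = cong (if_then 1ℚ else 0ℚ) (dec-false d ¬a)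

0<1 : 0ℚ <ℚ 1ℚ
0<1 = Real.0<1

0≤𝟙 : ∀ {a} {A : Set a} (d : Dec A) → 0ℚ ≤ℚ 𝟙 d
0≤𝟙 (yes _) = ℚ.<⇒≤ 0<1
0≤𝟙 (no _) = ℚ.≤-refl

δ : ∀ {n} → Fin n → Fin n → ℚ
δ i j = 𝟙 (i ≟ j)

δ-refl : ∀ {n} (i : Fin n) → δ i i ≡ 1ℚ
δ-refl i = 𝟙-yes (i ≟ i) refl

δ-≢ : ∀ {n} {i j : Fin n} → i ≢ j → δ i j ≡ 0ℚ
δ-≢ {i = i} {j} = 𝟙-no (i ≟ j)

δ-sym : ∀ {n} (i j : Fin n) → δ i j ≡ δ j i
δ-sym i j with i ≟ j
... | yes i≡j = sym (𝟙-yes (j ≟ i) (sym i≡j))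
... | no i≢j = sym (𝟙-no (j ≟ i) (i≢j ∘ sym))

∑-single : ∀ {n} {f : Fin n → ℚ} i → (∀ j → i ≢ j → f j ≡ 0ℚ) → ∑ f ≡ f i
∑-single {f = f} zero z = begin
  ∑ f ≡⟨ ∑-suc f ⟩
  f zero + ∑ (λ j → f (suc j)) ≡⟨ cong (f zero +_) (∑-zero λ j → z (suc j) λ ()) ⟩
  f zero + 0ℚ ≡⟨ ℚ.+-identityʳ (f zero) ⟩
  f zero ∎
  where open ≡-Reasoning
∑-single {f = f} (suc i) z = begin
  ∑ f ≡⟨ ∑-suc f ⟩
  f zero + ∑ (λ j → f (suc j)) ≡⟨ cong₂ _+_ (z zero λ ()) (∑-single i λ j i≢j → z (suc j) (i≢j ∘ Fin.suc-injective)) ⟩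
  0ℚ + f (suc i) ≡⟨ ℚ.+-identityˡ (f (suc i)) ⟩
  f (suc i) ∎
  where open ≡-Reasoning

∑-δ : ∀ {n} (f : Fin n → ℚ) i → ∑ (λ j → δ i j * f j) ≡ f i
∑-δ f i = begin
  ∑ (λ j → δ i j * f j) ≡⟨ ∑-single i (λ j i≢j → trans (cong (_* f j) (δ-≢ i≢j)) (ℚ.*-zeroˡ (f j))) ⟩
  δ i i * f i ≡⟨ cong (_* f i) (δ-refl i) ⟩
  1ℚ * f i ≡⟨ ℚ.*-identityˡ (f i) ⟩
  f i ∎
  where open ≡-Reasoning

infix 7 _∙_

_∙_ : ∀ {n} → (Fin n → ℚ) → (Fin n → ℚ) → ℚ
y ∙ v = ∑ λ i → y i * v i

∙-linearˡ : ∀ {n} (x y v : Fin n → ℚ) t → (λ i → x i + t * y i) ∙ v ≡ x ∙ v + t * (y ∙ v)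
∙-linearˡ x y v t = trans
  (∑-cong λ i → solve 4 (λ x y v t → (x :+ t :* y) :* v := x :* v :+ t :* (y :* v)) refl (x i) (y i) (v i) t)
  (∑-linear _ _ t)

∙-linearʳ : ∀ {n} (x v w : Fin n → ℚ) t → x ∙ (λ i → v i + t * w i) ≡ x ∙ v + t * (x ∙ w)
∙-linearʳ x v w t = trans
  (∑-cong λ i → solve 4 (λ x v w t → x :* (v :+ t :* w) := x :* v :+ t :* (x :* w)) refl (x i) (v i) (w i) t)
  (∑-linear _ _ t)

-- The Fredholm alternative over ℚ

cons : ∀ {a} {A : Set a} {n} → A → (Fin n → A) → Fin (suc n) → A
cons x f zero = x
cons x f (suc i) = f i

-- The alternative is first decided for the vector V zero and the span of the
-- others; if V zero lies outside it, witnessed by y₀, then h is shifted along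
-- V zero until y₀ annihilates it.
fredholm : ∀ {m r} (V : Fin m → Fin r → ℚ) (h : Fin r → ℚ) →
  (Σ[ z ∈ (Fin m → ℚ) ] (∀ i → ∑ (λ j → z j * V j i) ≡ h i)) ⊎
  (Σ[ y ∈ (Fin r → ℚ) ] (∀ j → y ∙ V j ≡ 0ℚ) × y ∙ h ≢ 0ℚ)
fredholm {zero} V h with Fin.all? (λ i → h i ℚ.≟ 0ℚ)
... | yes h≡0 = inj₁ ((λ ()) , λ i → trans (∑-empty _) (sym (h≡0 i)))
... | no h≢0 with Fin.¬∀⟶∃¬ _ _ (λ i → h i ℚ.≟ 0ℚ) h≢0
... | i , hi≢0 = inj₂ (δ i , (λ ()) , λ eq → hi≢0 (trans (sym (∑-δ h i)) eq))
fredholm {suc m} V h with fredholm (V ∘ suc) (V zero)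
... | inj₁ (z₀ , z₀-sol) with fredholm (V ∘ suc) h
... | inj₁ (z , z-sol) = inj₁ (cons 0ℚ z , λ i → begin
    ∑ (λ j → cons 0ℚ z j * V j i) ≡⟨ ∑-suc (λ j → cons 0ℚ z j * V j i) ⟩
    0ℚ * V zero i + ∑ (λ j → z j * V (suc j) i) ≡⟨ cong₂ _+_ (ℚ.*-zeroˡ (V zero i)) (z-sol i) ⟩
    0ℚ + h i ≡⟨ ℚ.+-identityˡ (h i) ⟩
    h i ∎)
  where open ≡-Reasoning
... | inj₂ (y , yV≡0 , yh≢0) = inj₂ (y , (λ { zero → yV₀≡0 ; (suc j) → yV≡0 j }) , yh≢0)
  where
  open ≡-Reasoning
  yV₀≡0 : y ∙ V zero ≡ 0ℚ
  yV₀≡0 = begin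
    ∑ (λ i → y i * V zero i) ≡⟨ ∑-cong (λ i → cong (y i *_) (z₀-sol i)) ⟨
    ∑ (λ i → y i * ∑ (λ j → z₀ j * V (suc j) i)) ≡⟨ ∑-cong (λ i → *-∑ (y i) (λ j → z₀ j * V (suc j) i)) ⟩
    ∑ (λ i → ∑ (λ j → y i * (z₀ j * V (suc j) i))) ≡⟨ ∑-swap (λ i j → y i * (z₀ j * V (suc j) i)) ⟩
    ∑ (λ j → ∑ (λ i → y i * (z₀ j * V (suc j) i))) ≡⟨ ∑-cong (λ j → trans
      (∑-cong λ i → solve 3 (λ y z v → y :* (z :* v) := z :* (y :* v)) refl (y i) (z₀ j) (V (suc j) i))
      (sym (*-∑ (z₀ j) (λ i → y i * V (suc j) i)))) ⟩
    ∑ (λ j → z₀ j * (y ∙ V (suc j))) ≡⟨ ∑-zero (λ j → trans (cong (z₀ j *_) (yV≡0 j)) (ℚ.*-zeroʳ (z₀ j))) ⟩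
    0ℚ ∎
fredholm {suc m} {r} V h | inj₂ (y₀ , y₀V≡0 , y₀V₀≢0) = shifted (fredholm (V ∘ suc) h′)
  where
  open ≡-Reasoning
  r′ = inverse y₀V₀≢0 .proj₁
  r-inv = inverse y₀V₀≢0 .proj₂
  s = (y₀ ∙ h) * r′
  h′ = λ i → h i + (- s) * V zero i
  y₀h′≡0 : y₀ ∙ h′ ≡ 0ℚ
  y₀h′≡0 = trans (∙-linearʳ y₀ h (V zero) (- s)) (eliminate (y₀ ∙ h) r-inv)
  shifted : (Σ[ z ∈ (Fin m → ℚ) ] (∀ i → ∑ (λ j → z j * V (suc j) i) ≡ h′ i)) ⊎
    (Σ[ y ∈ (Fin r → ℚ) ] (∀ j → y ∙ V (suc j) ≡ 0ℚ) × y ∙ h′ ≢ 0ℚ) →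
    (Σ[ z ∈ (Fin (suc m) → ℚ) ] (∀ i → ∑ (λ j → z j * V j i) ≡ h i)) ⊎
    (Σ[ y ∈ (Fin r → ℚ) ] (∀ j → y ∙ V j ≡ 0ℚ) × y ∙ h ≢ 0ℚ)
  shifted (inj₁ (z , z-sol)) = inj₁ (cons s z , λ i → begin
    ∑ (λ j → cons s z j * V j i) ≡⟨ ∑-suc (λ j → cons s z j * V j i) ⟩
    s * V zero i + ∑ (λ j → z j * V (suc j) i) ≡⟨ cong (s * V zero i +_) (z-sol i) ⟩
    s * V zero i + (h i + (- s) * V zero i) ≡⟨ solve 3 (λ s v h → s :* v :+ (h :+ (:- s) :* v) := h) refl s (V zero i) (h i) ⟩
    h i ∎)
  shifted (inj₂ (y , yV≡0 , yh′≢0)) = inj₂ (y′ , (λ { zero → y′V₀≡0 ; (suc j) → y′V≡0 j }) , λ y′h≡0 → yh′≢0 (begin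
    y ∙ h′ ≡⟨ solve 3 (λ a b t → a := a :+ (:- t) :* con 0ℚ) refl (y ∙ h′) (y₀ ∙ h′) t ⟩
    y ∙ h′ + (- t) * 0ℚ ≡⟨ cong (λ u → y ∙ h′ + (- t) * u) y₀h′≡0 ⟨
    y ∙ h′ + (- t) * (y₀ ∙ h′) ≡⟨ ∙-linearˡ y y₀ h′ (- t) ⟨
    y′ ∙ h′ ≡⟨ ∙-linearʳ y′ h (V zero) (- s) ⟩
    y′ ∙ h + (- s) * (y′ ∙ V zero) ≡⟨ cong₂ (λ a b → a + (- s) * b) y′h≡0 y′V₀≡0 ⟩
    0ℚ + (- s) * 0ℚ ≡⟨ solve 1 (λ s → con 0ℚ :+ (:- s) :* con 0ℚ := con 0ℚ) refl s ⟩
    0ℚ ∎))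
    where
    t = (y ∙ V zero) * r′
    y′ = λ i → y i + (- t) * y₀ i
    y′V₀≡0 : y′ ∙ V zero ≡ 0ℚ
    y′V₀≡0 = trans (∙-linearˡ y y₀ (V zero) (- t)) (eliminate (y ∙ V zero) r-inv)
    y′V≡0 : ∀ j → y′ ∙ V (suc j) ≡ 0ℚ
    y′V≡0 j = begin
      y′ ∙ V (suc j) ≡⟨ ∙-linearˡ y y₀ (V (suc j)) (- t) ⟩
      y ∙ V (suc j) + (- t) * (y₀ ∙ V (suc j)) ≡⟨ cong₂ (λ a b → a + (- t) * b) (yV≡0 j) (y₀V≡0 j) ⟩
      0ℚ + (- t) * 0ℚ ≡⟨ solve 1 (λ t → con 0ℚ :+ (:- t) :* con 0ℚ := con 0ℚ) refl t ⟩
      0ℚ ∎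

-- Scalar inequalities and graph Laplacians

2ℚ : ℚ
2ℚ = 1ℚ + 1ℚ

-- The hypothesis says H(z, z) ≤ 0 for z = x - t c, and completing the square gives H(x,c)² - H(x,x)
-- H(c,c) = (t H(c,c) - H(x,c))² - H(c,c) H(z,z).
reverse-Cauchy-Schwarz : ∀ {hxx hxc hcc} t → 0ℚ ≤ℚ hcc →
  hxx + (- t) * (2ℚ * hxc) + t * t * hcc ≤ℚ 0ℚ → hxx * hcc ≤ℚ hxc * hxc
reverse-Cauchy-Schwarz {a} {b} {c} t 0≤c q≤0 = 0≤q-p⇒p≤q (subst (0ℚ ≤ℚ_)
  (solve 4 (λ a b c t →
     (t :* c :- b) :* (t :* c :- b) :+ c :* (con 0ℚ :- (a :+ (:- t) :* (con 2ℚ :* b) :+ t :* t :* c))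
       := b :* b :- a :* c) refl a b c t)
  (0≤+ (0≤sq (t * c - b)) (0≤* 0≤c (p≤q⇒0≤q-p q≤0))))

-- One summand of the Bochner estimate. For an element of the right colour `v` equals `u * w`, so
-- `a * u ≤ v * v` can be divided by `u` once; a degenerate contraction has no positive `u` and
-- contributes zero on both sides.
row-inequality : ∀ c a u v d w → c ≡ 0ℚ ⊎ c ≡ 1ℚ → d ≡ c * u → c * v ≡ d * w → a * u ≤ℚ v * v →
  0ℚ <ℚ u ⊎ (a ≡ 0ℚ × u ≡ 0ℚ) → c * a ≤ℚ d * (w * w)
row-inequality _ a u v _ w (inj₁ refl) refl _ _ _ = ℚ.≤-reflexive
  (solve 3 (λ a u w → con 0ℚ :* a := con 0ℚ :* u :* (w :* w)) refl a u w)
row-inequality c _ _ v _ w _ refl _ _ (inj₂ (refl , refl)) = ℚ.≤-reflexive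
  (solve 2 (λ c w → c :* con 0ℚ := c :* con 0ℚ :* (w :* w)) refl c w)
row-inequality _ a u v _ w (inj₂ refl) refl v≡uw au≤vv (inj₁ 0<u) =
  ℚ.*-cancelʳ-≤-pos u {{ℚ.positive 0<u}} (subst₂ _≤ℚ_
    (solve 2 (λ a u → a :* u := con 1ℚ :* a :* u) refl a u)
    (begin
      v * v ≡⟨ solve 1 (λ v → v :* v := (con 1ℚ :* v) :* (con 1ℚ :* v)) refl v ⟩
      1ℚ * v * (1ℚ * v) ≡⟨ cong (λ t → t * t) v≡uw ⟩
      1ℚ * u * w * (1ℚ * u * w) ≡⟨ solve 2 (λ u w → con 1ℚ :* u :* w :* (con 1ℚ :* u :* w) := con 1ℚ :* u :* (w :* w) :* u) refl u w ⟩
      1ℚ * u * (w * w) * u ∎)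
    au≤vv)
  where open ≡-Reasoning

module Laplacian {m : ℕ} (L : Fin m → Fin m → ℚ)
  (L-sym : ∀ i j → L i j ≡ L j i) (0≤L : ∀ i j → 0ℚ ≤ℚ L i j) where

  open ≡-Reasoning

  degree : Fin m → ℚ
  degree i = ∑ (L i)

  Δ : (Fin m → ℚ) → Fin m → ℚ
  Δ W i = degree i * W i - ∑ (λ j → L i j * W j)

  Δ-difference : ∀ W i → Δ W i ≡ ∑ (λ j → L i j * (W i - W j))
  Δ-difference W i = begin
    degree i * W i - ∑ (λ j → L i j * W j)
      ≡⟨ cong (_- ∑ (λ j → L i j * W j)) (trans (ℚ.*-comm (degree i) (W i)) (*-∑ (W i) (L i))) ⟩
    ∑ (λ j → W i * L i j) - ∑ (λ j → L i j * W j)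
      ≡⟨ solve 2 (λ a b → a :- b := a :+ (:- con 1ℚ) :* b) refl (∑ (λ j → W i * L i j)) (∑ (λ j → L i j * W j)) ⟩
    ∑ (λ j → W i * L i j) + (- 1ℚ) * ∑ (λ j → L i j * W j)
      ≡⟨ ∑-linear (λ j → W i * L i j) (λ j → L i j * W j) (- 1ℚ) ⟨
    ∑ (λ j → W i * L i j + (- 1ℚ) * (L i j * W j))
      ≡⟨ ∑-cong (λ j → solve 3 (λ w l v → w :* l :+ (:- con 1ℚ) :* (l :* v) := l :* (w :- v)) refl (W i) (L i j) (W j)) ⟩
    ∑ (λ j → L i j * (W i - W j))
      ∎

  energy : (Fin m → ℚ) → ℚ
  energy W = ∑ λ i → ∑ λ j → L i j * ((W i - W j) * (W i - W j))

  0≤summand : ∀ (W : Fin m → ℚ) i j → 0ℚ ≤ℚ L i j * ((W i - W j) * (W i - W j))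
  0≤summand W i j = 0≤* (0≤L i j) (0≤sq (W i - W j))

  0≤energy : ∀ (W : Fin m → ℚ) → 0ℚ ≤ℚ energy W
  0≤energy W = ∑-nonNeg λ i → ∑-nonNeg (0≤summand W i)

  -- Summation by parts; the factor 2 arises because `energy` runs over ordered pairs.
  energy-Δ : ∀ W → energy W ≡ 2ℚ * (W ∙ Δ W)
  energy-Δ W = begin
    energy W
      ≡⟨ ∑-cong (λ i → ∑-cong λ j → solve 3
           (λ l v w → l :* ((v :- w) :* (v :- w)) := v :* (l :* (v :- w)) :+ (w :* (l :* (w :- v))))
           refl (L i j) (W i) (W j)) ⟩
    ∑ (λ i → ∑ (λ j → W i * (L i j * (W i - W j)) + W j * (L i j * (W j - W i))))
      ≡⟨ ∑-cong (λ i → ∑-+ (λ j → W i * (L i j * (W i - W j))) (λ j → W j * (L i j * (W j - W i)))) ⟩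
    ∑ (λ i → ∑ (λ j → W i * (L i j * (W i - W j))) + ∑ (λ j → W j * (L i j * (W j - W i))))
      ≡⟨ ∑-+ (λ i → ∑ (λ j → W i * (L i j * (W i - W j)))) (λ i → ∑ (λ j → W j * (L i j * (W j - W i)))) ⟩
    half + ∑ (λ i → ∑ (λ j → W j * (L i j * (W j - W i))))
      ≡⟨ cong (half +_) (∑-swap (λ i j → W j * (L i j * (W j - W i)))) ⟩
    half + ∑ (λ j → ∑ (λ i → W j * (L i j * (W j - W i))))
      ≡⟨ cong (half +_) (∑-cong λ j → ∑-cong λ i → cong (λ l → W j * (l * (W j - W i))) (L-sym i j)) ⟩
    half + half
      ≡⟨ solve 1 (λ a → a :+ a := con 2ℚ :* a) refl half ⟩
    2ℚ * half
      ≡⟨ cong (2ℚ *_) (∑-cong λ i → trans (sym (*-∑ (W i) (λ j → L i j * (W i - W j)))) (cong (W i *_) (sym (Δ-difference W i)))) ⟩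
    2ℚ * (W ∙ Δ W)
      ∎
    where
    half = ∑ (λ i → ∑ (λ j → W i * (L i j * (W i - W j))))

  locally-constant : ∀ (W : Fin m → ℚ) → energy W ≤ℚ 0ℚ → ∀ i j → L i j * (W i - W j) ≡ 0ℚ
  locally-constant W e≤0 i j = sq≡0 (begin
    L i j * (W i - W j) * (L i j * (W i - W j))
      ≡⟨ solve 2 (λ l d → l :* d :* (l :* d) := l :* (l :* (d :* d))) refl (L i j) (W i - W j) ⟩
    L i j * (L i j * ((W i - W j) * (W i - W j)))
      ≡⟨ cong (L i j *_) (∑-nonNeg≤0 (0≤summand W i)
           (ℚ.≤-reflexive (∑-nonNeg≤0 (λ k → ∑-nonNeg (0≤summand W k)) e≤0 i)) j) ⟩
    L i j * 0ℚ
      ≡⟨ ℚ.*-zeroʳ (L i j) ⟩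
    0ℚ
      ∎)

  0≤W∙Δ : ∀ W → 0ℚ ≤ℚ W ∙ Δ W
  0≤W∙Δ W = ℚ.*-cancelˡ-≤-pos 2ℚ (subst₂ _≤ℚ_ (sym (ℚ.*-zeroʳ 2ℚ)) (energy-Δ W) (0≤energy W))

  opaque

    -- The system is symmetric, so an obstruction `y` from Fredholm's alternative satisfies
    -- `Δ y = 0`. It then has zero energy and is constant along every edge, and such `y` are
    -- orthogonal to `h` by hypothesis.
    solvable : ∀ h → (∀ y → (∀ i j → L i j * (y i - y j) ≡ 0ℚ) → y ∙ h ≡ 0ℚ) →
               Σ[ W ∈ (Fin m → ℚ) ] (∀ i → Δ W i ≡ h i)
    solvable h orthogonal with fredholm V h
      where
      V : Fin m → Fin m → ℚ
      V j i = δ i j * degree i - L i j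
    ... | inj₁ (W , W-sol) = W , λ i → trans (sym (apply W i)) (W-sol i)
      where
      apply : ∀ W i → ∑ (λ j → W j * (δ i j * degree i - L i j)) ≡ Δ W i
      apply W i = begin
        ∑ (λ j → W j * (δ i j * degree i - L i j))
          ≡⟨ ∑-cong (λ j → solve 4 (λ w d p l → w :* (d :* p :- l) := d :* (p :* w) :+ (:- con 1ℚ) :* (l :* w)) refl (W j) (δ i j) (degree i) (L i j)) ⟩
        ∑ (λ j → δ i j * (degree i * W j) + (- 1ℚ) * (L i j * W j))
          ≡⟨ ∑-linear (λ j → δ i j * (degree i * W j)) (λ j → L i j * W j) (- 1ℚ) ⟩
        ∑ (λ j → δ i j * (degree i * W j)) + (- 1ℚ) * ∑ (λ j → L i j * W j)
          ≡⟨ cong (_+ (- 1ℚ) * ∑ (λ j → L i j * W j)) (∑-δ (λ j → degree i * W j) i) ⟩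
        degree i * W i + (- 1ℚ) * ∑ (λ j → L i j * W j)
          ≡⟨ solve 2 (λ a b → a :+ (:- con 1ℚ) :* b := a :- b) refl (degree i * W i) (∑ (λ j → L i j * W j)) ⟩
        Δ W i
          ∎
    ... | inj₂ (y , yV≡0 , yh≢0) = contradiction (orthogonal y (locally-constant y (ℚ.≤-reflexive energy≡0))) yh≢0
      where
      Δy≡0 : ∀ i → Δ y i ≡ 0ℚ
      Δy≡0 i = begin
        Δ y i
          ≡⟨ solve 2 (λ a b → a :- b := a :+ (:- con 1ℚ) :* b) refl (degree i * y i) (∑ (λ j → L i j * y j)) ⟩
        degree i * y i + (- 1ℚ) * ∑ (λ j → L i j * y j)
          ≡⟨ cong (_+ (- 1ℚ) * ∑ (λ j → L i j * y j)) (∑-δ (λ j → degree j * y j) i) ⟨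
        ∑ (λ j → δ i j * (degree j * y j)) + (- 1ℚ) * ∑ (λ j → L i j * y j)
          ≡⟨ ∑-linear (λ j → δ i j * (degree j * y j)) (λ j → L i j * y j) (- 1ℚ) ⟨
        ∑ (λ j → δ i j * (degree j * y j) + (- 1ℚ) * (L i j * y j))
          ≡⟨ ∑-cong (λ j → trans
               (solve 4 (λ w d p l → d :* (p :* w) :+ (:- con 1ℚ) :* (l :* w) := w :* (d :* p :- l)) refl (y j) (δ i j) (degree j) (L i j))
               (cong₂ (λ d l → y j * (d * degree j - l)) (δ-sym i j) (L-sym i j))) ⟩
        ∑ (λ j → y j * (δ j i * degree j - L j i))
          ≡⟨ yV≡0 i ⟩
        0ℚ
          ∎
      energy≡0 : energy y ≡ 0ℚ
      energy≡0 = begin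
        energy y ≡⟨ energy-Δ y ⟩
        2ℚ * ∑ (λ i → y i * Δ y i) ≡⟨ cong (2ℚ *_) (∑-zero λ i → *-≡0ʳ (y i) (Δy≡0 i)) ⟩
        2ℚ * 0ℚ ≡⟨ ℚ.*-zeroʳ 2ℚ ⟩
        0ℚ ∎

  -- The Bochner step: hxx and h stand for H(x, x) and (cᵢ H(x, eᵢ))ᵢ, and
  -- the hypothesis bounds H(z, z) for z = x + c W, where Δ W = h.
  module _ {hxx : ℚ} (W : Fin m → ℚ)
    (bound : hxx + 2ℚ * (W ∙ Δ W) + W ∙ (λ i → ∑ (λ j → L i j * W j)) ≤ℚ ∑ (λ i → degree i * (W i * W i))) where

    private
      s = W ∙ Δ W

      diagonal : ∑ (λ i → degree i * (W i * W i)) ≡ W ∙ (λ i → ∑ (λ j → L i j * W j)) + s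
      diagonal = begin
        ∑ (λ i → degree i * (W i * W i))
          ≡⟨ ∑-cong (λ i → solve 3 (λ d w u → d :* (w :* w) := w :* u :+ w :* (d :* w :- u)) refl (degree i) (W i) (∑ (λ j → L i j * W j))) ⟩
        ∑ (λ i → W i * ∑ (λ j → L i j * W j) + W i * Δ W i)
          ≡⟨ ∑-+ (λ i → W i * ∑ (λ j → L i j * W j)) (λ i → W i * Δ W i) ⟩
        W ∙ (λ i → ∑ (λ j → L i j * W j)) + s
          ∎

      q = W ∙ (λ i → ∑ (λ j → L i j * W j))

    -- The degree term on the right of `bound` is `q + s`: the quadratic parts `q` cancel and one of
    -- the two copies of `s` survives.
    hxx+s≤0 : hxx + W ∙ Δ W ≤ℚ 0ℚ
    hxx+s≤0 = 0≤q-p⇒p≤q (subst (0ℚ ≤ℚ_)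
      (solve 3 (λ x s q → (q :+ s) :- (x :+ con 2ℚ :* s :+ q) := con 0ℚ :- (x :+ s)) refl hxx s q)
      (p≤q⇒0≤q-p (subst (hxx + 2ℚ * s + q ≤ℚ_) diagonal bound)))

    hxx≤0 : hxx ≤ℚ 0ℚ
    hxx≤0 = ℚ.≤-trans (subst (_≤ℚ hxx + s) (ℚ.+-identityʳ hxx) (ℚ.+-monoʳ-≤ hxx (0≤W∙Δ W))) hxx+s≤0

    -- Equality leaves no room for the nonnegative term `s`, which is half the energy; so `W` is
    -- locally constant.
    hxx≡0⇒Δ≡0 : hxx ≡ 0ℚ → ∀ i → Δ W i ≡ 0ℚ
    hxx≡0⇒Δ≡0 hxx≡0 i = trans (Δ-difference W i) (∑-zero (locally-constant W energy≤0 i))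
      where
      s≤0 : s ≤ℚ 0ℚ
      s≤0 = subst (_≤ℚ 0ℚ) (trans (cong (_+ s) hxx≡0) (ℚ.+-identityˡ s)) hxx+s≤0
      energy≤0 : energy W ≤ℚ 0ℚ
      energy≤0 = subst₂ _≤ℚ_ (sym (energy-Δ W)) (ℚ.*-zeroʳ 2ℚ) (ℚ.*-monoˡ-≤-nonNeg 2ℚ s≤0)

module _ {m : ℕ} where

  infixl 6 _⊕_

  _⊕_ : Subset m → Fin m → Subset m
  S ⊕ e = S ∪ ⁅ e ⁆

  ∈-⊕ : ∀ {S} {e f : Fin m} → f ∈ S ⊕ e → f ∈ S ⊎ f ≡ e
  ∈-⊕ {S} {e} f∈ with Sub.x∈p∪q⁻ S ⁅ e ⁆ f∈
  ... | inj₁ f∈S = inj₁ f∈S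
  ... | inj₂ f∈e = inj₂ (Sub.x∈⁅y⁆⇒x≡y e f∈e)

  ∉-⊕ : ∀ {S e} {f : Fin m} → f ∉ S → f ≢ e → f ∉ S ⊕ e
  ∉-⊕ f∉S f≢e f∈ with ∈-⊕ f∈
  ... | inj₁ f∈S = f∉S f∈S
  ... | inj₂ f≡e = f≢e f≡e

  ⊆-⊕ : ∀ {S : Subset m} {e} → S ⊆ S ⊕ e
  ⊆-⊕ {S} {e} = Sub.p⊆p∪q ⁅ e ⁆

  self-∈-⊕ : ∀ {S : Subset m} {e} → e ∈ S ⊕ e
  self-∈-⊕ {S} {e} = Sub.q⊆p∪q S ⁅ e ⁆ (Sub.x∈⁅x⁆ e)

  ⊕-comm : ∀ (S : Subset m) e f → S ⊕ e ⊕ f ≡ S ⊕ f ⊕ e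
  ⊕-comm S e f = begin
    (S ∪ ⁅ e ⁆) ∪ ⁅ f ⁆ ≡⟨ Sub.∪-assoc S ⁅ e ⁆ ⁅ f ⁆ ⟩
    S ∪ (⁅ e ⁆ ∪ ⁅ f ⁆) ≡⟨ cong (S ∪_) (Sub.∪-comm ⁅ e ⁆ ⁅ f ⁆) ⟩
    S ∪ (⁅ f ⁆ ∪ ⁅ e ⁆) ≡⟨ Sub.∪-assoc S ⁅ f ⁆ ⁅ e ⁆ ⟨
    (S ∪ ⁅ f ⁆) ∪ ⁅ e ⁆ ∎
    where open ≡-Reasoning

  ⊕-absorb : ∀ {S : Subset m} {e} → e ∈ S → S ⊕ e ≡ S
  ⊕-absorb {S} {e} e∈S = Sub.⊆-antisym (λ {f} f∈ → absorb (∈-⊕ f∈)) ⊆-⊕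
    where
    absorb : ∀ {f} → f ∈ S ⊎ f ≡ e → f ∈ S
    absorb (inj₁ f∈S) = f∈S
    absorb (inj₂ refl) = e∈S

card-⊕ : ∀ {m} {S : Subset m} {e} → e ∉ S → card (S ⊕ e) ≡ suc (card S)
card-⊕ {S = true Vec.∷ S} {zero} e∉S = contradiction Vec.here e∉S
card-⊕ {S = false Vec.∷ S} {zero} e∉S = cong (suc ∘ card) (Sub.∪-identityʳ S)
card-⊕ {S = true Vec.∷ S} {suc e} e∉S = cong suc (card-⊕ (e∉S ∘ Vec.there))
card-⊕ {S = false Vec.∷ S} {suc e} e∉S = card-⊕ (e∉S ∘ Vec.there)

card-⊕-≤ : ∀ {m} (S : Subset m) e → card (S ⊕ e) ≤ suc (card S)
card-⊕-≤ S e with e Sub.∈? S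
... | yes e∈S = ℕ.≤-trans (ℕ.≤-reflexive (cong card (⊕-absorb e∈S))) (ℕ.n≤1+n _)
... | no e∉S = ℕ.≤-reflexive (card-⊕ e∉S)

-- Class sums of a partial equivalence relation

≤∧≢⇒< : ∀ {p q} → p ≤ℚ q → p ≢ q → p <ℚ q
≤∧≢⇒< {p} {q} p≤q p≢q with ℚ.<-cmp p q
... | tri< p<q _ _ = p<q
... | tri≈ _ p≡q _ = contradiction p≡q p≢q
... | tri> _ _ q<p = contradiction (ℚ.≤-antisym p≤q (ℚ.<⇒≤ q<p)) p≢q

-- The default 0 at 0 serves elements that lie in no class, whose `size` is zero.
reciprocal : ℚ → ℚ
reciprocal q with q ℚ.≟ 0ℚ
... | yes _ = 0ℚ
... | no q≢0 = inverse q≢0 .proj₁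

*-reciprocal : ∀ {q} → q ≢ 0ℚ → q * reciprocal q ≡ 1ℚ
*-reciprocal {q} q≢0 with q ℚ.≟ 0ℚ
... | yes q≡0 = contradiction q≡0 q≢0
... | no q≢0′ = inverse q≢0′ .proj₂

0≤reciprocal : ∀ {q} → 0ℚ ≤ℚ q → 0ℚ ≤ℚ reciprocal q
0≤reciprocal {q} 0≤q with q ℚ.≟ 0ℚ
... | yes _ = ℚ.≤-refl
... | no q≢0 = ℚ.<⇒≤ (ℚ.positive⁻¹ _ {{ℚ.1/pos⇒pos q {{ℚ.positive (≤∧≢⇒< 0≤q (q≢0 ∘ sym))}}}})

module Classes {m : ℕ} {K : Fin m → Fin m → Set} (K? : ∀ e f → Dec (K e f))
  (K-sym : ∀ {e f} → K e f → K f e) (K-trans : ∀ {e f g} → K e f → K f g → K e g) where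

  open ≡-Reasoning

  κ : Fin m → Fin m → ℚ
  κ e f = 𝟙 (K? e f)

  κ-resp : ∀ {e f} → K e f → ∀ g → κ e g ≡ κ f g
  κ-resp {e} {f} e~f g with K? e g
  ... | yes k = sym (𝟙-yes (K? f g) (K-trans (K-sym e~f) k))
  ... | no ¬k = sym (𝟙-no (K? f g) (¬k ∘ K-trans e~f))

  size : Fin m → ℚ
  size e = ∑ (κ e)

  weight : (Fin m → ℚ) → Fin m → ℚ
  weight x e = ∑ λ f → κ e f * x f

  0≤size : ∀ e → 0ℚ ≤ℚ size e
  0≤size e = ∑-nonNeg λ f → 0≤𝟙 (K? e f)

  size≢0 : ∀ {e} → K e e → size e ≢ 0ℚ
  size≢0 {e} k = pos⇒≢0 (∑-pos (λ f → 0≤𝟙 (K? e f)) e (subst (0ℚ <ℚ_) (sym (𝟙-yes (K? e e) k)) 0<1))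

  r : Fin m → ℚ
  r e = reciprocal (size e)

  -- A sum over classes written as a sum over elements: a class is met once for each of its members,
  -- and `r` divides by their number. No representatives have to be chosen.
  average : ∀ (x φ : Fin m → ℚ) → (∀ {e f} → K e f → φ e ≡ φ f) → (∀ e → size e ≡ 0ℚ → φ e ≡ 0ℚ) →
            x ∙ φ ≡ ∑ (λ e → r e * φ e * weight x e)
  average x φ φ-resp φ-supp = sym (begin
    ∑ (λ e → r e * φ e * weight x e)
      ≡⟨ ∑-cong (λ e → *-∑ (r e * φ e) (λ f → κ e f * x f)) ⟩
    ∑ (λ e → ∑ (λ f → r e * φ e * (κ e f * x f)))
      ≡⟨ ∑-swap (λ e f → r e * φ e * (κ e f * x f)) ⟩
    ∑ (λ f → ∑ (λ e → r e * φ e * (κ e f * x f)))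
      ≡⟨ ∑-cong (λ f → ∑-cong λ e → move f e) ⟩
    ∑ (λ f → ∑ (λ e → x f * (r f * φ f) * κ f e))
      ≡⟨ ∑-cong (λ f → sym (*-∑ (x f * (r f * φ f)) (κ f))) ⟩
    ∑ (λ f → x f * (r f * φ f) * size f)
      ≡⟨ ∑-cong (λ f → cancel f (size f ℚ.≟ 0ℚ)) ⟩
    x ∙ φ
      ∎)
    where
    move : ∀ f e → r e * φ e * (κ e f * x f) ≡ x f * (r f * φ f) * κ f e
    move f e with K? e f
    ... | yes k = begin
      r e * φ e * (1ℚ * x f) ≡⟨ cong₂ (λ a b → a * b * (1ℚ * x f)) (cong reciprocal (∑-cong (κ-resp k))) (φ-resp k) ⟩
      r f * φ f * (1ℚ * x f) ≡⟨ solve 3 (λ a b c → a :* b :* (con 1ℚ :* c) := c :* (a :* b) :* con 1ℚ) refl (r f) (φ f) (x f) ⟩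
      x f * (r f * φ f) * 1ℚ ≡⟨ cong (x f * (r f * φ f) *_) (𝟙-yes (K? f e) (K-sym k)) ⟨
      x f * (r f * φ f) * κ f e ∎
    ... | no ¬k = begin
      r e * φ e * (0ℚ * x f) ≡⟨ solve 3 (λ a b c → a :* (con 0ℚ :* b) := c :* con 0ℚ) refl (r e * φ e) (x f) (x f * (r f * φ f)) ⟩
      x f * (r f * φ f) * 0ℚ ≡⟨ cong (x f * (r f * φ f) *_) (𝟙-no (K? f e) (¬k ∘ K-sym)) ⟨
      x f * (r f * φ f) * κ f e ∎
    cancel : ∀ f → Dec (size f ≡ 0ℚ) → x f * (r f * φ f) * size f ≡ x f * φ f
    cancel f (yes s≡0) = begin
      x f * (r f * φ f) * size f ≡⟨ cong (x f * (r f * φ f) *_) s≡0 ⟩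
      x f * (r f * φ f) * 0ℚ ≡⟨ solve 2 (λ a b → b :* con 0ℚ := a :* con 0ℚ) refl (x f) (x f * (r f * φ f)) ⟩
      x f * 0ℚ ≡⟨ cong (x f *_) (φ-supp f s≡0) ⟨
      x f * φ f ∎
    cancel f (no s≢0) = begin
      x f * (reciprocal (size f) * φ f) * size f ≡⟨ solve 4 (λ a b c d → a :* (b :* c) :* d := a :* (c :* (d :* b))) refl (x f) (r f) (φ f) (size f) ⟩
      x f * (φ f * (size f * reciprocal (size f))) ≡⟨ cong (λ a → x f * (φ f * a)) (*-reciprocal s≢0) ⟩
      x f * (φ f * 1ℚ) ≡⟨ cong (x f *_) (ℚ.*-identityʳ (φ f)) ⟩
      x f * φ f ∎

  weight-resp : ∀ x {e f} → K e f → weight x e ≡ weight x f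
  weight-resp x e~f = ∑-cong λ g → cong (_* x g) (κ-resp e~f g)

  weight-supp : ∀ x e → size e ≡ 0ℚ → weight x e ≡ 0ℚ
  weight-supp x e s≡0 = ∑-zero λ f → trans
    (cong (_* x f) (∑-nonNeg≤0 (λ g → 0≤𝟙 (K? e g)) (ℚ.≤-reflexive s≡0) f)) (ℚ.*-zeroˡ (x f))

  square : ∀ x → x ∙ weight x ≡ ∑ (λ e → r e * weight x e * weight x e)
  square x = average x (weight x) (weight-resp x) (weight-supp x)

  0≤summand : ∀ x e → 0ℚ ≤ℚ r e * weight x e * weight x e
  0≤summand x e = subst (0ℚ ≤ℚ_) (sym (ℚ.*-assoc (r e) (weight x e) (weight x e)))
    (0≤* (0≤reciprocal (0≤size e)) (0≤sq (weight x e)))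

  positive-semidefinite : ∀ x → 0ℚ ≤ℚ x ∙ weight x
  positive-semidefinite x = subst (0ℚ ≤ℚ_) (sym (square x)) (∑-nonNeg (0≤summand x))

  isotropic⇒weight≡0 : ∀ x → x ∙ weight x ≤ℚ 0ℚ → ∀ e → weight x e ≡ 0ℚ
  isotropic⇒weight≡0 x q≤0 e with size e ℚ.≟ 0ℚ
  ... | yes s≡0 = weight-supp x e s≡0
  ... | no s≢0 = sq≡0 (begin
    weight x e * weight x e
      ≡⟨ solve 1 (λ a → a := con 1ℚ :* a) refl (weight x e * weight x e) ⟩
    1ℚ * (weight x e * weight x e)
      ≡⟨ cong (_* (weight x e * weight x e)) (*-reciprocal s≢0) ⟨
    size e * r e * (weight x e * weight x e)
      ≡⟨ solve 3 (λ a b c → a :* b :* (c :* c) := a :* (b :* c :* c)) refl (size e) (r e) (weight x e) ⟩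
    size e * (r e * weight x e * weight x e)
      ≡⟨ cong (size e *_) (∑-nonNeg≤0 (0≤summand x) (subst (_≤ℚ 0ℚ) (square x) q≤0) e) ⟩
    size e * 0ℚ
      ≡⟨ ℚ.*-zeroʳ (size e) ⟩
    0ℚ
      ∎)

-- Mixed discriminants and the reverse Cauchy–Schwarz inequality

module Mixed {m : ℕ} (M : Matroid m) (n : ℕ) where

  open Matroid M
  open ≡-Reasoning

  basis? : ∀ S → Dec (Indep S × card S ≡ n)
  basis? S = indep? S ×-dec (card S ℕ.≟ n)

  β : Subset m → ℚ
  β S = 𝟙 (basis? S)

  opaque

    -- The mixed discriminant after contraction of S: a basis counts once for
    -- each of its orderings, and β excludes repeated elements.
    D : List (Fin m → ℚ) → Subset m → ℚ
    D [] S = β S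
    D (x ∷ xs) S = ∑ λ e → x e * D xs (S ⊕ e)

    D-[] : ∀ S → D [] S ≡ β S
    D-[] S = refl

    D-∷ : ∀ x xs S → D (x ∷ xs) S ≡ ∑ (λ e → x e * D xs (S ⊕ e))
    D-∷ x xs S = refl

    D-swap : ∀ x y xs S → D (x ∷ y ∷ xs) S ≡ D (y ∷ x ∷ xs) S
    D-swap x y xs S = begin
      ∑ (λ e → x e * ∑ (λ f → y f * D xs (S ⊕ e ⊕ f)))
        ≡⟨ ∑-cong (λ e → *-∑ (x e) (λ f → y f * D xs (S ⊕ e ⊕ f))) ⟩
      ∑ (λ e → ∑ (λ f → x e * (y f * D xs (S ⊕ e ⊕ f))))
        ≡⟨ ∑-swap (λ e f → x e * (y f * D xs (S ⊕ e ⊕ f))) ⟩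
      ∑ (λ f → ∑ (λ e → x e * (y f * D xs (S ⊕ e ⊕ f))))
        ≡⟨ ∑-cong (λ f → ∑-cong λ e → trans
             (solve 3 (λ a b d → a :* (b :* d) := b :* (a :* d)) refl (x e) (y f) (D xs (S ⊕ e ⊕ f)))
             (cong (λ T → y f * (x e * D xs T)) (⊕-comm S e f))) ⟩
      ∑ (λ f → ∑ (λ e → y f * (x e * D xs (S ⊕ f ⊕ e))))
        ≡⟨ ∑-cong (λ f → *-∑ (y f) (λ e → x e * D xs (S ⊕ f ⊕ e))) ⟨
      ∑ (λ f → y f * ∑ (λ e → x e * D xs (S ⊕ f ⊕ e)))
        ∎

    D-cons : ∀ x xs ys → (∀ S → D xs S ≡ D ys S) → ∀ S → D (x ∷ xs) S ≡ D (x ∷ ys) S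
    D-cons x xs ys eq S = ∑-cong λ e → cong (x e *_) (eq (S ⊕ e))

    D-↭ : ∀ {xs ys} → xs ↭ ys → ∀ S → D xs S ≡ D ys S
    D-↭ Perm.refl S = refl
    D-↭ (Perm.prep {xs} {ys} x p) S = D-cons x xs ys (D-↭ p) S
    D-↭ (Perm.swap {xs} {ys} x y p) S = trans (D-swap x y xs S)
      (D-cons y (x ∷ xs) (x ∷ ys) (D-cons x xs ys (D-↭ p)) S)
    D-↭ (Perm.trans p q) S = trans (D-↭ p S) (D-↭ q S)

    D-linear : ∀ x y t xs S → D ((λ e → x e + t * y e) ∷ xs) S ≡ D (x ∷ xs) S + t * D (y ∷ xs) S
    D-linear x y t xs S = ∙-linearˡ x y (λ e → D xs (S ⊕ e)) t

    D-dependent : ∀ xs S → ¬ Indep S → D xs S ≡ 0ℚ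
    D-dependent [] S ¬ind = 𝟙-no (basis? S) (¬ind ∘ proj₁)
    D-dependent (x ∷ xs) S ¬ind = ∑-zero λ e → trans
      (cong (x e *_) (D-dependent xs (S ⊕ e) (¬ind ∘ hereditary ⊆-⊕))) (ℚ.*-zeroʳ (x e))

    D-short : ∀ xs S → card S ℕ.+ length xs < n → D xs S ≡ 0ℚ
    D-short [] S small = 𝟙-no (basis? S) λ p → ℕ.<⇒≢ small (trans (ℕ.+-identityʳ (card S)) (p .proj₂))
    D-short (x ∷ xs) S small = ∑-zero λ e → trans
      (cong (x e *_) (D-short xs (S ⊕ e) (ℕ.≤-<-trans (ℕ.+-monoˡ-≤ (length xs) (card-⊕-≤ S e))
        (subst (_< n) (ℕ.+-suc (card S) (length xs)) small)))) (ℚ.*-zeroʳ (x e))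

    0≤D : ∀ xs → (∀ S → 0ℚ ≤ℚ D xs S) → ∀ {x : Fin m → ℚ} → (∀ e → 0ℚ ≤ℚ x e) → ∀ S → 0ℚ ≤ℚ D (x ∷ xs) S
    0≤D xs 0≤xs 0≤x S = ∑-nonNeg λ e → 0≤* (0≤x e) (0≤xs (S ⊕ e))

  D-linear₂ : ∀ z x y t xs S →
    D (z ∷ (λ e → x e + t * y e) ∷ xs) S ≡ D (z ∷ x ∷ xs) S + t * D (z ∷ y ∷ xs) S
  D-linear₂ z x y t xs S = begin
    D (z ∷ (λ e → x e + t * y e) ∷ xs) S ≡⟨ D-swap z (λ e → x e + t * y e) xs S ⟩
    D ((λ e → x e + t * y e) ∷ z ∷ xs) S ≡⟨ D-linear x y t (z ∷ xs) S ⟩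
    D (x ∷ z ∷ xs) S + t * D (y ∷ z ∷ xs) S ≡⟨ cong₂ (λ a b → a + t * b) (D-swap x z xs S) (D-swap y z xs S) ⟩
    D (z ∷ x ∷ xs) S + t * D (z ∷ y ∷ xs) S ∎

  D-square : ∀ x y t xs S →
    D ((λ e → x e + t * y e) ∷ (λ e → x e + t * y e) ∷ xs) S ≡
    D (x ∷ x ∷ xs) S + t * (2ℚ * D (x ∷ y ∷ xs) S) + t * t * D (y ∷ y ∷ xs) S
  D-square x y t xs S = begin
    D (z ∷ z ∷ xs) S
      ≡⟨ D-linear x y t (z ∷ xs) S ⟩
    D (x ∷ z ∷ xs) S + t * D (y ∷ z ∷ xs) S
      ≡⟨ cong₂ (λ a b → a + t * b) (D-linear₂ x x y t xs S) (D-linear₂ y x y t xs S) ⟩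
    xx + t * xy + t * (D (y ∷ x ∷ xs) S + t * yy)
      ≡⟨ cong (λ a → xx + t * xy + t * (a + t * yy)) (D-swap y x xs S) ⟩
    xx + t * xy + t * (xy + t * yy)
      ≡⟨ solve 4 (λ a b c t → a :+ t :* b :+ t :* (b :+ t :* c) := a :+ t :* (con 2ℚ :* b) :+ t :* t :* c) refl xx xy yy t ⟩
    xx + t * (2ℚ * xy) + t * t * yy
      ∎
    where
    z = λ e → x e + t * y e
    xx = D (x ∷ x ∷ xs) S
    xy = D (x ∷ y ∷ xs) S
    yy = D (y ∷ y ∷ xs) S

  Extends : Subset m → Fin m → Set
  Extends S e = Indep (S ⊕ e) × card (S ⊕ e) ≡ suc (card S)

  extends? : ∀ S e → Dec (Extends S e)
  extends? S e = indep? (S ⊕ e) ×-dec (card (S ⊕ e) ℕ.≟ suc (card S))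

  ∉⇒extends : ∀ {S e} → e ∉ S → Indep (S ⊕ e) → Extends S e
  ∉⇒extends e∉S ind = ind , card-⊕ e∉S

  extends⇒∉ : ∀ {S e} → Extends S e → e ∉ S
  extends⇒∉ {S} {e} (_ , c) e∈S = ℕ.1+n≢n (trans (sym c) (cong card (⊕-absorb e∈S)))

  -- Either `e` already lies in `S`, and the list is too short to reach `n` elements, or `S ⊕ e` is
  -- dependent.
  D-nonextending : ∀ xs S e → card S ℕ.+ suc (length xs) ≤ n → ¬ Extends S e → D xs (S ⊕ e) ≡ 0ℚ
  D-nonextending xs S e c≤n ¬ext with e Sub.∈? S
  ... | yes e∈S = trans (cong (D xs) (⊕-absorb e∈S)) (D-short xs S (subst (_≤ n) (ℕ.+-suc (card S) (length xs)) c≤n))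
  ... | no e∉S = D-dependent xs (S ⊕ e) λ ind → ¬ext (∉⇒extends e∉S ind)

  -- Augmentation of `S ⊕ e` from the larger set `S ⊕ f ⊕ g`; the new element cannot come from `S`.
  exchange : ∀ {S e f g} → Extends S e → Extends (S ⊕ f) g → Extends S f → Extends (S ⊕ e) f ⊎ Extends (S ⊕ e) g
  exchange {S} {e} {f} {g} (indSe , cSe) (indSfg , cSfg) (_ , cSf)
    with augmentation indSe indSfg (ℕ.≤-reflexive (trans (cong suc cSe) (trans (cong suc (sym cSf)) (sym cSfg))))
  ... | h , h∈ , h∉ , ind with ∈-⊕ h∈
  ... | inj₂ refl = inj₂ (∉⇒extends h∉ ind)
  ... | inj₁ h∈Sf with ∈-⊕ h∈Sf
  ... | inj₁ h∈S = contradiction (⊆-⊕ h∈S) h∉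
  ... | inj₂ refl = inj₁ (∉⇒extends h∉ ind)

  extends-swap : ∀ {S e f} → Extends S e → Extends (S ⊕ e) f → Extends S f → Extends (S ⊕ f) e
  extends-swap {S} {e} {f} (_ , cSe) (indSef , cSef) (_ , cSf) =
    subst Indep (⊕-comm S e f) indSef ,
    trans (cong card (⊕-comm S f e)) (trans cSef (cong suc (trans cSe (sym cSf))))

  -- Parallelism in the contraction by `S`. Loops of the contraction lie in no class, while an
  -- extending `e` is parallel to itself because it cannot be added twice.
  Parallel : Subset m → Fin m → Fin m → Set
  Parallel S e f = (Extends S e × Extends S f) × ¬ Extends (S ⊕ e) f

  parallel? : ∀ S e f → Dec (Parallel S e f)
  parallel? S e f = (extends? S e ×-dec extends? S f) ×-dec ¬? (extends? (S ⊕ e) f)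

  parallel-sym : ∀ {S e f} → Parallel S e f → Parallel S f e
  parallel-sym ((Se , Sf) , ¬Sef) = (Sf , Se) , λ Sfe → ¬Sef (extends-swap Sf Sfe Se)

  parallel-trans : ∀ {S e f g} → Parallel S e f → Parallel S f g → Parallel S e g
  parallel-trans ((Se , Sf) , ¬Sef) ((_ , Sg) , ¬Sfg) = (Se , Sg) , λ Seg → case exchange Sf Seg Se of λ
    { (inj₁ Sfe) → ¬Sef (extends-swap Sf Sfe Se)
    ; (inj₂ Sfg) → ¬Sfg Sfg
    }

  parallel-refl : ∀ {S e} → Extends S e → Parallel S e e
  parallel-refl Se = (Se , Se) , λ See → extends⇒∉ See self-∈-⊕

-- Positivity, and the form of a rank two contraction

module Lorentzian {m : ℕ} (M : Matroid m) (R : Subset m) (n : ℕ)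
  (extend : ∀ b {S} → Matroid.Indep M S → card S < n →
            ∃[ e ] lookup R e ≡ b × e ∉ S × Matroid.Indep M (S ⊕ e)) where

  open Matroid M
  open Mixed M n
  open ≡-Reasoning

  opaque

    χ : Bool → Fin m → ℚ
    χ b e = 𝟙 (lookup R e Bool.≟ b)

    0≤χ : ∀ b e → 0ℚ ≤ℚ χ b e
    0≤χ b e = 0≤𝟙 (lookup R e Bool.≟ b)

    χ≡1 : ∀ {b e} → lookup R e ≡ b → χ b e ≡ 1ℚ
    χ≡1 {b} {e} = 𝟙-yes (lookup R e Bool.≟ b)

    χ≡0 : ∀ {b e} → lookup R e ≢ b → χ b e ≡ 0ℚ
    χ≡0 {b} {e} = 𝟙-no (lookup R e Bool.≟ b)

  χs : List Bool → List (Fin m → ℚ)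
  χs = map χ

  0≤Dχ : ∀ cs S → 0ℚ ≤ℚ D (χs cs) S
  0≤Dχ [] S = subst (0ℚ ≤ℚ_) (sym (D-[] S)) (0≤𝟙 (basis? S))
  0≤Dχ (c ∷ cs) S = 0≤D (χs cs) (0≤Dχ cs) (0≤χ c) S

  ⊕-fits : ∀ {S e k} → Extends S e → card S ℕ.+ suc k ≡ n → card (S ⊕ e) ℕ.+ k ≡ n
  ⊕-fits {S} {k = k} (_ , c) eq = trans (cong (ℕ._+ k) c) (trans (sym (ℕ.+-suc (card S) k)) eq)

  extend′ : ∀ b {S k} → Indep S → card S ℕ.+ suc k ≡ n → ∃[ e ] lookup R e ≡ b × Extends S e
  extend′ b {S} {k} ind eq with extend b ind (subst (card S <_) eq (ℕ.m<m+n (card S) (s≤s z≤n)))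
  ... | e , Re≡b , e∉S , ind⊕ = e , Re≡b , ∉⇒extends e∉S ind⊕

  0<Dχ : ∀ cs S → Indep S → card S ℕ.+ length cs ≡ n → 0ℚ <ℚ D (χs cs) S
  0<Dχ [] S ind eq = subst (0ℚ <ℚ_) (sym (trans (D-[] S) (𝟙-yes (basis? S) (ind , trans (sym (ℕ.+-identityʳ (card S))) eq)))) 0<1
  0<Dχ (c ∷ cs) S ind eq with extend′ c ind eq
  ... | e , Re≡c , ext = subst (0ℚ <ℚ_) (sym (D-∷ (χ c) (χs cs) S)) (∑-pos (λ f → 0≤* (0≤χ c f) (0≤Dχ cs (S ⊕ f))) e
    (0<* (subst (0ℚ <ℚ_) (sym (χ≡1 Re≡c)) 0<1) (0<Dχ cs (S ⊕ e) (ext .proj₁) (⊕-fits ext eq))))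

  -- The induction passes through `S ⊕ i` for all `i`, also when `i` lies in `S` or makes it
  -- dependent; in these degenerate cases every mixed discriminant of the relevant length is zero.
  dichotomy : ∀ k S → card S ℕ.+ k ≤ n →
    (Indep S × card S ℕ.+ k ≡ n) ⊎ (∀ xs → length xs ≡ k → D xs S ≡ 0ℚ)
  dichotomy k S c≤n with indep? S | ℕ.m≤n⇒m<n∨m≡n c≤n
  ... | no ¬ind | _ = inj₂ λ xs _ → D-dependent xs S ¬ind
  ... | yes _ | inj₁ c<n = inj₂ λ { xs refl → D-short xs S c<n }
  ... | yes ind | inj₂ c≡n = inj₁ (ind , c≡n)

  -- The Lorentzian signature is tested on a single hyperplane transversal to `χ b`: any `x` can be
  -- shifted along `χ b` into the kernel of `ℓ`, where the form is nonpositive.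
  hyperplane⇒reverse-CS : ∀ xs S b (ℓ : (Fin m → ℚ) → ℚ) →
    (∀ x y t → ℓ (λ e → x e + t * y e) ≡ ℓ x + t * ℓ y) → ℓ (χ b) ≢ 0ℚ →
    0ℚ ≤ℚ D (χ b ∷ χ b ∷ xs) S → (∀ z → ℓ z ≡ 0ℚ → D (z ∷ z ∷ xs) S ≤ℚ 0ℚ) →
    ∀ x → D (x ∷ x ∷ xs) S * D (χ b ∷ χ b ∷ xs) S ≤ℚ D (x ∷ χ b ∷ xs) S * D (x ∷ χ b ∷ xs) S
  hyperplane⇒reverse-CS xs S b ℓ ℓ-linear ℓb≢0 0≤bb neg x =
    reverse-Cauchy-Schwarz {D (x ∷ x ∷ xs) S} {D (x ∷ χ b ∷ xs) S} {D (χ b ∷ χ b ∷ xs) S} t 0≤bb (subst (_≤ℚ 0ℚ)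
      (trans (D-square x (χ b) (- t) xs S)
        (cong (D (x ∷ x ∷ xs) S + (- t) * (2ℚ * D (x ∷ χ b ∷ xs) S) +_)
          (solve 2 (λ t q → (:- t) :* (:- t) :* q := t :* t :* q) refl t (D (χ b ∷ χ b ∷ xs) S))))
      (neg (λ e → x e + (- t) * χ b e) (trans (ℓ-linear x (χ b) (- t)) (eliminate (ℓ x) r-inv))))
    where
    r = inverse ℓb≢0 .proj₁
    r-inv = inverse ℓb≢0 .proj₂
    t = ℓ x * r

  module RankTwo (S : Subset m) (ind : Indep S) (fits : card S ℕ.+ 2 ≡ n) where

    module P = Classes (parallel? S) parallel-sym parallel-trans

    u : Fin m → ℚ
    u e = 𝟙 (extends? S e)

    basis⇒extends : ∀ {e f} → Indep (S ⊕ e ⊕ f) × card (S ⊕ e ⊕ f) ≡ n → Extends S e × Extends (S ⊕ e) f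
    basis⇒extends {e} {f} (indSef , cSef) = (hereditary ⊆-⊕ indSef , cSe) , (indSef , trans cSef (trans n≡ (cong suc (sym cSe))))
      where
      n≡ : n ≡ suc (suc (card S))
      n≡ = trans (sym fits) (ℕ.+-comm (card S) 2)
      cSe : card (S ⊕ e) ≡ suc (card S)
      cSe = ℕ.≤-antisym (card-⊕-≤ S e)
        (ℕ.≤-pred (ℕ.≤-trans (ℕ.≤-reflexive (trans (sym n≡) (sym cSef))) (card-⊕-≤ (S ⊕ e) f)))

    extends⇒basis : ∀ {e f} → Extends S e → Extends (S ⊕ e) f → Indep (S ⊕ e ⊕ f) × card (S ⊕ e ⊕ f) ≡ n
    extends⇒basis (_ , cSe) (indSef , cSef) = indSef , trans cSef (trans (cong suc cSe) (trans (ℕ.+-comm 2 (card S)) fits))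

    -- In rank two a pair of non-loops is a basis unless it is parallel.
    β-split : ∀ e f → β (S ⊕ e ⊕ f) ≡ u e * u f - P.κ e f
    β-split e f = by-cases (extends? S e) (extends? S f) (extends? (S ⊕ e) f)
      where
      value : ∀ {a b c d} → β (S ⊕ e ⊕ f) ≡ a → u e ≡ b → u f ≡ c → P.κ e f ≡ d → a ≡ b * c - d →
              β (S ⊕ e ⊕ f) ≡ u e * u f - P.κ e f
      value p q r s eq = trans p (trans eq (sym (cong₂ _-_ (cong₂ _*_ q r) s)))
      by-cases : Dec (Extends S e) → Dec (Extends S f) → Dec (Extends (S ⊕ e) f) → β (S ⊕ e ⊕ f) ≡ u e * u f - P.κ e f
      by-cases (no ¬Se) _ _ = value (𝟙-no (basis? _) λ b → ¬Se (basis⇒extends b .proj₁))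
        (𝟙-no (extends? S e) ¬Se) refl (𝟙-no (parallel? S e f) λ p → ¬Se (p .proj₁ .proj₁))
        (solve 1 (λ a → con 0ℚ := con 0ℚ :* a :- con 0ℚ) refl (u f))
      by-cases (yes Se) (no ¬Sf) _ = value (𝟙-no (basis? _) λ b → ¬Sf
          (basis⇒extends (subst (λ T → Indep T × card T ≡ n) (⊕-comm S e f) b) .proj₁))
        refl (𝟙-no (extends? S f) ¬Sf) (𝟙-no (parallel? S e f) λ p → ¬Sf (p .proj₁ .proj₂))
        (solve 1 (λ a → con 0ℚ := a :* con 0ℚ :- con 0ℚ) refl (u e))
      by-cases (yes Se) (yes Sf) (yes Sef) = value (𝟙-yes (basis? _) (extends⇒basis Se Sef))
        (𝟙-yes (extends? S e) Se) (𝟙-yes (extends? S f) Sf) (𝟙-no (parallel? S e f) λ p → p .proj₂ Sef) refl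
      by-cases (yes Se) (yes Sf) (no ¬Sef) = value (𝟙-no (basis? _) λ b → ¬Sef (basis⇒extends b .proj₂))
        (𝟙-yes (extends? S e) Se) (𝟙-yes (extends? S f) Sf) (𝟙-yes (parallel? S e f) ((Se , Sf) , ¬Sef)) refl

    pairing : ∀ x y → D (x ∷ y ∷ []) S ≡ (x ∙ u) * (y ∙ u) - x ∙ P.weight y
    pairing x y = begin
      D (x ∷ y ∷ []) S
        ≡⟨ trans (D-∷ x (y ∷ []) S) (∑-cong λ e → cong (x e *_) (trans (D-∷ y [] (S ⊕ e))
             (∑-cong λ f → cong (y f *_) (D-[] (S ⊕ e ⊕ f))))) ⟩
      ∑ (λ e → x e * ∑ (λ f → y f * β (S ⊕ e ⊕ f)))
        ≡⟨ ∑-cong (λ e → cong (x e *_) (inner e)) ⟩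
      ∑ (λ e → x e * (u e * (y ∙ u) + (- 1ℚ) * P.weight y e))
        ≡⟨ ∑-cong (λ e → solve 4 (λ x u q w → x :* (u :* q :+ (:- con 1ℚ) :* w) := q :* (x :* u) :+ (:- con 1ℚ) :* (x :* w)) refl (x e) (u e) (y ∙ u) (P.weight y e)) ⟩
      ∑ (λ e → (y ∙ u) * (x e * u e) + (- 1ℚ) * (x e * P.weight y e))
        ≡⟨ ∑-linear (λ e → (y ∙ u) * (x e * u e)) (λ e → x e * P.weight y e) (- 1ℚ) ⟩
      ∑ (λ e → (y ∙ u) * (x e * u e)) + (- 1ℚ) * (x ∙ P.weight y)
        ≡⟨ cong (_+ (- 1ℚ) * (x ∙ P.weight y)) (*-∑ (y ∙ u) (λ e → x e * u e)) ⟨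
      (y ∙ u) * (x ∙ u) + (- 1ℚ) * (x ∙ P.weight y)
        ≡⟨ solve 3 (λ a b c → a :* b :+ (:- con 1ℚ) :* c := b :* a :- c) refl (y ∙ u) (x ∙ u) (x ∙ P.weight y) ⟩
      (x ∙ u) * (y ∙ u) - x ∙ P.weight y
        ∎
      where
      inner : ∀ e → ∑ (λ f → y f * β (S ⊕ e ⊕ f)) ≡ u e * (y ∙ u) + (- 1ℚ) * P.weight y e
      inner e = begin
        ∑ (λ f → y f * β (S ⊕ e ⊕ f))
          ≡⟨ ∑-cong (λ f → trans (cong (y f *_) (β-split e f))
               (solve 4 (λ y u v k → y :* (u :* v :- k) := u :* (y :* v) :+ (:- con 1ℚ) :* (k :* y)) refl (y f) (u e) (u f) (P.κ e f))) ⟩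
        ∑ (λ f → u e * (y f * u f) + (- 1ℚ) * (P.κ e f * y f))
          ≡⟨ ∑-linear (λ f → u e * (y f * u f)) (λ f → P.κ e f * y f) (- 1ℚ) ⟩
        ∑ (λ f → u e * (y f * u f)) + (- 1ℚ) * P.weight y e
          ≡⟨ cong (_+ (- 1ℚ) * P.weight y e) (*-∑ (u e) (λ f → y f * u f)) ⟨
        u e * (y ∙ u) + (- 1ℚ) * P.weight y e
          ∎

    0<χ∙u : ∀ b → 0ℚ <ℚ χ b ∙ u
    0<χ∙u b with extend′ b ind fits
    ... | e , Re≡b , ext = ∑-pos (λ f → 0≤* (0≤χ b f) (0≤𝟙 (extends? S f))) e
      (0<* (subst (0ℚ <ℚ_) (sym (χ≡1 Re≡b)) 0<1) (subst (0ℚ <ℚ_) (sym (𝟙-yes (extends? S e) ext)) 0<1))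

    diagonal : ∀ x → x ∙ u ≡ 0ℚ → D (x ∷ x ∷ []) S ≡ 0ℚ - x ∙ P.weight x
    diagonal x xu≡0 = trans (pairing x x) (cong (_- x ∙ P.weight x) (*-≡0ˡ (x ∙ u) xu≡0))

    negative : ∀ x → x ∙ u ≡ 0ℚ → D (x ∷ x ∷ []) S ≤ℚ 0ℚ
    negative x xu≡0 = 0≤q-p⇒p≤q (subst (0ℚ ≤ℚ_)
      (trans (solve 1 (λ a → a := con 0ℚ :- (con 0ℚ :- a)) refl (x ∙ P.weight x)) (cong (λ v → 0ℚ - v) (sym (diagonal x xu≡0))))
      (P.positive-semidefinite x))

    reverse-CS : ∀ b x → D (x ∷ x ∷ []) S * D (χ b ∷ χ b ∷ []) S ≤ℚ D (x ∷ χ b ∷ []) S * D (x ∷ χ b ∷ []) S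
    reverse-CS b = hyperplane⇒reverse-CS [] S b (_∙ u) (λ x y t → ∙-linearˡ x y u t) (pos⇒≢0 (0<χ∙u b))
      (0≤Dχ (b ∷ b ∷ []) S) negative

    -- Shifting `x` by a multiple `t` of `χ b` into the hyperplane of `u` produces the value t² H(b,
    -- b), which must be nonpositive there. So t = 0 and `x` lies in the hyperplane already, where
    -- the form is minus a sum of squares of class weights.
    isotropic : ∀ b x → D (x ∷ x ∷ []) S ≡ 0ℚ → D (x ∷ χ b ∷ []) S ≡ 0ℚ → ∀ e → P.weight x e ≡ 0ℚ
    isotropic b x xx≡0 xb≡0 = P.isotropic⇒weight≡0 x (ℚ.≤-reflexive (begin
      x ∙ P.weight x ≡⟨ solve 1 (λ a → a := con 0ℚ :- (con 0ℚ :- a)) refl (x ∙ P.weight x) ⟩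
      0ℚ - (0ℚ - x ∙ P.weight x) ≡⟨ cong (λ v → 0ℚ - v) (trans (sym (diagonal x xu≡0)) xx≡0) ⟩
      0ℚ ∎))
      where
      χu≢0 = pos⇒≢0 (0<χ∙u b)
      r = inverse χu≢0 .proj₁
      r-inv = inverse χu≢0 .proj₂
      t = (x ∙ u) * r
      bb = D (χ b ∷ χ b ∷ []) S
      z = λ e → x e + (- t) * χ b e
      zu≡0 : z ∙ u ≡ 0ℚ
      zu≡0 = trans (∙-linearˡ x (χ b) u (- t)) (eliminate (x ∙ u) r-inv)
      zz≡ : D (z ∷ z ∷ []) S ≡ bb * (t * t)
      zz≡ = begin
        D (z ∷ z ∷ []) S
          ≡⟨ D-square x (χ b) (- t) [] S ⟩
        D (x ∷ x ∷ []) S + (- t) * (2ℚ * D (x ∷ χ b ∷ []) S) + (- t) * (- t) * bb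
          ≡⟨ cong₂ (λ p q → p + (- t) * (2ℚ * q) + (- t) * (- t) * bb) xx≡0 xb≡0 ⟩
        0ℚ + (- t) * (2ℚ * 0ℚ) + (- t) * (- t) * bb
          ≡⟨ solve 2 (λ t b → con 0ℚ :+ (:- t) :* (con 2ℚ :* con 0ℚ) :+ (:- t) :* (:- t) :* b := b :* (t :* t)) refl t bb ⟩
        bb * (t * t)
          ∎
      t≡0 : t ≡ 0ℚ
      t≡0 = sq≡0 (ℚ.≤-antisym
        (≤-cancel-pos (0<Dχ (b ∷ b ∷ []) S ind fits) (subst (_≤ℚ 0ℚ) zz≡ (negative z zu≡0)))
        (0≤sq t))
      xu≡0 : x ∙ u ≡ 0ℚ
      xu≡0 = begin
        x ∙ u ≡⟨ ℚ.*-identityʳ (x ∙ u) ⟨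
        (x ∙ u) * 1ℚ ≡⟨ cong ((x ∙ u) *_) r-inv ⟨
        (x ∙ u) * ((χ b ∙ u) * r) ≡⟨ solve 3 (λ a b r → a :* (b :* r) := a :* r :* b) refl (x ∙ u) (χ b ∙ u) r ⟩
        t * (χ b ∙ u) ≡⟨ cong (_* (χ b ∙ u)) t≡0 ⟩
        0ℚ * (χ b ∙ u) ≡⟨ ℚ.*-zeroˡ (χ b ∙ u) ⟩
        0ℚ ∎

-- The inductive Bochner step

module HodgeRiemann {m : ℕ} (M : Matroid m) (R : Subset m) (n : ℕ)
  (extend : ∀ b {S} → Matroid.Indep M S → card S < n →
            ∃[ e ] lookup R e ≡ b × e ∉ S × Matroid.Indep M (S ⊕ e)) where

  open Matroid M
  open Mixed M n
  open Lorentzian M R n extend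
  open ≡-Reasoning

  -- The bound `≤ n` instead of equality admits contractions by an element already in `S`, which do
  -- not increase `card`.
  ReverseCS : List Bool → Set
  ReverseCS cs = ∀ S → card S ℕ.+ (2 ℕ.+ length cs) ≤ n → ∀ b x →
    D (x ∷ x ∷ χs cs) S * D (χ b ∷ χ b ∷ χs cs) S ≤ℚ D (x ∷ χ b ∷ χs cs) S * D (x ∷ χ b ∷ χs cs) S

  length-χs : ∀ cs → length (χs cs) ≡ length cs
  length-χs = List.length-map χ

  module Step (c : Bool) (cs : List Bool) (IH : ReverseCS cs) (S : Subset m) (ind : Indep S)
    (fits : card S ℕ.+ (3 ℕ.+ length cs) ≡ n)
    (x : Fin m → ℚ) (xc≡0 : D (x ∷ χ c ∷ χ c ∷ χs cs) S ≡ 0ℚ) where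

    row square : (Fin m → ℚ) → Fin m → ℚ
    row y i = D (y ∷ χ c ∷ χs cs) (S ⊕ i)
    square y i = D (y ∷ y ∷ χs cs) (S ⊕ i)

    D₂ : Fin m → Fin m → ℚ
    D₂ i j = D (χ c ∷ χs cs) (S ⊕ i ⊕ j)

    -- The matrix of the form H on vectors supported in colour `c`, read as edge weights of a graph;
    -- its degrees are its products with `χ c`.
    L : Fin m → Fin m → ℚ
    L i j = χ c i * (χ c j * D₂ i j)

    L-sym : ∀ i j → L i j ≡ L j i
    L-sym i j = trans
      (solve 3 (λ a b d → a :* (b :* d) := b :* (a :* d)) refl (χ c i) (χ c j) (D₂ i j))
      (cong (λ T → χ c j * (χ c i * D (χ c ∷ χs cs) T)) (⊕-comm S i j))

    0≤L : ∀ i j → 0ℚ ≤ℚ L i j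
    0≤L i j = 0≤* (0≤χ c i) (0≤* (0≤χ c j) (0≤Dχ (c ∷ cs) (S ⊕ i ⊕ j)))

    open Laplacian L L-sym 0≤L

    degree≡ : ∀ i → degree i ≡ χ c i * row (χ c) i
    degree≡ i = trans (sym (*-∑ (χ c i) (λ j → χ c j * D₂ i j)))
      (cong (χ c i *_) (sym (D-∷ (χ c) (χ c ∷ χs cs) (S ⊕ i))))

    h : Fin m → ℚ
    h i = χ c i * row x i

    ∑h≡0 : ∑ h ≡ 0ℚ
    ∑h≡0 = trans (sym (D-∷ (χ c) (x ∷ χ c ∷ χs cs) S)) (trans (D-swap (χ c) x (χ c ∷ χs cs) S) xc≡0)

    h-supp : ∀ i → h i ≡ 0ℚ ⊎ (lookup R i ≡ c × Extends S i)
    h-supp i = by-cases (lookup R i Bool.≟ c) (extends? S i)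
      where
      by-cases : Dec (lookup R i ≡ c) → Dec (Extends S i) → h i ≡ 0ℚ ⊎ (lookup R i ≡ c × Extends S i)
      by-cases (no Ri≢c) _ = inj₁ (*-≡0ˡ (row x i) (χ≡0 Ri≢c))
      by-cases (yes Ri≡c) (yes ext) = inj₂ (Ri≡c , ext)
      by-cases (yes Ri≡c) (no ¬ext) = inj₁ (*-≡0ʳ (χ c i) (D-nonextending (x ∷ χ c ∷ χs cs) S i
          (ℕ.≤-reflexive (trans (cong (λ k → card S ℕ.+ (3 ℕ.+ k)) (length-χs cs)) fits)) ¬ext))

    adjacent : ∀ (y : Fin m → ℚ) → (∀ i j → L i j * (y i - y j) ≡ 0ℚ) → ∀ {i j} → lookup R i ≡ c → lookup R j ≡ c →
               Extends S i → Extends (S ⊕ i) j → y i ≡ y j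
    adjacent y const {i} {j} Ri≡c Rj≡c Si Sij = begin
      y i ≡⟨ solve 2 (λ a b → a := (a :- b) :+ b) refl (y i) (y j) ⟩
      (y i - y j) + y j ≡⟨ cong (_+ y j) (*-cancel-0 (pos⇒≢0 0<L) (const i j)) ⟩
      0ℚ + y j ≡⟨ ℚ.+-identityˡ (y j) ⟩
      y j ∎
      where
      0<χ : ∀ {k} → lookup R k ≡ c → 0ℚ <ℚ χ c k
      0<χ Rk≡c = subst (0ℚ <ℚ_) (sym (χ≡1 Rk≡c)) 0<1
      0<L : 0ℚ <ℚ L i j
      0<L = 0<* (0<χ Ri≡c) (0<* (0<χ Rj≡c) (0<Dχ (c ∷ cs) (S ⊕ i ⊕ j) (Sij .proj₁)
        (⊕-fits Sij (⊕-fits Si fits))))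

    -- The extending elements of colour `c` are joined by paths of length at most two: `i` has a
    -- neighbour `l` of the same colour, and by exchange `j` is adjacent to `i` or to `l`.
    connected : ∀ (y : Fin m → ℚ) → (∀ i j → L i j * (y i - y j) ≡ 0ℚ) → ∀ {i j} → lookup R i ≡ c → lookup R j ≡ c →
                Extends S i → Extends S j → y i ≡ y j
    connected y const {i} {j} Ri≡c Rj≡c Si Sj with extend′ c (Si .proj₁) (⊕-fits Si fits)
    ... | l , Rl≡c , Sil with exchange {f = i} Sj Sil Si
    ... | inj₁ Sji = sym (adjacent y const Rj≡c Ri≡c Sj Sji)
    ... | inj₂ Sjl = trans (adjacent y const Ri≡c Rl≡c Si Sil) (sym (adjacent y const Rj≡c Rl≡c Sj Sjl))

    -- By connectedness `y` is constant on the support of `h`, and the assumption `xc≡0` says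
    -- exactly that `h` sums to zero.
    orthogonal : ∀ (y : Fin m → ℚ) → (∀ i j → L i j * (y i - y j) ≡ 0ℚ) → y ∙ h ≡ 0ℚ
    orthogonal y const with extend′ c ind fits
    ... | i₀ , Ri₀≡c , Si₀ = begin
      y ∙ h ≡⟨ ∑-cong (λ i → move i (h-supp i)) ⟩
      ∑ (λ i → y i₀ * h i) ≡⟨ *-∑ (y i₀) h ⟨
      y i₀ * ∑ h ≡⟨ cong (y i₀ *_) ∑h≡0 ⟩
      y i₀ * 0ℚ ≡⟨ ℚ.*-zeroʳ (y i₀) ⟩
      0ℚ ∎
      where
      move : ∀ i → h i ≡ 0ℚ ⊎ (lookup R i ≡ c × Extends S i) → y i * h i ≡ y i₀ * h i
      move i (inj₁ h≡0) = trans (cong (y i *_) h≡0) (trans (ℚ.*-zeroʳ (y i))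
        (sym (*-≡0ʳ (y i₀) h≡0)))
      move i (inj₂ (Ri≡c , Si)) = cong (_* h i) (connected y const Ri≡c Ri₀≡c Si Si₀)

    W : Fin m → ℚ
    W = solvable h orthogonal .proj₁

    ΔW≡h : ∀ i → Δ W i ≡ h i
    ΔW≡h = solvable h orthogonal .proj₂

    cW : Fin m → ℚ
    cW e = χ c e * W e

    z : Fin m → ℚ
    z e = x e + 1ℚ * cW e

    cW-D : ∀ i → χ c i * row cW i ≡ ∑ (λ j → L i j * W j)
    cW-D i = trans (cong (χ c i *_) (D-∷ cW (χ c ∷ χs cs) (S ⊕ i))) (trans (*-∑ (χ c i) (λ j → cW j * D₂ i j))
      (∑-cong λ j → solve 4 (λ a b w d → a :* (b :* w :* d) := a :* (b :* d) :* w) refl (χ c i) (χ c j) (W j) (D₂ i j)))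

    -- By the choice of W, the i-th row of z is proportional to that of c.
    z-D : ∀ i → χ c i * row z i ≡ degree i * W i
    z-D i = begin
      χ c i * row z i
        ≡⟨ cong (χ c i *_) (D-linear x cW 1ℚ (χ c ∷ χs cs) (S ⊕ i)) ⟩
      χ c i * (row x i + 1ℚ * row cW i)
        ≡⟨ solve 3 (λ a b d → a :* (b :+ con 1ℚ :* d) := a :* b :+ a :* d) refl (χ c i) (row x i) (row cW i) ⟩
      h i + χ c i * row cW i
        ≡⟨ cong₂ _+_ (sym (ΔW≡h i)) (cW-D i) ⟩
      Δ W i + ∑ (λ j → L i j * W j)
        ≡⟨ solve 2 (λ a b → (a :- b) :+ b := a) refl (degree i * W i) (∑ (λ j → L i j * W j)) ⟩
      degree i * W i
        ∎

    ⊕-≤ : ∀ i → card (S ⊕ i) ℕ.+ (2 ℕ.+ length cs) ≤ n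
    ⊕-≤ i = ℕ.≤-trans (ℕ.+-monoˡ-≤ (2 ℕ.+ length cs) (card-⊕-≤ S i))
      (ℕ.≤-reflexive (trans (sym (ℕ.+-suc (card S) (2 ℕ.+ length cs))) fits))

    χ-dichotomy : ∀ i → χ c i ≡ 0ℚ ⊎ χ c i ≡ 1ℚ
    χ-dichotomy i = by-cases (lookup R i Bool.≟ c)
      where
      by-cases : Dec (lookup R i ≡ c) → χ c i ≡ 0ℚ ⊎ χ c i ≡ 1ℚ
      by-cases (yes Ri≡c) = inj₂ (χ≡1 Ri≡c)
      by-cases (no Ri≢c) = inj₁ (χ≡0 Ri≢c)

    length-2 : ∀ (x y : Fin m → ℚ) → length (x ∷ y ∷ χs cs) ≡ 2 ℕ.+ length cs
    length-2 _ _ = cong (2 ℕ.+_) (length-χs cs)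

    degenerate : ∀ i (y : Fin m → ℚ) → 0ℚ <ℚ row (χ c) i ⊎
      (square y i ≡ 0ℚ × row (χ c) i ≡ 0ℚ)
    degenerate i y = by-cases (dichotomy (2 ℕ.+ length cs) (S ⊕ i) (⊕-≤ i))
      where
      by-cases : (Indep (S ⊕ i) × card (S ⊕ i) ℕ.+ (2 ℕ.+ length cs) ≡ n) ⊎
        (∀ xs → length xs ≡ 2 ℕ.+ length cs → D xs (S ⊕ i) ≡ 0ℚ) →
        0ℚ <ℚ row (χ c) i ⊎
        (square y i ≡ 0ℚ × row (χ c) i ≡ 0ℚ)
      by-cases (inj₁ (ind⊕ , eq)) = inj₁ (0<Dχ (c ∷ c ∷ cs) (S ⊕ i) ind⊕ eq)
      by-cases (inj₂ D≡0) = inj₂ (D≡0 (y ∷ y ∷ χs cs) (length-2 y y) , D≡0 (χ c ∷ χ c ∷ χs cs) (length-2 (χ c) (χ c)))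

    row-bound : ∀ i → χ c i * square z i ≤ℚ degree i * (W i * W i)
    row-bound i = row-inequality (χ c i) (square z i) (row (χ c) i)
      (row z i) (degree i) (W i)
      (χ-dichotomy i) (degree≡ i) (z-D i) (IH (S ⊕ i) (⊕-≤ i) c z) (degenerate i z)

    hxx : ℚ
    hxx = D (x ∷ x ∷ χ c ∷ χs cs) S

    rotate : ∀ y → D (y ∷ y ∷ χ c ∷ χs cs) S ≡ ∑ (λ i → χ c i * square y i)
    rotate y = trans (D-cons y (y ∷ χ c ∷ χs cs) (χ c ∷ y ∷ χs cs) (D-swap y (χ c) (χs cs)) S)
      (trans (D-swap y (χ c) (y ∷ χs cs) S) (D-∷ (χ c) (y ∷ y ∷ χs cs) S))

    bound : hxx + 2ℚ * (W ∙ Δ W) + W ∙ (λ i → ∑ (λ j → L i j * W j)) ≤ℚ ∑ (λ i → degree i * (W i * W i))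
    bound = subst (_≤ℚ ∑ (λ i → degree i * (W i * W i))) (begin
      ∑ (λ i → χ c i * square z i)
        ≡⟨ rotate z ⟨
      D (z ∷ z ∷ χ c ∷ χs cs) S
        ≡⟨ D-square x cW 1ℚ (χ c ∷ χs cs) S ⟩
      hxx + 1ℚ * (2ℚ * D (x ∷ cW ∷ χ c ∷ χs cs) S) + 1ℚ * 1ℚ * D (cW ∷ cW ∷ χ c ∷ χs cs) S
        ≡⟨ solve 3 (λ a b d → a :+ con 1ℚ :* (con 2ℚ :* b) :+ con 1ℚ :* con 1ℚ :* d := a :+ con 2ℚ :* b :+ d) refl hxx (D (x ∷ cW ∷ χ c ∷ χs cs) S) (D (cW ∷ cW ∷ χ c ∷ χs cs) S) ⟩
      hxx + 2ℚ * D (x ∷ cW ∷ χ c ∷ χs cs) S + D (cW ∷ cW ∷ χ c ∷ χs cs) S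
        ≡⟨ cong₂ (λ a b → hxx + 2ℚ * a + b) cross corner ⟩
      hxx + 2ℚ * (W ∙ Δ W) + W ∙ (λ i → ∑ (λ j → L i j * W j))
        ∎) (∑-mono row-bound)
      where
      cross : D (x ∷ cW ∷ χ c ∷ χs cs) S ≡ W ∙ Δ W
      cross = trans (D-swap x cW (χ c ∷ χs cs) S) (trans (D-∷ cW (x ∷ χ c ∷ χs cs) S) (∑-cong λ i → begin
        χ c i * W i * row x i ≡⟨ solve 3 (λ a w d → a :* w :* d := w :* (a :* d)) refl (χ c i) (W i) (row x i) ⟩
        W i * h i ≡⟨ cong (W i *_) (ΔW≡h i) ⟨
        W i * Δ W i ∎))
      corner : D (cW ∷ cW ∷ χ c ∷ χs cs) S ≡ W ∙ (λ i → ∑ (λ j → L i j * W j))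
      corner = trans (D-∷ cW (cW ∷ χ c ∷ χs cs) S) (∑-cong λ i → begin
        χ c i * W i * row cW i ≡⟨ solve 3 (λ a w d → a :* w :* d := w :* (a :* d)) refl (χ c i) (W i) (row cW i) ⟩
        W i * (χ c i * row cW i) ≡⟨ cong (W i *_) (cW-D i) ⟩
        W i * ∑ (λ j → L i j * W j) ∎)

    negative : hxx ≤ℚ 0ℚ
    negative = hxx≤0 W bound

    -- Equality gives `Δ W = 0`, hence `h = 0`. The row estimate then applies to `x` itself with
    -- weight 0 in place of `W i`, so each `square x i` of colour `c` is nonpositive; they add up to
    -- `hxx`, hence all vanish.
    descend : hxx ≡ 0ℚ → ∀ i → lookup R i ≡ c →
              square x i ≡ 0ℚ × row x i ≡ 0ℚ
    descend hxx≡0 i Ri≡c = xx≡0 , xci≡0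
      where
      h≡0 : ∀ i → h i ≡ 0ℚ
      h≡0 i = trans (sym (ΔW≡h i)) (hxx≡0⇒Δ≡0 W bound hxx≡0 i)
      xci≡0 : row x i ≡ 0ℚ
      xci≡0 = begin
        row x i ≡⟨ ℚ.*-identityˡ (row x i) ⟨
        1ℚ * row x i ≡⟨ cong (_* row x i) (χ≡1 Ri≡c) ⟨
        h i ≡⟨ h≡0 i ⟩
        0ℚ ∎
      summand : Fin m → ℚ
      summand i = χ c i * square x i
      row≤0 : ∀ i → summand i ≤ℚ 0ℚ
      row≤0 i = subst (χ c i * square x i ≤ℚ_) (ℚ.*-zeroʳ (degree i))
        (row-inequality (χ c i) (square x i) (row (χ c) i)
          (row x i) (degree i) 0ℚ
          (χ-dichotomy i) (degree≡ i) (trans (h≡0 i) (sym (ℚ.*-zeroʳ (degree i)))) (IH (S ⊕ i) (⊕-≤ i) c x) (degenerate i x))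
      -row : Fin m → ℚ
      -row i = (- 1ℚ) * summand i
      0≤-row : ∀ i → 0ℚ ≤ℚ -row i
      0≤-row i = subst (0ℚ ≤ℚ_) (solve 1 (λ a → con 0ℚ :- a := (:- con 1ℚ) :* a) refl (summand i)) (p≤q⇒0≤q-p (row≤0 i))
      ∑-row≤0 : ∑ -row ≤ℚ 0ℚ
      ∑-row≤0 = ℚ.≤-reflexive (begin
        ∑ -row ≡⟨ *-∑ (- 1ℚ) summand ⟨
        (- 1ℚ) * ∑ summand ≡⟨ cong ((- 1ℚ) *_) (trans (sym (rotate x)) hxx≡0) ⟩
        (- 1ℚ) * 0ℚ ≡⟨ ℚ.*-zeroʳ (- 1ℚ) ⟩
        0ℚ ∎)
      xx≡0 : square x i ≡ 0ℚ
      xx≡0 = *-cancel-0 { - 1ℚ} (λ ()) (begin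
        (- 1ℚ) * square x i ≡⟨ cong ((- 1ℚ) *_) (ℚ.*-identityˡ (square x i)) ⟨
        (- 1ℚ) * (1ℚ * square x i) ≡⟨ cong (λ a → (- 1ℚ) * (a * square x i)) (χ≡1 Ri≡c) ⟨
        -row i ≡⟨ ∑-nonNeg≤0 0≤-row ∑-row≤0 i ⟩
        0ℚ ∎)

  reverseCS : ∀ cs → ReverseCS cs
  reverseCS cs S c≤n b x with dichotomy (2 ℕ.+ length cs) S c≤n
  reverseCS cs S c≤n b x | inj₂ D≡0 = ℚ.≤-reflexive (begin
    D (x ∷ x ∷ χs cs) S * D (χ b ∷ χ b ∷ χs cs) S
      ≡⟨ cong (D (x ∷ x ∷ χs cs) S *_) (D≡0 (χ b ∷ χ b ∷ χs cs) (cong (2 ℕ.+_) (length-χs cs))) ⟩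
    D (x ∷ x ∷ χs cs) S * 0ℚ
      ≡⟨ solve 2 (λ a b → a :* con 0ℚ := b :* con 0ℚ) refl (D (x ∷ x ∷ χs cs) S) (D (x ∷ χ b ∷ χs cs) S) ⟩
    D (x ∷ χ b ∷ χs cs) S * 0ℚ
      ≡⟨ cong (D (x ∷ χ b ∷ χs cs) S *_) (D≡0 (x ∷ χ b ∷ χs cs) (cong (2 ℕ.+_) (length-χs cs))) ⟨
    D (x ∷ χ b ∷ χs cs) S * D (x ∷ χ b ∷ χs cs) S
      ∎)
  reverseCS [] S c≤n b x | inj₁ (ind , fits) = RankTwo.reverse-CS S ind fits b x
  reverseCS (c ∷ cs) S c≤n b x | inj₁ (ind , fits) =
    -- The hyperplane is orthogonal to the listed colour `c`, whichever direction `b` is compared;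
    -- strict positivity of the mixed discriminants makes `χ b` transversal to it.
    hyperplane⇒reverse-CS (χs (c ∷ cs)) S b (λ y → D (y ∷ χ c ∷ χ c ∷ χs cs) S)
      (λ x y t → D-linear x y t (χ c ∷ χ c ∷ χs cs) S)
      (pos⇒≢0 (0<Dχ (b ∷ c ∷ c ∷ cs) S ind fits))
      (0≤Dχ (b ∷ b ∷ c ∷ cs) S)
      (Step.negative c cs (reverseCS cs) S ind fits) x

-- Determinants

∑-pair : ∀ {n} {f : Fin n → ℚ} a b → a ≢ b → (∀ j → j ≢ a → j ≢ b → f j ≡ 0ℚ) → ∑ f ≡ f a + f b
∑-pair {f = f} a b a≢b z = begin
  ∑ f ≡⟨ ∑-cong split ⟩
  ∑ (λ j → δ a j * f j + δ b j * f j) ≡⟨ ∑-+ (λ j → δ a j * f j) (λ j → δ b j * f j) ⟩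
  ∑ (λ j → δ a j * f j) + ∑ (λ j → δ b j * f j) ≡⟨ cong₂ _+_ (∑-δ f a) (∑-δ f b) ⟩
  f a + f b ∎
  where
  open ≡-Reasoning
  split : ∀ j → f j ≡ δ a j * f j + δ b j * f j
  split j with a ≟ j | b ≟ j
  ... | yes refl | yes refl = contradiction refl a≢b
  ... | yes refl | no _ = solve 1 (λ x → x := con 1ℚ :* x :+ con 0ℚ :* x) refl (f a)
  ... | no _ | yes refl = solve 1 (λ x → x := con 0ℚ :* x :+ con 1ℚ :* x) refl (f b)
  ... | no a≢j | no b≢j = trans (z j (a≢j ∘ sym) (b≢j ∘ sym)) (solve 1 (λ x → con 0ℚ := con 0ℚ :* x :+ con 0ℚ :* x) refl (f j))

linear-∑ : ∀ {r} (F : (Fin r → ℚ) → ℚ) → (∀ {x y} → (∀ i → x i ≡ y i) → F x ≡ F y) →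
  (∀ x y t → F (λ i → x i + t * y i) ≡ F x + t * F y) →
  ∀ {m} (a : Fin m → ℚ) (V : Fin m → Fin r → ℚ) → F (λ i → ∑ (λ j → a j * V j i)) ≡ ∑ (λ j → a j * F (V j))
linear-∑ F F-cong F-linear {zero} a V = begin
  F (λ i → ∑ (λ j → a j * V j i)) ≡⟨ F-cong (λ i → trans (∑-empty _) (solve 0 (con 0ℚ := con 0ℚ :+ (:- con 1ℚ) :* con 0ℚ) refl)) ⟩
  F (λ i → 0ℚ + (- 1ℚ) * 0ℚ) ≡⟨ F-linear (λ _ → 0ℚ) (λ _ → 0ℚ) (- 1ℚ) ⟩
  F (λ _ → 0ℚ) + (- 1ℚ) * F (λ _ → 0ℚ) ≡⟨ solve 1 (λ x → x :+ (:- con 1ℚ) :* x := con 0ℚ) refl (F (λ _ → 0ℚ)) ⟩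
  0ℚ ≡⟨ ∑-empty _ ⟨
  ∑ (λ j → a j * F (V j)) ∎
  where open ≡-Reasoning
linear-∑ F F-cong F-linear {suc m} a V = begin
  F (λ i → ∑ (λ j → a j * V j i))
    ≡⟨ F-cong (λ i → trans (∑-suc (λ j → a j * V j i)) (ℚ.+-comm (a zero * V zero i) (∑ (λ j → a (suc j) * V (suc j) i)))) ⟩
  F (λ i → ∑ (λ j → a (suc j) * V (suc j) i) + a zero * V zero i)
    ≡⟨ F-linear (λ i → ∑ (λ j → a (suc j) * V (suc j) i)) (V zero) (a zero) ⟩
  F (λ i → ∑ (λ j → a (suc j) * V (suc j) i)) + a zero * F (V zero)
    ≡⟨ cong (_+ a zero * F (V zero)) (linear-∑ F F-cong F-linear (a ∘ suc) (V ∘ suc)) ⟩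
  ∑ (λ j → a (suc j) * F (V (suc j))) + a zero * F (V zero)
    ≡⟨ ℚ.+-comm (∑ (λ j → a (suc j) * F (V (suc j)))) (a zero * F (V zero)) ⟩
  a zero * F (V zero) + ∑ (λ j → a (suc j) * F (V (suc j)))
    ≡⟨ ∑-suc (λ j → a j * F (V j)) ⟨
  ∑ (λ j → a j * F (V j))
    ∎
  where open ≡-Reasoning

punchIn-adjacent : ∀ {n} (p : Fin (suc n)) (j : Fin (suc (suc n))) → j ≢ inject₁ p → j ≢ suc p →
  ∃[ p′ ] punchIn j (inject₁ p′) ≡ inject₁ p × punchIn j (suc p′) ≡ suc p
punchIn-adjacent zero zero j≢p _ = contradiction refl j≢p
punchIn-adjacent (suc p) zero _ _ = p , refl , refl
punchIn-adjacent zero (suc zero) _ j≢q = contradiction refl j≢q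
punchIn-adjacent {suc n} zero (suc (suc j)) _ _ = zero , refl , refl
punchIn-adjacent {suc n} (suc p) (suc j) j≢p j≢q
  with punchIn-adjacent p j (j≢p ∘ cong suc) (j≢q ∘ cong suc)
... | p′ , eq₁ , eq₂ = suc p′ , cong suc eq₁ , cong suc eq₂

-- Deleting one or the other of two adjacent columns gives the same list of columns, except at the
-- place where the remaining one of the two stands.
punchIn-neighbours : ∀ {n} (p l : Fin n) →
  punchIn (inject₁ p) l ≡ punchIn (suc p) l ⊎
  (punchIn (inject₁ p) l ≡ suc p × punchIn (suc p) l ≡ inject₁ p)
punchIn-neighbours zero zero = inj₂ (refl , refl)
punchIn-neighbours zero (suc l) = inj₁ refl
punchIn-neighbours (suc p) zero = inj₁ refl
punchIn-neighbours (suc p) (suc l) with punchIn-neighbours p l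
... | inj₁ eq = inj₁ (cong suc eq)
... | inj₂ (eq₁ , eq₂) = inj₂ (cong suc eq₁ , cong suc eq₂)

inject₁≢suc : ∀ {n} (p : Fin n) → inject₁ p ≢ suc p
inject₁≢suc (suc p) eq = inject₁≢suc p (Fin.suc-injective eq)

module Determinant where

  open Matrices ℚ.+-*-commutativeRing public using (Matrix; minor; det; TotallyUnimodular)
  open ≡-Reasoning

  sgn : ℕ → ℚ
  sgn k = (- 1ℚ) ^ k

  opaque

    Det : ∀ {n} → Matrix n n → ℚ
    Det = det

    Det≡det : ∀ {n} (A : Matrix n n) → Det A ≡ det A
    Det≡det A = refl

    Det-zero : ∀ (A : Matrix 0 0) → Det A ≡ 1ℚ
    Det-zero A = refl

    Det-suc : ∀ {n} (A : Matrix (suc n) (suc n)) →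
              Det A ≡ ∑ (λ j → sgn (toℕ j) * (A zero j * Det (minor A j)))
    Det-suc A = sym (∑≡sum (λ j → sgn (toℕ j) * (A zero j * det (minor A j))))

  Det-cong : ∀ {n} {A B : Matrix n n} → (∀ i j → A i j ≡ B i j) → Det A ≡ Det B
  Det-cong {zero} {A} {B} A≡B = trans (Det-zero A) (sym (Det-zero B))
  Det-cong {suc n} {A} {B} A≡B = begin
    Det A ≡⟨ Det-suc A ⟩
    ∑ (λ j → sgn (toℕ j) * (A zero j * Det (minor A j))) ≡⟨ ∑-cong (λ j → cong₂ (λ a b → sgn (toℕ j) * (a * b))
      (A≡B zero j) (Det-cong λ i k → A≡B (suc i) (punchIn j k))) ⟩
    ∑ (λ j → sgn (toℕ j) * (B zero j * Det (minor B j))) ≡⟨ Det-suc B ⟨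
    Det B ∎

  -- Phrased for three matrices that agree off one column, a form inherited by their minors, so the
  -- induction never meets a minor of a replaced matrix.
  Det-linear′ : ∀ {n} (A B C : Matrix n n) j t →
    (∀ i → C i j ≡ A i j + t * B i j) → (∀ i k → k ≢ j → A i k ≡ C i k) → (∀ i k → k ≢ j → B i k ≡ C i k) →
    Det C ≡ Det A + t * Det B
  Det-linear′ {suc n} A B C j t C≡ A≡ B≡ = begin
    Det C
      ≡⟨ Det-suc C ⟩
    ∑ (term C)
      ≡⟨ ∑-cong split ⟩
    ∑ (λ k → term A k + t * term B k)
      ≡⟨ ∑-linear (term A) (term B) t ⟩
    ∑ (term A) + t * ∑ (term B)
      ≡⟨ cong₂ (λ a b → a + t * b) (Det-suc A) (Det-suc B) ⟨
    Det A + t * Det B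
      ∎
    where
    term : Matrix (suc n) (suc n) → Fin (suc n) → ℚ
    term X k = sgn (toℕ k) * (X zero k * Det (minor X k))
    split : ∀ k → term C k ≡ term A k + t * term B k
    split k with k ≟ j
    ... | yes refl = begin
      sgn (toℕ k) * (C zero k * Det (minor C k))
        ≡⟨ cong (λ c → sgn (toℕ k) * (c * Det (minor C k))) (C≡ zero) ⟩
      sgn (toℕ k) * ((A zero k + t * B zero k) * Det (minor C k))
        ≡⟨ solve 5 (λ s a b t d → s :* ((a :+ t :* b) :* d) := s :* (a :* d) :+ t :* (s :* (b :* d))) refl (sgn (toℕ k)) (A zero k) (B zero k) t (Det (minor C k)) ⟩
      sgn (toℕ k) * (A zero k * Det (minor C k)) + t * (sgn (toℕ k) * (B zero k * Det (minor C k)))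
        ≡⟨ cong₂ (λ a b → sgn (toℕ k) * (A zero k * a) + t * (sgn (toℕ k) * (B zero k * b)))
             (Det-cong λ i l → A≡ (suc i) (punchIn k l) (Fin.punchInᵢ≢i k l))
             (Det-cong λ i l → B≡ (suc i) (punchIn k l) (Fin.punchInᵢ≢i k l)) ⟨
      term A k + t * term B k
        ∎
    ... | no k≢j = begin
      sgn (toℕ k) * (C zero k * Det (minor C k))
        ≡⟨ cong (λ d → sgn (toℕ k) * (C zero k * d)) (Det-linear′ (minor A k) (minor B k) (minor C k) j′ t
             (λ i → subst (λ l → C (suc i) l ≡ A (suc i) l + t * B (suc i) l) (sym (Fin.punchIn-punchOut k≢j)) (C≡ (suc i)))
             (λ i l l≢j′ → A≡ (suc i) (punchIn k l) (≢j l l≢j′))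
             (λ i l l≢j′ → B≡ (suc i) (punchIn k l) (≢j l l≢j′))) ⟩
      sgn (toℕ k) * (C zero k * (Det (minor A k) + t * Det (minor B k)))
        ≡⟨ solve 5 (λ s c a b t → s :* (c :* (a :+ t :* b)) := s :* (c :* a) :+ t :* (s :* (c :* b))) refl (sgn (toℕ k)) (C zero k) (Det (minor A k)) (Det (minor B k)) t ⟩
      sgn (toℕ k) * (C zero k * Det (minor A k)) + t * (sgn (toℕ k) * (C zero k * Det (minor B k)))
        ≡⟨ cong₂ (λ a b → sgn (toℕ k) * (a * Det (minor A k)) + t * (sgn (toℕ k) * (b * Det (minor B k))))
             (A≡ zero k k≢j) (B≡ zero k k≢j) ⟨
      term A k + t * term B k
        ∎
      where
      j′ = punchOut k≢j
      ≢j : ∀ l → l ≢ j′ → punchIn k l ≢ j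
      ≢j l l≢j′ eq = l≢j′ (Fin.punchIn-injective k l j′ (trans eq (sym (Fin.punchIn-punchOut k≢j))))

  opaque

    replace : ∀ {n} → Fin n → (Fin n → ℚ) → Matrix n n → Matrix n n
    replace j v A i k = if does (k ≟ j) then v i else A i k

    replace-≡ : ∀ {n} j (v : Fin n → ℚ) A i → replace j v A i j ≡ v i
    replace-≡ j v A i = cong (if_then v i else A i j) (dec-true (j ≟ j) refl)

    replace-≢ : ∀ {n} j (v : Fin n → ℚ) A i {k} → k ≢ j → replace j v A i k ≡ A i k
    replace-≢ j v A i {k} k≢j = cong (if_then v i else A i k) (dec-false (k ≟ j) k≢j)

  replace-unique : ∀ {n} j {v : Fin n → ℚ} {A B : Matrix n n} →
    (∀ i → B i j ≡ v i) → (∀ i k → k ≢ j → B i k ≡ A i k) → ∀ i k → B i k ≡ replace j v A i k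
  replace-unique j {v} {A} {B} Bj B≢j i k with k ≟ j
  ... | yes refl = trans (Bj i) (sym (replace-≡ j v A i))
  ... | no k≢j = trans (B≢j i k k≢j) (sym (replace-≢ j v A i k≢j))

  Det-linear : ∀ {n} j (A : Matrix n n) x y t →
    Det (replace j (λ i → x i + t * y i) A) ≡ Det (replace j x A) + t * Det (replace j y A)
  Det-linear j A x y t = Det-linear′ (replace j x A) (replace j y A) (replace j (λ i → x i + t * y i) A) j t
    (λ i → trans (replace-≡ j _ A i) (sym (cong₂ (λ a b → a + t * b) (replace-≡ j x A i) (replace-≡ j y A i))))
    (λ i k k≢j → trans (replace-≢ j x A i k≢j) (sym (replace-≢ j _ A i k≢j)))
    (λ i k k≢j → trans (replace-≢ j y A i k≢j) (sym (replace-≢ j _ A i k≢j)))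

  Det-replace-cong : ∀ {n} j (A : Matrix n n) {x y : Fin n → ℚ} → (∀ i → x i ≡ y i) →
    Det (replace j x A) ≡ Det (replace j y A)
  Det-replace-cong j A {x} {y} x≡y = Det-cong (replace-unique j
    (λ i → trans (replace-≡ j x A i) (x≡y i)) (λ i k k≢j → replace-≢ j x A i k≢j))

  -- A zero column is itself minus itself, so linearity yields `Det A = Det A - Det A`.
  Det-zeroColumn : ∀ {n} (A : Matrix n n) j → (∀ i → A i j ≡ 0ℚ) → Det A ≡ 0ℚ
  Det-zeroColumn A j A≡0 = begin
    Det A ≡⟨ Det-linear′ A A A j (- 1ℚ)
      (λ i → trans (A≡0 i) (sym (trans (cong (λ a → a + (- 1ℚ) * a) (A≡0 i)) (solve 0 (con 0ℚ :+ (:- con 1ℚ) :* con 0ℚ := con 0ℚ) refl))))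
      (λ _ _ _ → refl) (λ _ _ _ → refl) ⟩
    Det A + (- 1ℚ) * Det A ≡⟨ solve 1 (λ a → a :+ (:- con 1ℚ) :* a := con 0ℚ) refl (Det A) ⟩
    0ℚ ∎

  -- In the Laplace expansion the two terms at the equal columns have opposite signs and the same
  -- minor; in every other minor the two columns are still adjacent.
  Det-adjacent : ∀ {n} (A : Matrix (suc n) (suc n)) (p : Fin n) →
    (∀ i → A i (inject₁ p) ≡ A i (suc p)) → Det A ≡ 0ℚ
  Det-adjacent {suc n} A p A≡ = begin
    Det A
      ≡⟨ Det-suc A ⟩
    ∑ term
      ≡⟨ ∑-pair (inject₁ p) (suc p) (inject₁≢suc p) others ⟩
    term (inject₁ p) + term (suc p)
      ≡⟨ cong₂ (λ s q → s * (A zero (inject₁ p) * Det (minor A (inject₁ p))) + (- 1ℚ) * sgn (toℕ p) * q)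
           (cong sgn (Fin.toℕ-inject₁ p))
           (cong₂ _*_ (sym (A≡ zero)) (Det-cong (λ i l → same i l (punchIn-neighbours p l)))) ⟩
    sgn (toℕ p) * (A zero (inject₁ p) * Det (minor A (inject₁ p))) +
      (- 1ℚ) * sgn (toℕ p) * (A zero (inject₁ p) * Det (minor A (inject₁ p)))
      ≡⟨ solve 2 (λ s x → s :* x :+ (:- con 1ℚ) :* s :* x := con 0ℚ) refl (sgn (toℕ p)) (A zero (inject₁ p) * Det (minor A (inject₁ p))) ⟩
    0ℚ
      ∎
    where
    term : Fin (suc (suc n)) → ℚ
    term j = sgn (toℕ j) * (A zero j * Det (minor A j))
    same : ∀ i l → punchIn (inject₁ p) l ≡ punchIn (suc p) l ⊎
      (punchIn (inject₁ p) l ≡ suc p × punchIn (suc p) l ≡ inject₁ p) →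
      minor A (suc p) i l ≡ minor A (inject₁ p) i l
    same i l (inj₁ eq) = cong (A (suc i)) (sym eq)
    same i l (inj₂ (eq₁ , eq₂)) = trans (cong (A (suc i)) eq₂) (trans (A≡ (suc i)) (cong (A (suc i)) (sym eq₁)))
    others : ∀ j → j ≢ inject₁ p → j ≢ suc p → term j ≡ 0ℚ
    others j j≢p j≢q with punchIn-adjacent p j j≢p j≢q
    ... | p′ , eq₁ , eq₂ = trans
      (cong (λ d → sgn (toℕ j) * (A zero j * d)) (Det-adjacent (minor A j) p′ λ i →
        trans (cong (A (suc i)) eq₁) (trans (A≡ (suc i)) (cong (A (suc i)) (sym eq₂)))))
      (solve 2 (λ s a → s :* (a :* con 0ℚ) := con 0ℚ) refl (sgn (toℕ j)) (A zero j))

  module _ {n} (A : Matrix (suc n) (suc n)) (p : Fin n) where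

    private
      F : (Fin (suc n) → ℚ) → (Fin (suc n) → ℚ) → ℚ
      F x y = Det (replace (inject₁ p) x (replace (suc p) y A))

      at-p : ∀ x y i → replace (inject₁ p) x (replace (suc p) y A) i (inject₁ p) ≡ x i
      at-p x y = replace-≡ (inject₁ p) x (replace (suc p) y A)

      at-q : ∀ x y i → replace (inject₁ p) x (replace (suc p) y A) i (suc p) ≡ y i
      at-q x y i = trans (replace-≢ (inject₁ p) x _ i (inject₁≢suc p ∘ sym)) (replace-≡ (suc p) y A i)

      at-others : ∀ x y i {k} → k ≢ inject₁ p → k ≢ suc p → replace (inject₁ p) x (replace (suc p) y A) i k ≡ A i k
      at-others x y i k≢p k≢q = trans (replace-≢ (inject₁ p) x _ i k≢p) (replace-≢ (suc p) y A i k≢q)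

      F-linearʳ : ∀ z x y t → F z (λ i → x i + t * y i) ≡ F z x + t * F z y
      F-linearʳ z x y t = Det-linear′ _ _ _ (suc p) t
        (λ i → trans (at-q z _ i) (sym (cong₂ (λ a b → a + t * b) (at-q z x i) (at-q z y i))))
        (same x) (same y)
        where
        same : ∀ w i k → k ≢ suc p → replace (inject₁ p) z (replace (suc p) w A) i k ≡
               replace (inject₁ p) z (replace (suc p) (λ i → x i + t * y i) A) i k
        same w i k k≢q with k ≟ inject₁ p
        ... | yes refl = trans (at-p z w i) (sym (at-p z _ i))
        ... | no k≢p = trans (at-others z w i k≢p k≢q) (sym (at-others z _ i k≢p k≢q))

    swapped : Matrix (suc n) (suc n)
    swapped = replace (inject₁ p) (λ i → A i (suc p)) (replace (suc p) (λ i → A i (inject₁ p)) A)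

    swapped-p : ∀ i → swapped i (inject₁ p) ≡ A i (suc p)
    swapped-p = at-p (λ i → A i (suc p)) (λ i → A i (inject₁ p))

    swapped-others : ∀ i {k} → k ≢ inject₁ p → k ≢ suc p → swapped i k ≡ A i k
    swapped-others = at-others (λ i → A i (suc p)) (λ i → A i (inject₁ p))

    -- Polarisation: the determinant vanishes with `a + b` in both places and with `a` or `b` in
    -- both, so the two mixed terms add up to zero.
    Det-swapped : Det swapped ≡ 0ℚ → Det A ≡ 0ℚ
    Det-swapped swapped≡0 = begin
      Det A ≡⟨ Det-cong original ⟩
      F a b ≡⟨ solve 1 (λ x → x := con 0ℚ :+ con 1ℚ :* x :+ con 1ℚ :* (con 0ℚ :+ con 1ℚ :* con 0ℚ)) refl (F a b) ⟩
      0ℚ + 1ℚ * F a b + 1ℚ * (0ℚ + 1ℚ * 0ℚ)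
        ≡⟨ cong₂ (λ u v → u + 1ℚ * F a b + 1ℚ * v) (sym (F-diagonal a)) (cong₂ (λ u v → u + 1ℚ * v) (sym swapped≡0) (sym (F-diagonal b))) ⟩
      F a a + 1ℚ * F a b + 1ℚ * (F b a + 1ℚ * F b b)
        ≡⟨ cong₂ (λ u v → u + 1ℚ * v) (F-linearʳ a a b 1ℚ) (F-linearʳ b a b 1ℚ) ⟨
      F a c + 1ℚ * F b c
        ≡⟨ Det-linear (inject₁ p) (replace (suc p) c A) a b 1ℚ ⟨
      F c c
        ≡⟨ F-diagonal c ⟩
      0ℚ
        ∎
      where
      a b c : Fin (suc n) → ℚ
      a i = A i (inject₁ p)
      b i = A i (suc p)
      c i = a i + 1ℚ * b i
      F-diagonal : ∀ x → F x x ≡ 0ℚ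
      F-diagonal x = Det-adjacent _ p λ i → trans (at-p x x i) (sym (at-q x x i))
      original : ∀ i k → A i k ≡ replace (inject₁ p) a (replace (suc p) b A) i k
      original i k with k ≟ inject₁ p
      ... | yes refl = sym (at-p a b i)
      ... | no k≢p with k ≟ suc p
      ... | yes refl = sym (at-q a b i)
      ... | no k≢q = sym (at-others a b i k≢p k≢q)

  -- Induction on the gap `d`: an adjacent swap brings the second of the equal columns one place
  -- nearer to the first.
  Det-alternating-< : ∀ d {n} (A : Matrix n n) p q → toℕ q ≡ suc (toℕ p ℕ.+ d) →
    (∀ i → A i p ≡ A i q) → Det A ≡ 0ℚ
  Det-alternating-< zero {suc n} A p (suc q) q≡ A≡ = Det-adjacent A q λ i → trans (cong (A i) (sym p≡)) (A≡ i)
    where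
    p≡ : p ≡ inject₁ q
    p≡ = Fin.toℕ-injective (trans (sym (trans (ℕ.suc-injective q≡) (ℕ.+-identityʳ (toℕ p)))) (sym (Fin.toℕ-inject₁ q)))
  Det-alternating-< (suc d) {suc n} A p (suc q) q≡ A≡ = Det-swapped A q
    (Det-alternating-< d (swapped A q) p (inject₁ q) (trans (Fin.toℕ-inject₁ q) q≡′) λ i →
      trans (swapped-others A q i p≢inject p≢suc) (trans (A≡ i) (sym (swapped-p A q i))))
    where
    q≡′ : toℕ q ≡ suc (toℕ p ℕ.+ d)
    q≡′ = trans (ℕ.suc-injective q≡) (ℕ.+-suc (toℕ p) d)
    p<q : toℕ p < toℕ q
    p<q = subst (toℕ p <_) (sym q≡′) (s≤s (ℕ.m≤m+n (toℕ p) d))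
    p≢inject : p ≢ inject₁ q
    p≢inject refl = ℕ.<-irrefl (Fin.toℕ-inject₁ q) p<q
    p≢suc : p ≢ suc q
    p≢suc refl = ℕ.<-asym p<q ≤-refl

  Det-alternating : ∀ {n} (A : Matrix n n) p q → p ≢ q → (∀ i → A i p ≡ A i q) → Det A ≡ 0ℚ
  Det-alternating A p q p≢q A≡ with ℕ.<-cmp (toℕ p) (toℕ q)
  ... | tri< p<q _ _ = Det-alternating-< (toℕ q ∸ suc (toℕ p)) A p q (sym (ℕ.m+[n∸m]≡n p<q)) A≡
  ... | tri≈ _ p≡q _ = contradiction (Fin.toℕ-injective p≡q) p≢q
  ... | tri> _ _ q<p = Det-alternating-< (toℕ p ∸ suc (toℕ q)) A q p (sym (ℕ.m+[n∸m]≡n q<p)) (sym ∘ A≡)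

-- Nonzero minors, relations between columns, integrality

module _ where

  open Determinant
  open ≡-Reasoning

  Det-axis : ∀ {n} (A : Matrix (suc n) (suc n)) j → (∀ i → A (suc i) j ≡ 0ℚ) →
             Det A ≡ sgn (toℕ j) * (A zero j * Det (minor A j))
  Det-axis {n} A j A≡0 = trans (Det-suc A) (∑-single j λ k j≢k → trans
    (cong (λ d → sgn (toℕ k) * (A zero k * d)) (vanish k j≢k))
    (solve 2 (λ s a → s :* (a :* con 0ℚ) := con 0ℚ) refl (sgn (toℕ k)) (A zero k)))
    where
    vanish : ∀ k → j ≢ k → Det (minor A k) ≡ 0ℚ
    vanish k j≢k = Det-zeroColumn (minor A k) (punchOut (j≢k ∘ sym)) λ i →
      trans (cong (A (suc i)) (Fin.punchIn-punchOut (j≢k ∘ sym))) (A≡0 i)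

  sgn≢0 : ∀ k → sgn k ≢ 0ℚ
  sgn≢0 zero ()
  sgn≢0 (suc k) eq = sgn≢0 k (*-cancel-0 {p = - 1ℚ} (λ ()) eq)

  ≢0-* : ∀ {p q} → p ≢ 0ℚ → q ≢ 0ℚ → p * q ≢ 0ℚ
  ≢0-* p≢0 q≢0 eq = q≢0 (*-cancel-0 p≢0 eq)

  -- Expanded by linearity, every term except the one of column `j` has two equal columns.
  Det-replace-combination : ∀ {n} (A : Matrix n n) j (a : Fin n → ℚ) →
    Det (replace j (λ i → ∑ (λ k → a k * A i k)) A) ≡ a j * Det A
  Det-replace-combination A j a = begin
    Det (replace j (λ i → ∑ (λ k → a k * A i k)) A)
      ≡⟨ linear-∑ (λ v → Det (replace j v A)) (Det-replace-cong j A) (Det-linear j A) a (λ k i → A i k) ⟩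
    ∑ (λ k → a k * Det (replace j (λ i → A i k) A))
      ≡⟨ ∑-single j (λ k j≢k → *-≡0ʳ (a k) (Det-alternating (replace j (λ i → A i k) A) j k j≢k λ i →
           trans (replace-≡ j (λ i → A i k) A i) (sym (replace-≢ j (λ i → A i k) A i (j≢k ∘ sym))))) ⟩
    a j * Det (replace j (λ i → A i j) A)
      ≡⟨ cong (a j *_) (Det-cong (replace-unique j (λ _ → refl) (λ _ _ _ → refl))) ⟨
    a j * Det A
      ∎

  Relation : ∀ {r k} → (Fin r → Fin k → ℚ) → (Fin k → ℚ) → Set
  Relation C a = ∀ i → ∑ (λ j → a j * C i j) ≡ 0ℚ

  Monotone : ∀ {k r} → (Fin k → Fin r) → Set
  Monotone ρ = ρ Preserves Fin._<_ ⟶ Fin._<_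

  monotone-suc : ∀ {k r} {ρ : Fin k → Fin r} → Monotone ρ → Monotone (suc ∘ ρ)
  monotone-suc mono i<j = s≤s (mono i<j)

  monotone-cons : ∀ {k r} {ρ : Fin k → Fin r} → Monotone ρ → Monotone (cons zero (suc ∘ ρ))
  monotone-cons mono {zero} {suc j} _ = s≤s z≤n
  monotone-cons mono {suc i} {suc j} (s≤s i<j) = s≤s (mono i<j)

  insert : ∀ {k} → Fin (suc k) → (Fin k → ℚ) → Fin (suc k) → ℚ
  insert j b l with j ≟ l
  ... | yes _ = 0ℚ
  ... | no j≢l = b (punchOut j≢l)

  insert-≡ : ∀ {k} j (b : Fin k → ℚ) → insert j b j ≡ 0ℚ
  insert-≡ j b with j ≟ j
  ... | yes _ = refl
  ... | no j≢j = contradiction refl j≢j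

  insert-punchIn : ∀ {k} j (b : Fin k → ℚ) l → insert j b (punchIn j l) ≡ b l
  insert-punchIn j b l with j ≟ punchIn j l
  ... | yes eq = contradiction (sym eq) (Fin.punchInᵢ≢i j l)
  ... | no j≢ = cong b (trans (Fin.punchOut-cong j refl) (Fin.punchOut-punchIn j))

  ∑-punchIn : ∀ {k} j (f : Fin (suc k) → ℚ) → ∑ f ≡ f j + ∑ (λ l → f (punchIn j l))
  ∑-punchIn j f = trans (∑≡sum f) (trans (sum-remove {i = j} f) (cong (f j +_) (sym (∑≡sum (λ l → f (punchIn j l))))))

  insert-relation : ∀ {k r} j (b : Fin k → ℚ) (C : Fin r → Fin (suc k) → ℚ) i →
    ∑ (λ l → insert j b l * C i l) ≡ ∑ (λ l → b l * C i (punchIn j l))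
  insert-relation j b C i = begin
    ∑ (λ l → insert j b l * C i l)
      ≡⟨ ∑-punchIn j (λ l → insert j b l * C i l) ⟩
    insert j b j * C i j + ∑ (λ l → insert j b (punchIn j l) * C i (punchIn j l))
      ≡⟨ cong₂ _+_ (*-≡0ˡ (C i j) (insert-≡ j b))
           (∑-cong λ l → cong (_* C i (punchIn j l)) (insert-punchIn j b l)) ⟩
    0ℚ + ∑ (λ l → b l * C i (punchIn j l))
      ≡⟨ ℚ.+-identityˡ _ ⟩
    ∑ (λ l → b l * C i (punchIn j l))
      ∎

  -- Induction on rows. Suppose `a` is a relation below the top row with value `s ≠ 0` on it and
  -- `a j₀ ≠ 0`; the same question is asked for the lower rows without column `j₀`. A nonzero minor
  -- found there extends by the top row: replacing column `j₀` by the combination `a` turns it into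
  -- `(s, 0, …, 0)` and multiplies the determinant by `a j₀`.
  nonzero-minor-or-relation : ∀ {r k} (C : Fin r → Fin k → ℚ) →
    (Σ[ ρ ∈ (Fin k → Fin r) ] Monotone ρ × Det (λ i j → C (ρ i) j) ≢ 0ℚ) ⊎
    (Σ[ a ∈ (Fin k → ℚ) ] (∃[ j ] a j ≢ 0ℚ) × Relation C a)
  nonzero-minor-or-relation {r} {zero} C = inj₁ ((λ ()) , (λ { {()} }) , λ eq → contradiction (trans (sym (Det-zero _)) eq) λ ())
  nonzero-minor-or-relation {zero} {suc k} C = inj₂ ((λ _ → 1ℚ) , (zero , λ ()) , λ ())
  nonzero-minor-or-relation {suc r} {suc k} C with nonzero-minor-or-relation (C ∘ suc)
  ... | inj₁ (ρ , mono , det≢0) = inj₁ (suc ∘ ρ , monotone-suc mono , det≢0)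
  ... | inj₂ (a , (j₀ , a≢0) , rel) = extend-by-row (s ℚ.≟ 0ℚ)
    where
    s = ∑ (λ j → a j * C zero j)
    tail : Fin r → Fin k → ℚ
    tail i l = C (suc i) (punchIn j₀ l)
    Goal = (Σ[ ρ ∈ (Fin (suc k) → Fin (suc r)) ] Monotone ρ × Det (λ i j → C (ρ i) j) ≢ 0ℚ) ⊎
           (Σ[ a ∈ (Fin (suc k) → ℚ) ] (∃[ j ] a j ≢ 0ℚ) × Relation C a)
    module _ (s≢0 : s ≢ 0ℚ) where
      from-minor : (Σ[ ρ ∈ (Fin k → Fin r) ] Monotone ρ × Det (λ i l → tail (ρ i) l) ≢ 0ℚ) → Goal
      from-minor (ρ , mono , det≢0) = inj₁ (ρ₀ , monotone-cons mono , λ eq → ≢0-* (sgn≢0 (toℕ j₀)) (≢0-* s≢0 det≢0) (begin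
        sgn (toℕ j₀) * (s * Det (λ i l → tail (ρ i) l))
          ≡⟨ cong₂ (λ p q → sgn (toℕ j₀) * (p * q)) (replace-≡ j₀ v U zero)
               (Det-cong λ i l → replace-≢ j₀ v U (suc i) (Fin.punchInᵢ≢i j₀ l)) ⟨
        sgn (toℕ j₀) * (replace j₀ v U zero j₀ * Det (minor (replace j₀ v U) j₀))
          ≡⟨ Det-axis (replace j₀ v U) j₀ (λ i → trans (replace-≡ j₀ v U (suc i)) (rel (ρ i))) ⟨
        Det (replace j₀ v U)
          ≡⟨ Det-replace-combination U j₀ a ⟩
        a j₀ * Det U
          ≡⟨ *-≡0ʳ (a j₀) eq ⟩
        0ℚ
          ∎))
        where
        ρ₀ : Fin (suc k) → Fin (suc r)
        ρ₀ = cons zero (suc ∘ ρ)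
        U : Matrix (suc k) (suc k)
        U i j = C (ρ₀ i) j
        v : Fin (suc k) → ℚ
        v i = ∑ (λ j → a j * U i j)
      from-relation : (Σ[ b ∈ (Fin k → ℚ) ] (∃[ l ] b l ≢ 0ℚ) × Relation tail b) → Goal
      from-relation (b , (l , b≢0) , rel-b) = by-cases (s′ ℚ.≟ 0ℚ)
        where
        b′ = insert j₀ b
        s′ = ∑ (λ j → b′ j * C zero j)
        -- The combination of the two relations whose values on the top row cancel; it is nonzero at
        -- `j₀`, where `b′` is zero and `a` is not.
        c : Fin (suc k) → ℚ
        c j = s * b′ j + (- s′) * a j
        c-value : ∀ i → ∑ (λ j → c j * C i j) ≡ s * ∑ (λ j → b′ j * C i j) + (- s′) * ∑ (λ j → a j * C i j)
        c-value i = trans (∙-linearˡ (λ j → s * b′ j) a (C i) (- s′)) (cong (_+ (- s′) * ∑ (λ j → a j * C i j))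
          (trans (∑-cong λ j → ℚ.*-assoc s (b′ j) (C i j)) (sym (*-∑ s (λ j → b′ j * C i j)))))
        rel-b′ : ∀ i → ∑ (λ j → b′ j * C (suc i) j) ≡ 0ℚ
        rel-b′ i = trans (insert-relation j₀ b C (suc i)) (rel-b i)
        by-cases : Dec (s′ ≡ 0ℚ) → Goal
        by-cases (yes s′≡0) = inj₂ (b′ , (punchIn j₀ l , λ eq → b≢0 (trans (sym (insert-punchIn j₀ b l)) eq)) ,
          λ { zero → s′≡0 ; (suc i) → rel-b′ i })
        by-cases (no s′≢0) = inj₂ (c , (j₀ , λ eq → ≢0-* s′≢0 a≢0 (begin
            s′ * a j₀ ≡⟨ solve 3 (λ s p q → p :* q := (:- con 1ℚ) :* (s :* con 0ℚ :+ (:- p) :* q)) refl s s′ (a j₀) ⟩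
            (- 1ℚ) * (s * 0ℚ + (- s′) * a j₀) ≡⟨ cong (λ p → (- 1ℚ) * (s * p + (- s′) * a j₀)) (insert-≡ j₀ b) ⟨
            (- 1ℚ) * c j₀ ≡⟨ *-≡0ʳ (- 1ℚ) eq ⟩
            0ℚ ∎)) ,
          λ { zero → trans (c-value zero) (solve 2 (λ s t → s :* t :+ (:- t) :* s := con 0ℚ) refl s s′)
            ; (suc i) → trans (c-value (suc i)) (trans (cong₂ (λ p q → s * p + (- s′) * q) (rel-b′ i) (rel i))
                (solve 2 (λ s t → s :* con 0ℚ :+ (:- t) :* con 0ℚ := con 0ℚ) refl s s′))
            })
    extend-by-row : Dec (s ≡ 0ℚ) → Goal
    extend-by-row (yes s≡0) = inj₂ (a , (j₀ , a≢0) , λ { zero → s≡0 ; (suc i) → rel i })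
    extend-by-row (no s≢0) with nonzero-minor-or-relation tail
    ... | inj₁ minor-ρ = from-minor s≢0 minor-ρ
    ... | inj₂ rel-b = from-relation s≢0 rel-b

  enum : ∀ {m} (S : Subset m) → Fin (card S) → Fin m
  enum (true Vec.∷ S) zero = zero
  enum (true Vec.∷ S) (suc i) = suc (enum S i)
  enum (false Vec.∷ S) i = suc (enum S i)

  enum-monotone : ∀ {m} (S : Subset m) → Monotone (enum S)
  enum-monotone (true Vec.∷ S) {zero} {suc j} _ = s≤s z≤n
  enum-monotone (true Vec.∷ S) {suc i} {suc j} (s≤s i<j) = s≤s (enum-monotone S i<j)
  enum-monotone (false Vec.∷ S) i<j = s≤s (enum-monotone S i<j)

  enum-∈ : ∀ {m} (S : Subset m) i → enum S i ∈ S
  enum-∈ (true Vec.∷ S) zero = Vec.here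
  enum-∈ (true Vec.∷ S) (suc i) = Vec.there (enum-∈ S i)
  enum-∈ (false Vec.∷ S) i = Vec.there (enum-∈ S i)

  enum-surjective : ∀ {m} {S : Subset m} {e} → e ∈ S → ∃[ i ] enum S i ≡ e
  enum-surjective {S = true Vec.∷ S} Vec.here = zero , refl
  enum-surjective {S = true Vec.∷ S} (Vec.there e∈S) with enum-surjective e∈S
  ... | i , eq = suc i , cong suc eq
  enum-surjective {S = false Vec.∷ S} (Vec.there e∈S) with enum-surjective e∈S
  ... | i , eq = i , cong suc eq

  enum-injective : ∀ {m} (S : Subset m) {i j} → enum S i ≡ enum S j → i ≡ j
  enum-injective S {i} {j} eq with Fin.<-cmp i j
  ... | tri< i<j _ _ = contradiction (cong toℕ eq) (ℕ.<⇒≢ (enum-monotone S i<j))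
  ... | tri≈ _ i≡j _ = i≡j
  ... | tri> _ _ j<i = contradiction (cong toℕ (sym eq)) (ℕ.<⇒≢ (enum-monotone S j<i))

  Unit : ℚ → Set
  Unit q = q ≡ 1ℚ ⊎ q ≡ - 1ℚ

  unit-* : ∀ {p q} → Unit p → Unit q → Unit (p * q)
  unit-* (inj₁ refl) (inj₁ refl) = inj₁ refl
  unit-* (inj₁ refl) (inj₂ refl) = inj₂ refl
  unit-* (inj₂ refl) (inj₁ refl) = inj₂ refl
  unit-* (inj₂ refl) (inj₂ refl) = inj₁ refl

  unit-square : ∀ {p} → Unit p → p * p ≡ 1ℚ
  unit-square (inj₁ refl) = refl
  unit-square (inj₂ refl) = refl

  -- Stated through unnormalised fractions of denominator 1, whose sums and products again have
  -- denominator 1 without any reduction to lowest terms.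
  record Integral (q : ℚ) : Set where
    constructor integral
    field
      numerator : ℤ.ℤ
      equal : ℚ.toℚᵘ q ℚᵘ.≃ ℚᵘ.mkℚᵘ numerator 0

  integral-0 : Integral 0ℚ
  integral-0 = integral (ℤ.+ 0) ℚᵘ.≃-refl

  integral-1 : Integral 1ℚ
  integral-1 = integral (ℤ.+ 1) ℚᵘ.≃-refl

  integral--1 : Integral (- 1ℚ)
  integral--1 = integral (ℤ.- (ℤ.+ 1)) ℚᵘ.≃-refl

  integral-+ : ∀ {p q} → Integral p → Integral q → Integral (p + q)
  integral-+ {p} {q} (integral x p≃x) (integral y q≃y) = integral (x ℤ.* ℤ.+ 1 ℤ.+ y ℤ.* ℤ.+ 1)
    (ℚᵘ.≃-trans (ℚ.toℚᵘ-homo-+ p q) (ℚᵘ.+-cong p≃x q≃y))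

  integral-* : ∀ {p q} → Integral p → Integral q → Integral (p * q)
  integral-* {p} {q} (integral x p≃x) (integral y q≃y) = integral (x ℤ.* y)
    (ℚᵘ.≃-trans (ℚ.toℚᵘ-homo-* p q) (ℚᵘ.*-cong p≃x q≃y))

  integral-∑ : ∀ {n} {f : Fin n → ℚ} → (∀ i → Integral (f i)) → Integral (∑ f)
  integral-∑ {zero} {f} int = subst Integral (sym (∑-empty f)) integral-0
  integral-∑ {suc n} {f} int = subst Integral (sym (∑-suc f)) (integral-+ (int zero) (integral-∑ λ i → int (suc i)))

  integral-sgn : ∀ k → Integral (sgn k)
  integral-sgn zero = integral-1
  integral-sgn (suc k) = integral-* integral--1 (integral-sgn k)

  integral-Det : ∀ {n} {A : Matrix n n} → (∀ i j → Integral (A i j)) → Integral (Det A)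
  integral-Det {zero} {A} int = subst Integral (sym (Det-zero A)) integral-1
  integral-Det {suc n} {A} int = subst Integral (sym (Det-suc A)) (integral-∑ λ j →
    integral-* (integral-sgn (toℕ j)) (integral-* (int zero j) (integral-Det λ i k → int (suc i) (punchIn j k))))

  integral-inverse : ∀ {p q} → Integral p → Integral q → p * q ≡ 1ℚ → Unit p
  integral-inverse {p} {q} P@(integral x p≃x) Q@(integral y q≃y) pq≡1 = by-sign (±1 x ∣x∣≡1)
    where
    ±1 : ∀ i → ℤ.∣ i ∣ ≡ 1 → i ≡ ℤ.+ 1 ⊎ i ≡ ℤ.- (ℤ.+ 1)
    ±1 (ℤ.+ _) refl = inj₁ refl
    ±1 ℤ.-[1+ _ ] refl = inj₂ refl
    xy≡1 : x ℤ.* y ≡ ℤ.+ 1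
    xy≡1 with ℚᵘ.≃-trans (ℚᵘ.≃-sym (Integral.equal (integral-* P Q))) (ℚᵘ.≃-reflexive (cong ℚ.toℚᵘ pq≡1))
    ... | ℚᵘ.*≡* eq = trans (sym (ℤ.*-identityʳ (x ℤ.* y))) eq
    ∣x∣≡1 : ℤ.∣ x ∣ ≡ 1
    ∣x∣≡1 = ℕ.m*n≡1⇒m≡1 ℤ.∣ x ∣ ℤ.∣ y ∣ (trans (sym (ℤ.abs-* x y)) (cong ℤ.∣_∣ xy≡1))
    by-sign : x ≡ ℤ.+ 1 ⊎ x ≡ ℤ.- (ℤ.+ 1) → Unit p
    by-sign (inj₁ refl) = inj₁ (ℚ.toℚᵘ-injective p≃x)
    by-sign (inj₂ refl) = inj₂ (ℚ.toℚᵘ-injective p≃x)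

-- Totally unimodular representations

open Determinant using (Matrix; Det; replace; replace-≡; replace-≢; replace-unique; Det-replace-cong; Det-linear; Det-cong; Det-alternating; Det-zeroColumn)

-- Restrictions to the columns of linear functionals on their span, that is, the row space of `B`,
-- given as the orthogonal complement of the relations so that no coefficient vector has to be
-- carried along.
Functional : ∀ {r m} → (Fin r → Fin m → ℚ) → (Fin m → ℚ) → Set
Functional B φ = ∀ a → Relation B a → a ∙ φ ≡ 0ℚ

functional-row : ∀ {r m} (B : Fin r → Fin m → ℚ) (y : Fin r → ℚ) → Functional B (λ e → ∑ (λ i → y i * B i e))
functional-row B y a rel = begin
  ∑ (λ e → a e * ∑ (λ i → y i * B i e))
    ≡⟨ ∑-cong (λ e → *-∑ (a e) (λ i → y i * B i e)) ⟩
  ∑ (λ e → ∑ (λ i → a e * (y i * B i e)))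
    ≡⟨ ∑-swap (λ e i → a e * (y i * B i e)) ⟩
  ∑ (λ i → ∑ (λ e → a e * (y i * B i e)))
    ≡⟨ ∑-cong (λ i → trans (∑-cong λ e → solve 3 (λ a y b → a :* (y :* b) := y :* (a :* b)) refl (a e) (y i) (B i e))
         (sym (*-∑ (y i) (λ e → a e * B i e)))) ⟩
  ∑ (λ i → y i * ∑ (λ e → a e * B i e))
    ≡⟨ ∑-zero (λ i → *-≡0ʳ (y i) (rel i)) ⟩
  0ℚ
    ∎
  where open ≡-Reasoning

functional-linear : ∀ {r m} {B : Fin r → Fin m → ℚ} {φ ψ} → Functional B φ → Functional B ψ → ∀ t →
  Functional B (λ e → φ e + t * ψ e)
functional-linear {φ = φ} {ψ} Fφ Fψ t a rel = trans (∙-linearʳ a φ ψ t)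
  (trans (cong₂ (λ p q → p + t * q) (Fφ a rel) (Fψ a rel)) (solve 1 (λ t → con 0ℚ :+ t :* con 0ℚ := con 0ℚ) refl t))

-- The two directions of linear independence are kept in the forms that are applied: `independent`
-- kills rational relations, and `detects` turns a rational separating functional into independence
-- in the matroid.
record Representation {m : ℕ} (M : Matroid m) : Set where
  open Matroid M
  field
    r : ℕ
    B : Fin r → Fin m → ℚ
    entries : ∀ i e → Integral (B i e)
    totally-unimodular : ∀ {k} (ρ : Fin k → Fin r) (κ : Fin k → Fin m) → Monotone ρ → Monotone κ →
      Det (λ i j → B (ρ i) (κ j)) ≡ 0ℚ ⊎ Unit (Det (λ i j → B (ρ i) (κ j)))
    independent : ∀ {S} → Indep S → ∀ a → (∀ e → e ∉ S → a e ≡ 0ℚ) → Relation B a → ∀ e → a e ≡ 0ℚ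
    detects : ∀ {S e} → Indep S → ∀ (y : Fin r → ℚ) → (∀ f → f ∈ S → ∑ (λ i → y i * B i f) ≡ 0ℚ) →
      ∑ (λ i → y i * B i e) ≢ 0ℚ → Indep (S ⊕ e)

-- Functionals on the column space

module Represented {m : ℕ} (M : Matroid m) (n : ℕ) (rep : Representation M) where

  open Matroid M
  open Mixed M n
  open Representation rep
  open ≡-Reasoning

  Vanishes : Subset m → (Fin m → ℚ) → Set
  Vanishes S φ = ∀ f → f ∈ S → φ f ≡ 0ℚ

  -- Fredholm's alternative for the column of `e` against the columns in `S`; the factor `ι` zeroes
  -- the other columns, so that they may keep their indices in `Fin m`.
  separate : ∀ S e → e ∉ S →
    (Σ[ a ∈ (Fin m → ℚ) ] (∀ f → f ∉ S ⊕ e → a f ≡ 0ℚ) × a e ≡ 1ℚ × Relation B a) ⊎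
    (Σ[ y ∈ (Fin r → ℚ) ] Vanishes S (λ f → ∑ (λ i → y i * B i f)) × ∑ (λ i → y i * B i e) ≢ 0ℚ)
  separate S e e∉S = conclude (fredholm (λ j i → ι j * B i j) (λ i → B i e))
    where
    ι : Fin m → ℚ
    ι j = 𝟙 (j Sub.∈? S)
    ι-∈ : ∀ {j} → j ∈ S → ι j ≡ 1ℚ
    ι-∈ {j} = 𝟙-yes (j Sub.∈? S)
    ι-∉ : ∀ {j} → j ∉ S → ι j ≡ 0ℚ
    ι-∉ {j} = 𝟙-no (j Sub.∈? S)
    conclude : (Σ[ z ∈ (Fin m → ℚ) ] (∀ i → ∑ (λ j → z j * (ι j * B i j)) ≡ B i e)) ⊎
      (Σ[ y ∈ (Fin r → ℚ) ] (∀ j → y ∙ (λ i → ι j * B i j) ≡ 0ℚ) × y ∙ (λ i → B i e) ≢ 0ℚ) →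
      (Σ[ a ∈ (Fin m → ℚ) ] (∀ f → f ∉ S ⊕ e → a f ≡ 0ℚ) × a e ≡ 1ℚ × Relation B a) ⊎
      (Σ[ y ∈ (Fin r → ℚ) ] Vanishes S (λ f → ∑ (λ i → y i * B i f)) × ∑ (λ i → y i * B i e) ≢ 0ℚ)
    conclude (inj₁ (z , z-sol)) = inj₁ (a , support , at-e , relation)
      where
      a : Fin m → ℚ
      a f = δ e f + (- 1ℚ) * (z f * ι f)
      support : ∀ f → f ∉ S ⊕ e → a f ≡ 0ℚ
      support f f∉ = trans (cong₂ (λ p q → p + (- 1ℚ) * (z f * q)) (δ-≢ {i = e} {f} λ { refl → f∉ self-∈-⊕ }) (ι-∉ (f∉ ∘ ⊆-⊕)))
        (solve 1 (λ z → con 0ℚ :+ (:- con 1ℚ) :* (z :* con 0ℚ) := con 0ℚ) refl (z f))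
      at-e : a e ≡ 1ℚ
      at-e = trans (cong₂ (λ p q → p + (- 1ℚ) * (z e * q)) (δ-refl e) (ι-∉ e∉S))
        (solve 1 (λ z → con 1ℚ :+ (:- con 1ℚ) :* (z :* con 0ℚ) := con 1ℚ) refl (z e))
      relation : Relation B a
      relation i = begin
        ∑ (λ f → a f * B i f)
          ≡⟨ ∙-linearˡ (δ e) (λ f → z f * ι f) (B i) (- 1ℚ) ⟩
        δ e ∙ B i + (- 1ℚ) * ∑ (λ f → z f * ι f * B i f)
          ≡⟨ cong₂ (λ p q → p + (- 1ℚ) * q) (∑-δ (B i) e) (trans (∑-cong λ f → ℚ.*-assoc (z f) (ι f) (B i f)) (z-sol i)) ⟩
        B i e + (- 1ℚ) * B i e
          ≡⟨ solve 1 (λ b → b :+ (:- con 1ℚ) :* b := con 0ℚ) refl (B i e) ⟩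
        0ℚ
          ∎
    conclude (inj₂ (y , yV≡0 , ye≢0)) = inj₂ (y , (λ f f∈S → begin
        ∑ (λ i → y i * B i f) ≡⟨ ∑-cong (λ i → cong (y i *_) (trans (sym (ℚ.*-identityˡ (B i f))) (cong (_* B i f) (sym (ι-∈ f∈S))))) ⟩
        y ∙ (λ i → ι f * B i f) ≡⟨ yV≡0 f ⟩
        0ℚ ∎) , ye≢0)

  relation-of-dependence : ∀ {S e} → Indep S → e ∉ S → ¬ Indep (S ⊕ e) →
    Σ[ a ∈ (Fin m → ℚ) ] (∀ f → f ∉ S ⊕ e → a f ≡ 0ℚ) × a e ≡ 1ℚ × Relation B a
  relation-of-dependence {S} {e} ind e∉S ¬ind with separate S e e∉S
  ... | inj₁ relation = relation
  ... | inj₂ (y , y≡0 , ye≢0) = contradiction (detects ind y y≡0 ye≢0) ¬ind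

  functional-of-extension : ∀ {S e} → Extends S e →
    Σ[ φ ∈ (Fin m → ℚ) ] Functional B φ × Vanishes S φ × φ e ≢ 0ℚ
  functional-of-extension {S} {e} ext with separate S e (extends⇒∉ ext)
  ... | inj₁ (a , support , ae≡1 , relation) =
    contradiction (trans (sym ae≡1) (independent (ext .proj₁) a support relation e)) λ ()
  ... | inj₂ (y , y≡0 , ye≢0) = (λ f → ∑ (λ i → y i * B i f)) , functional-row B y , y≡0 , ye≢0

  -- By total unimodularity Cramer's rule gives a dual basis of the columns in
  -- S that is integral on all columns.
  integral-functional : ∀ {S e} → Indep S → e ∈ S →
    Σ[ ψ ∈ (Fin m → ℚ) ] Functional B ψ × (∀ f → f ∈ S → f ≢ e → ψ f ≡ 0ℚ) × Unit (ψ e) × (∀ f → Integral (ψ f))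
  integral-functional {S} {e} ind e∈S with nonzero-minor-or-relation (λ i j → B i (enum S j))
  ... | inj₂ (a , (j , aj≢0) , rel) = contradiction aj≡0 aj≢0
    where
    a′ : Fin m → ℚ
    a′ f = ∑ (λ l → a l * δ (enum S l) f)
    support : ∀ f → f ∉ S → a′ f ≡ 0ℚ
    support f f∉S = ∑-zero λ l → *-≡0ʳ (a l) (δ-≢ {i = enum S l} {f} λ { refl → f∉S (enum-∈ S l) })
    relation : Relation B a′
    relation i = begin
      ∑ (λ f → a′ f * B i f)
        ≡⟨ ∑-cong (λ f → trans (ℚ.*-comm (a′ f) (B i f)) (*-∑ (B i f) (λ l → a l * δ (enum S l) f))) ⟩
      ∑ (λ f → ∑ (λ l → B i f * (a l * δ (enum S l) f)))
        ≡⟨ ∑-swap (λ f l → B i f * (a l * δ (enum S l) f)) ⟩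
      ∑ (λ l → ∑ (λ f → B i f * (a l * δ (enum S l) f)))
        ≡⟨ ∑-cong (λ l → trans (∑-cong λ f → solve 3 (λ b a d → b :* (a :* d) := a :* (d :* b)) refl (B i f) (a l) (δ (enum S l) f))
             (trans (sym (*-∑ (a l) (λ f → δ (enum S l) f * B i f))) (cong (a l *_) (∑-δ (B i) (enum S l))))) ⟩
      ∑ (λ l → a l * B i (enum S l))
        ≡⟨ rel i ⟩
      0ℚ
        ∎
    aj≡0 : a j ≡ 0ℚ
    aj≡0 = begin
      a j ≡⟨ ℚ.*-identityʳ (a j) ⟨
      a j * 1ℚ ≡⟨ cong (a j *_) (δ-refl (enum S j)) ⟨
      a j * δ (enum S j) (enum S j) ≡⟨ ∑-single j (λ l j≢l → *-≡0ʳ (a l) (δ-≢ {i = enum S l} {enum S j} (j≢l ∘ sym ∘ enum-injective S))) ⟨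
      a′ (enum S j) ≡⟨ independent ind a′ support relation (enum S j) ⟩
      0ℚ ∎
  ... | inj₁ (ρ , mono , det≢0) = cramer (enum-surjective e∈S)
    where
    U : Matrix (card S) (card S)
    U i j = B (ρ i) (enum S j)
    cramer : ∃[ p ] enum S p ≡ e →
      Σ[ ψ ∈ (Fin m → ℚ) ] Functional B ψ × (∀ f → f ∈ S → f ≢ e → ψ f ≡ 0ℚ) × Unit (ψ e) × (∀ f → Integral (ψ f))
    cramer (p , refl) = ψ , functional , vanishes , unit , λ f → integral-Det λ i j → integral-entry f i j
      where
      F : (Fin (card S) → ℚ) → ℚ
      F v = Det (replace p v U)
      ψ : Fin m → ℚ
      ψ f = F (λ i → B (ρ i) f)
      functional : Functional B ψ
      functional a rel = begin
        ∑ (λ f → a f * ψ f)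
          ≡⟨ linear-∑ F (Det-replace-cong p U) (Det-linear p U) a (λ f i → B (ρ i) f) ⟨
        F (λ i → ∑ (λ f → a f * B (ρ i) f))
          ≡⟨ Det-replace-cong p U (λ i → rel (ρ i)) ⟩
        F (λ _ → 0ℚ)
          ≡⟨ Det-zeroColumn (replace p (λ _ → 0ℚ) U) p (replace-≡ p (λ _ → 0ℚ) U) ⟩
        0ℚ
          ∎
      vanishes : ∀ f → f ∈ S → f ≢ enum S p → ψ f ≡ 0ℚ
      vanishes f f∈S f≢e with enum-surjective f∈S
      ... | l , refl = Det-alternating (replace p v U) p l (λ { refl → f≢e refl }) λ i →
        trans (replace-≡ p v U i) (sym (replace-≢ p v U i (λ { refl → f≢e refl })))
        where
        v : Fin (card S) → ℚ
        v i = B (ρ i) (enum S l)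
      ψe≡ : Det U ≡ ψ (enum S p)
      ψe≡ = Det-cong (replace-unique p (λ _ → refl) (λ _ _ _ → refl))
      unit : Unit (ψ (enum S p))
      unit with totally-unimodular ρ (enum S) mono (enum-monotone S)
      ... | inj₁ det≡0 = contradiction det≡0 det≢0
      ... | inj₂ u = subst Unit ψe≡ u
      integral-entry : ∀ f i j → Integral (replace p (λ i → B (ρ i) f) U i j)
      integral-entry f i j with j ≟ p
      ... | yes refl = subst Integral (sym (replace-≡ p (λ i → B (ρ i) f) U i)) (entries (ρ i) f)
      ... | no j≢p = subst Integral (sym (replace-≢ p (λ i → B (ρ i) f) U i j≢p)) (entries (ρ i) (enum S j))

  relation-value : ∀ {S e f} → e ≢ f → ∀ a → (∀ g → g ∉ S ⊕ e ⊕ f → a g ≡ 0ℚ) → a f ≡ 1ℚ → Relation B a →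
    ∀ φ → Functional B φ → Vanishes S φ → φ f ≡ (- a e) * φ e
  relation-value {S} {e} {f} e≢f a support af≡1 rel φ Fφ φ≡0 = begin
    φ f
      ≡⟨ solve 3 (λ x a y → x := con 1ℚ :* x :+ a :* y :+ (:- a) :* y) refl (φ f) (a e) (φ e) ⟩
    1ℚ * φ f + a e * φ e + (- a e) * φ e
      ≡⟨ cong (λ p → p * φ f + a e * φ e + (- a e) * φ e) af≡1 ⟨
    a f * φ f + a e * φ e + (- a e) * φ e
      ≡⟨ cong (_+ (- a e) * φ e) (trans (sym (∑-pair f e (e≢f ∘ sym) others)) (Fφ a rel)) ⟩
    0ℚ + (- a e) * φ e
      ≡⟨ ℚ.+-identityˡ _ ⟩
    (- a e) * φ e
      ∎
    where
    others : ∀ g → g ≢ f → g ≢ e → a g * φ g ≡ 0ℚ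
    others g g≢f g≢e = by-cases (g Sub.∈? S)
      where
      by-cases : Dec (g ∈ S) → a g * φ g ≡ 0ℚ
      by-cases (yes g∈S) = *-≡0ʳ (a g) (φ≡0 g g∈S)
      by-cases (no g∉S) = *-≡0ˡ (φ g) (support g (∉-⊕ (∉-⊕ g∉S g≢e) g≢f))

  -- Functionals vanishing on `S` see only the terms at `e` and `f` of the dependence between them,
  -- which leaves one ratio. Comparing the integral dual functionals of `e` and of `f` shows that
  -- this ratio is a unit.
  parallel-proportional : ∀ {S e f} → Parallel S e f →
    Σ[ u ∈ ℚ ] Unit u × (∀ φ → Functional B φ → Vanishes S φ → φ f ≡ u * φ e)
  parallel-proportional {S} {e} {f} ((Se , Sf) , ¬Sef) with e ≟ f
  ... | yes refl = 1ℚ , inj₁ refl , λ φ _ _ → sym (ℚ.*-identityˡ (φ e))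
  ... | no e≢f = - a e , unit , value
    where
    f∉Se : f ∉ S ⊕ e
    f∉Se = ∉-⊕ (extends⇒∉ Sf) (e≢f ∘ sym)
    dependence = relation-of-dependence (Se .proj₁) f∉Se (¬Sef ∘ ∉⇒extends f∉Se)
    a = dependence .proj₁
    value : ∀ φ → Functional B φ → Vanishes S φ → φ f ≡ (- a e) * φ e
    value = relation-value e≢f a (dependence .proj₂ .proj₁) (dependence .proj₂ .proj₂ .proj₁) (dependence .proj₂ .proj₂ .proj₂)
    at-e = integral-functional (Se .proj₁) (self-∈-⊕ {S = S} {e = e})
    at-f = integral-functional (Sf .proj₁) (self-∈-⊕ {S = S} {e = f})
    ψ ψ′ : Fin m → ℚ
    ψ = at-e .proj₁
    ψ′ = at-f .proj₁
    unit-e : Unit (ψ e)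
    unit-e = at-e .proj₂ .proj₂ .proj₂ .proj₁
    unit-f : Unit (ψ′ f)
    unit-f = at-f .proj₂ .proj₂ .proj₂ .proj₁
    ψf : ψ f ≡ (- a e) * ψ e
    ψf = value ψ (at-e .proj₂ .proj₁) λ g g∈S → at-e .proj₂ .proj₂ .proj₁ g (⊆-⊕ g∈S) λ { refl → extends⇒∉ Se g∈S }
    ψ′f : ψ′ f ≡ (- a e) * ψ′ e
    ψ′f = value ψ′ (at-f .proj₂ .proj₁) λ g g∈S → at-f .proj₂ .proj₂ .proj₁ g (⊆-⊕ g∈S) λ { refl → extends⇒∉ Sf g∈S }
    integral-ψf : Integral (ψ f)
    integral-ψf = at-e .proj₂ .proj₂ .proj₂ .proj₂ f
    integral-ψ′e : Integral (ψ′ e)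
    integral-ψ′e = at-f .proj₂ .proj₂ .proj₂ .proj₂ e
    integral-unit : ∀ {q} → Unit q → Integral q
    integral-unit (inj₁ refl) = integral-1
    integral-unit (inj₂ refl) = integral--1
    -- The ratio of f to e and its inverse are both integral.
    unit-ψf : Unit (ψ f)
    unit-ψf = integral-inverse integral-ψf (integral-* integral-ψ′e (integral-unit (unit-* unit-e unit-f))) (begin
      ψ f * (ψ′ e * (ψ e * ψ′ f))
        ≡⟨ cong (_* (ψ′ e * (ψ e * ψ′ f))) ψf ⟩
      (- a e) * ψ e * (ψ′ e * (ψ e * ψ′ f))
        ≡⟨ solve 4 (λ c p q s → c :* p :* (q :* (p :* s)) := p :* p :* (c :* q :* s)) refl (- a e) (ψ e) (ψ′ e) (ψ′ f) ⟩
      ψ e * ψ e * ((- a e) * ψ′ e * ψ′ f)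
        ≡⟨ cong₂ (λ p q → p * (q * ψ′ f)) (unit-square unit-e) (sym ψ′f) ⟩
      1ℚ * (ψ′ f * ψ′ f)
        ≡⟨ cong (1ℚ *_) (unit-square unit-f) ⟩
      1ℚ * 1ℚ
        ∎)
    unit : Unit (- a e)
    unit = subst Unit (begin
      ψ f * ψ e ≡⟨ cong (_* ψ e) ψf ⟩
      (- a e) * ψ e * ψ e ≡⟨ ℚ.*-assoc (- a e) (ψ e) (ψ e) ⟩
      (- a e) * (ψ e * ψ e) ≡⟨ cong ((- a e) *_) (unit-square unit-e) ⟩
      (- a e) * 1ℚ ≡⟨ ℚ.*-identityʳ (- a e) ⟩
      - a e ∎) (unit-* unit-ψf unit-e)

  -- The sign occurs twice and squares to 1. A mere linear representation would leave the square of
  -- an arbitrary ratio here.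
  parallel-product : ∀ {S e f} → Parallel S e f → ∀ φ ψ → Functional B φ → Functional B ψ →
    Vanishes S φ → Vanishes S ψ → φ e * ψ e ≡ φ f * ψ f
  parallel-product {e = e} {f} par φ ψ Fφ Fψ φ≡0 ψ≡0 with parallel-proportional par
  ... | u , unit , value = sym (begin
    φ f * ψ f ≡⟨ cong₂ _*_ (value φ Fφ φ≡0) (value ψ Fψ ψ≡0) ⟩
    u * φ e * (u * ψ e) ≡⟨ solve 3 (λ u p q → u :* p :* (u :* q) := u :* u :* (p :* q)) refl u (φ e) (ψ e) ⟩
    u * u * (φ e * ψ e) ≡⟨ cong (_* (φ e * ψ e)) (unit-square unit) ⟩
    1ℚ * (φ e * ψ e) ≡⟨ ℚ.*-identityˡ _ ⟩
    φ e * ψ e ∎)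

  nonextending-vanishes : ∀ {S e φ} → Indep S → ¬ Extends S e → Functional B φ → Vanishes S φ → φ e ≡ 0ℚ
  nonextending-vanishes {S} {e} {φ} ind ¬ext Fφ φ≡0 with e Sub.∈? S
  ... | yes e∈S = φ≡0 e e∈S
  ... | no e∉S with relation-of-dependence ind e∉S (¬ext ∘ ∉⇒extends e∉S)
  ... | a , support , ae≡1 , rel = begin
    φ e ≡⟨ ℚ.*-identityˡ (φ e) ⟨
    1ℚ * φ e ≡⟨ cong (_* φ e) ae≡1 ⟨
    a e * φ e ≡⟨ ∑-single e others ⟨
    a ∙ φ ≡⟨ Fφ a rel ⟩
    0ℚ ∎
    where
    others : ∀ g → e ≢ g → a g * φ g ≡ 0ℚ
    others g e≢g = by-cases (g Sub.∈? S)
      where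
      by-cases : Dec (g ∈ S) → a g * φ g ≡ 0ℚ
      by-cases (yes g∈S) = *-≡0ʳ (a g) (φ≡0 g g∈S)
      by-cases (no g∉S) = *-≡0ˡ (φ g) (support g (∉-⊕ g∉S (e≢g ∘ sym)))

-- The equality case

module Equality {m : ℕ} (M : Matroid m) (R : Subset m) (n : ℕ)
  (extend : ∀ b {S} → Matroid.Indep M S → card S < n →
            ∃[ e ] lookup R e ≡ b × e ∉ S × Matroid.Indep M (S ⊕ e))
  (rank : ∀ {S} → Matroid.Indep M S → card S ≤ n)
  (rep : Representation M) {c : ℚ} (c≢0 : c ≢ 0ℚ) where

  open Matroid M
  open Mixed M n
  open Lorentzian M R n extend
  open HodgeRiemann M R n extend using (reverseCS; module Step)
  open Representation rep using (B)
  open Represented M n rep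
  open ≡-Reasoning

  w : Fin m → ℚ
  w e = χ true e + (- c) * χ false e

  -- Orthogonality of `w` to both indicators. As `w` is a combination of them it then has D(w, w) =
  -- 0; conversely D(w, w) = 0 and one of the orthogonalities give the other, because `c` is
  -- nonzero.
  Isotropic : Subset m → List Bool → Set
  Isotropic S cs = ∀ b → D (w ∷ χ b ∷ χs cs) S ≡ 0ℚ

  D-ww : ∀ S cs → D (w ∷ w ∷ χs cs) S ≡ D (w ∷ χ true ∷ χs cs) S + (- c) * D (w ∷ χ false ∷ χs cs) S
  D-ww S cs = D-linear₂ w (χ true) (χ false) (- c) (χs cs) S

  isotropic⇒ww≡0 : ∀ {S cs} → Isotropic S cs → D (w ∷ w ∷ χs cs) S ≡ 0ℚ
  isotropic⇒ww≡0 {S} {cs} iso = trans (D-ww S cs) (trans (cong₂ (λ p q → p + (- c) * q) (iso true) (iso false))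
    (solve 1 (λ c → con 0ℚ :+ (:- c) :* con 0ℚ := con 0ℚ) refl c))

  isotropic-from : ∀ S cs b → D (w ∷ w ∷ χs cs) S ≡ 0ℚ → D (w ∷ χ b ∷ χs cs) S ≡ 0ℚ → Isotropic S cs
  isotropic-from S cs true ww≡0 wt≡0 true = wt≡0
  isotropic-from S cs true ww≡0 wt≡0 false = *-cancel-0 c≢0 (begin
    c * wf ≡⟨ solve 2 (λ c f → c :* f := (:- con 1ℚ) :* (con 0ℚ :+ (:- c) :* f)) refl c wf ⟩
    (- 1ℚ) * (0ℚ + (- c) * wf) ≡⟨ cong (λ p → (- 1ℚ) * (p + (- c) * wf)) wt≡0 ⟨
    (- 1ℚ) * (D (w ∷ χ true ∷ χs cs) S + (- c) * wf) ≡⟨ cong ((- 1ℚ) *_) (trans (sym (D-ww S cs)) ww≡0) ⟩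
    (- 1ℚ) * 0ℚ ≡⟨ ℚ.*-zeroʳ (- 1ℚ) ⟩
    0ℚ ∎)
    where
    wf = D (w ∷ χ false ∷ χs cs) S
  isotropic-from S cs false ww≡0 wf≡0 false = wf≡0
  isotropic-from S cs false ww≡0 wf≡0 true = begin
    wt ≡⟨ solve 2 (λ c t → t := t :+ (:- c) :* con 0ℚ) refl c wt ⟩
    wt + (- c) * 0ℚ ≡⟨ cong (λ p → wt + (- c) * p) wf≡0 ⟨
    wt + (- c) * D (w ∷ χ false ∷ χs cs) S ≡⟨ trans (sym (D-ww S cs)) ww≡0 ⟩
    0ℚ ∎
    where
    wt = D (w ∷ χ true ∷ χs cs) S

  -- The equality case of the Bochner step yields D(w, w) = 0 and orthogonality to `χ b` alone, and
  -- this only over elements of colour `b`; `isotropic-from` restores the other colour.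
  isotropic-descends : ∀ b cs S → Indep S → card S ℕ.+ (3 ℕ.+ length cs) ≡ n → Isotropic S (b ∷ cs) →
    ∀ i → lookup R i ≡ b → Isotropic (S ⊕ i) cs
  isotropic-descends b cs S ind fits iso i Ri≡b = isotropic-from (S ⊕ i) cs b (next .proj₁) (next .proj₂)
    where
    next = Step.descend b cs (reverseCS cs) S ind fits w (iso b) (isotropic⇒ww≡0 {S} {b ∷ cs} iso) i Ri≡b

  X : (Fin m → ℚ) → (Fin m → ℚ) → ℚ
  X φ ψ = w ∙ (λ e → φ e * ψ e)

  X-comm : ∀ φ ψ → X φ ψ ≡ X ψ φ
  X-comm φ ψ = ∑-cong λ e → cong (w e *_) (ℚ.*-comm (φ e) (ψ e))

  X-linear : ∀ φ φ′ ψ t → X (λ e → φ e + t * φ′ e) ψ ≡ X φ ψ + t * X φ′ ψ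
  X-linear φ φ′ ψ t = trans
    (∑-cong λ e → solve 5 (λ w p q t s → w :* ((p :+ t :* q) :* s) := w :* (p :* s :+ t :* (q :* s))) refl (w e) (φ e) (φ′ e) t (ψ e))
    (∙-linearʳ w (λ e → φ e * ψ e) (λ e → φ′ e * ψ e) t)

  Annihilates : Subset m → Set
  Annihilates S = ∀ φ ψ → Functional B φ → Functional B ψ → Vanishes S φ → Vanishes S ψ → X φ ψ ≡ 0ℚ

  -- The product of two functionals vanishing on `S` is constant on parallel classes and zero off
  -- them, so `average` expresses `X` through the class weights of `w`.
  annihilates-rank-two : ∀ S → Indep S → card S ℕ.+ 2 ≡ n → Isotropic S [] → Annihilates S
  annihilates-rank-two S ind fits iso φ ψ Fφ Fψ φ≡0 ψ≡0 = begin
    w ∙ g ≡⟨ P.average w g resp supp ⟩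
    ∑ (λ e → P.r e * g e * P.weight w e) ≡⟨ ∑-zero (λ e → *-≡0ʳ (P.r e * g e) (weight≡0 e)) ⟩
    0ℚ ∎
    where
    module P = RankTwo.P S ind fits
    g : Fin m → ℚ
    g e = φ e * ψ e
    weight≡0 : ∀ e → P.weight w e ≡ 0ℚ
    weight≡0 = RankTwo.isotropic S ind fits true w (isotropic⇒ww≡0 {S} {[]} iso) (iso true)
    resp : ∀ {e f} → Parallel S e f → g e ≡ g f
    resp par = parallel-product par φ ψ Fφ Fψ φ≡0 ψ≡0
    supp : ∀ e → P.size e ≡ 0ℚ → g e ≡ 0ℚ
    supp e size≡0 = trans
      (cong (_* ψ e) (nonextending-vanishes ind (λ ext → P.size≢0 (parallel-refl ext) size≡0) Fφ φ≡0))
      (ℚ.*-zeroˡ (ψ e))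

  vanishes-⊕ : ∀ {S e φ} → Vanishes S φ → φ e ≡ 0ℚ → Vanishes (S ⊕ e) φ
  vanishes-⊕ φ≡0 φe≡0 f f∈ with ∈-⊕ f∈
  ... | inj₁ f∈S = φ≡0 f f∈S
  ... | inj₂ refl = φe≡0

  vanishes-⊆ : ∀ {S T φ} → S ⊆ T → Vanishes T φ → Vanishes S φ
  vanishes-⊆ S⊆T φ≡0 f f∈S = φ≡0 f (S⊆T f∈S)

  -- Modulo μ and ν, dual to i and j, every functional vanishes at i and j; all
  -- pairs formed from μ, ν and such functionals vanish at a common element.
  annihilates-three : ∀ S i j l → Extends S i → Extends (S ⊕ i) j → Extends (S ⊕ i ⊕ j) l →
    Annihilates (S ⊕ i) → Annihilates (S ⊕ j) → Annihilates (S ⊕ l) → Annihilates S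
  annihilates-three S i j l Si Sij Sijl ann-i ann-j ann-l φ ψ Fφ Fψ φ≡0 ψ≡0 =
    -- First `φ` and then `ψ` is reduced modulo `μ` and `ν` to a remainder `ξ` vanishing at `i` and
    -- `j`. Among the resulting pairs only `μ`, `ν` needs the third element `l`, since `μ` is
    -- nonzero at `i` and `ν` at `j`.
    reduce ψ pair-μ pair-ν (λ ξ Fξ ξS ξi ξj → trans (X-comm ξ ψ) (reduce ξ
      (ann-j μ ξ Fμ Fξ μ-j (vanishes-⊕ ξS ξj))
      (ann-i ν ξ Fν Fξ ν-i (vanishes-⊕ ξS ξi))
      (λ ξ′ Fξ′ ξ′S ξ′i _ → ann-i ξ′ ξ Fξ′ Fξ (vanishes-⊕ ξ′S ξ′i) (vanishes-⊕ ξS ξi)) ψ Fψ ψ≡0)) φ Fφ φ≡0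
    where
    S-ijl : S ⊕ i ⊕ j ⊕ l ≡ S ⊕ j ⊕ l ⊕ i
    S-ijl = trans (cong (_⊕ l) (⊕-comm S i j)) (⊕-comm (S ⊕ j) i l)
    S-jil : S ⊕ i ⊕ j ⊕ l ≡ S ⊕ i ⊕ l ⊕ j
    S-jil = ⊕-comm (S ⊕ i) j l
    indep-Sijl = Sijl .proj₁
    i≢j : i ≢ j
    i≢j refl = extends⇒∉ Sij self-∈-⊕
    i≢l : i ≢ l
    i≢l refl = extends⇒∉ Sijl (⊆-⊕ self-∈-⊕)
    j≢l : j ≢ l
    j≢l refl = extends⇒∉ Sijl self-∈-⊕
    -- `μ` vanishes on `S`, `j` and `l` but not at `i`; `ν` vanishes on `S`, `i` and `l` but not at
    -- `j`.
    μ-data = functional-of-extension (∉⇒extends (∉-⊕ (∉-⊕ (extends⇒∉ Si) i≢j) i≢l) (subst Indep S-ijl indep-Sijl))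
    ν-data = functional-of-extension (∉⇒extends (∉-⊕ (∉-⊕ (extends⇒∉ Sij ∘ ⊆-⊕) (i≢j ∘ sym)) j≢l) (subst Indep S-jil indep-Sijl))
    μ ν : Fin m → ℚ
    μ = μ-data .proj₁
    ν = ν-data .proj₁
    Fμ = μ-data .proj₂ .proj₁
    Fν = ν-data .proj₂ .proj₁
    μ-j : Vanishes (S ⊕ j) μ
    μ-j = vanishes-⊆ ⊆-⊕ (μ-data .proj₂ .proj₂ .proj₁)
    ν-i : Vanishes (S ⊕ i) ν
    ν-i = vanishes-⊆ ⊆-⊕ (ν-data .proj₂ .proj₂ .proj₁)
    μ-S : Vanishes S μ
    μ-S = vanishes-⊆ ⊆-⊕ μ-j
    ν-S : Vanishes S ν
    ν-S = vanishes-⊆ ⊆-⊕ ν-i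
    μ-l : Vanishes (S ⊕ l) μ
    μ-l = vanishes-⊕ μ-S (μ-data .proj₂ .proj₂ .proj₁ l self-∈-⊕)
    ν-l : Vanishes (S ⊕ l) ν
    ν-l = vanishes-⊕ ν-S (ν-data .proj₂ .proj₂ .proj₁ l self-∈-⊕)
    μi≢0 = μ-data .proj₂ .proj₂ .proj₂
    νj≢0 = ν-data .proj₂ .proj₂ .proj₂
    reduce : ∀ ψ → X μ ψ ≡ 0ℚ → X ν ψ ≡ 0ℚ →
      (∀ ξ → Functional B ξ → Vanishes S ξ → ξ i ≡ 0ℚ → ξ j ≡ 0ℚ → X ξ ψ ≡ 0ℚ) →
      ∀ φ → Functional B φ → Vanishes S φ → X φ ψ ≡ 0ℚ
    reduce ψ Xμ≡0 Xν≡0 rest φ Fφ φ≡0 = begin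
      X φ ψ
        ≡⟨ solve 3 (λ x s t → x := x :+ (:- s) :* con 0ℚ :+ (:- t) :* con 0ℚ) refl (X φ ψ) s t ⟩
      X φ ψ + (- s) * 0ℚ + (- t) * 0ℚ
        ≡⟨ cong₂ (λ p q → X φ ψ + (- s) * p + (- t) * q) Xμ≡0 Xν≡0 ⟨
      X φ ψ + (- s) * X μ ψ + (- t) * X ν ψ
        ≡⟨ trans (X-linear φ₁ ν ψ (- t)) (cong (_+ (- t) * X ν ψ) (X-linear φ μ ψ (- s))) ⟨
      X φ₂ ψ
        ≡⟨ rest φ₂ (functional-linear (functional-linear Fφ Fμ (- s)) Fν (- t)) vanishes-S at-i at-j ⟩
      0ℚ
        ∎
      where
      s = φ i * inverse μi≢0 .proj₁
      t = φ j * inverse νj≢0 .proj₁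
      φ₁ φ₂ : Fin m → ℚ
      φ₁ e = φ e + (- s) * μ e
      φ₂ e = φ₁ e + (- t) * ν e
      vanishes-S : Vanishes S φ₂
      vanishes-S f f∈S = trans
        (cong₂ (λ p q → p + (- t) * q) (cong₂ (λ p q → p + (- s) * q) (φ≡0 f f∈S) (μ-S f f∈S)) (ν-S f f∈S))
        (solve 2 (λ s t → con 0ℚ :+ (:- s) :* con 0ℚ :+ (:- t) :* con 0ℚ := con 0ℚ) refl s t)
      at-i : φ₂ i ≡ 0ℚ
      at-i = trans (cong (λ q → φ₁ i + (- t) * q) (ν-i i self-∈-⊕)) (trans
        (solve 2 (λ p t → p :+ (:- t) :* con 0ℚ := p) refl (φ₁ i) t)
        (eliminate (φ i) (inverse μi≢0 .proj₂)))
      at-j : φ₂ j ≡ 0ℚ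
      at-j = trans (cong (λ q → φ j + (- s) * q + (- t) * ν j) (μ-j j self-∈-⊕)) (trans
        (cong (_+ (- t) * ν j) (solve 2 (λ p s → p :+ (:- s) :* con 0ℚ := p) refl (φ j) s))
        (eliminate (φ j) (inverse νj≢0 .proj₂)))
    pair : ∀ ξ → Functional B ξ → X μ ξ ≡ 0ℚ → X ν ξ ≡ 0ℚ →
      (∀ ξ′ → Functional B ξ′ → Vanishes S ξ′ → ξ′ i ≡ 0ℚ → ξ′ j ≡ 0ℚ → X ξ′ ξ ≡ 0ℚ) → X ξ ψ ≡ 0ℚ
    pair ξ Fξ μξ νξ rest = trans (X-comm ξ ψ) (reduce ξ μξ νξ rest ψ Fψ ψ≡0)
    pair-μ : X μ ψ ≡ 0ℚ
    pair-μ = pair μ Fμ (ann-j μ μ Fμ Fμ μ-j μ-j) (ann-l ν μ Fν Fμ ν-l μ-l)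
      λ ξ′ Fξ′ ξ′S _ ξ′j → ann-j ξ′ μ Fξ′ Fμ (vanishes-⊕ ξ′S ξ′j) μ-j
    pair-ν : X ν ψ ≡ 0ℚ
    pair-ν = pair ν Fν (ann-l μ ν Fμ Fν μ-l ν-l) (ann-i ν ν Fν Fν ν-i ν-i)
      λ ξ′ Fξ′ ξ′S ξ′i _ → ann-i ξ′ ν Fξ′ Fν (vanishes-⊕ ξ′S ξ′i) ν-i

  -- All three elements are taken of the colour `b` at the head of the list, because isotropy
  -- descends only along that colour; a nonempty list leaves corank at least three, so they exist.
  annihilates : ∀ cs S → Indep S → card S ℕ.+ (2 ℕ.+ length cs) ≡ n → Isotropic S cs → Annihilates S
  annihilates [] S ind fits iso = annihilates-rank-two S ind fits iso
  annihilates (b ∷ cs) S ind fits iso with extend′ b ind fits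
  ... | i , Ri≡b , Si with extend′ b (Si .proj₁) (⊕-fits Si fits)
  ... | j , Rj≡b , Sij with extend′ b (Sij .proj₁) (⊕-fits Sij (⊕-fits Si fits))
  ... | l , Rl≡b , Sijl = annihilates-three S i j l Si Sij Sijl
    (contracted Ri≡b Si)
    (contracted Rj≡b (∉⇒extends (λ j∈S → extends⇒∉ Sij (⊆-⊕ j∈S))
      (hereditary ⊆-⊕ (subst Indep (⊕-comm S i j) (Sij .proj₁)))))
    (contracted Rl≡b (∉⇒extends (λ l∈S → extends⇒∉ Sijl (⊆-⊕ (⊆-⊕ l∈S)))
      (hereditary ⊆-⊕ (hereditary ⊆-⊕ (subst Indep S-lij (Sijl .proj₁))))))
    where
    contracted : ∀ {e} → lookup R e ≡ b → Extends S e → Annihilates (S ⊕ e)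
    contracted {e} Re≡b Se = annihilates cs (S ⊕ e) (Se .proj₁) (⊕-fits Se fits)
      (isotropic-descends b cs S ind fits iso e Re≡b)
    S-lij : S ⊕ i ⊕ j ⊕ l ≡ S ⊕ l ⊕ i ⊕ j
    S-lij = trans (⊕-comm (S ⊕ i) j l) (cong (_⊕ j) (⊕-comm S i l))

  module _ (annihilates-∅ : Annihilates ∅) where

    -- All elements extending `T` are parallel over it, so the square of a functional that vanishes
    -- on `T` is a nonzero constant on them and zero elsewhere; `X φ φ` is that constant times the
    -- `w`-weight off the hyperplane spanned by `T`.
    corank-one : ∀ T → Indep T → card T ℕ.+ 1 ≡ n → D (w ∷ []) T ≡ 0ℚ
    corank-one T ind fits with extend′ true ind fits
    ... | e , _ , Te with functional-of-extension Te
    ... | φ , Fφ , φ≡0 , φe≢0 = *-cancel-0 (≢0-* φe≢0 φe≢0) (begin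
      φ e * φ e * D (w ∷ []) T
        ≡⟨ cong (φ e * φ e *_) (trans (D-∷ w [] T) (∑-cong λ f → cong (w f *_) (D-[] (T ⊕ f)))) ⟩
      φ e * φ e * ∑ (λ f → w f * β (T ⊕ f))
        ≡⟨ *-∑ (φ e * φ e) (λ f → w f * β (T ⊕ f)) ⟩
      ∑ (λ f → φ e * φ e * (w f * β (T ⊕ f)))
        ≡⟨ ∑-cong (λ f → value f (extends? T f)) ⟩
      X φ φ
        ≡⟨ annihilates-∅ φ φ Fφ Fφ (λ _ f∈∅ → contradiction f∈∅ Sub.∉⊥) (λ _ f∈∅ → contradiction f∈∅ Sub.∉⊥) ⟩
      0ℚ
        ∎)
      where
      card≡n : ∀ {f} → Extends T f → card (T ⊕ f) ≡ n
      card≡n Tf = trans (Tf .proj₂) (trans (ℕ.+-comm 1 (card T)) fits)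
      value : ∀ f → Dec (Extends T f) → φ e * φ e * (w f * β (T ⊕ f)) ≡ w f * (φ f * φ f)
      value f (yes Tf) = begin
        φ e * φ e * (w f * β (T ⊕ f))
          ≡⟨ cong₂ (λ p q → p * (w f * q)) (parallel-product ((Te , Tf) , maximal) φ φ Fφ Fφ φ≡0 φ≡0)
               (𝟙-yes (basis? (T ⊕ f)) (Tf .proj₁ , card≡n Tf)) ⟩
        φ f * φ f * (w f * 1ℚ)
          ≡⟨ solve 2 (λ p w → p :* (w :* con 1ℚ) := w :* p) refl (φ f * φ f) (w f) ⟩
        w f * (φ f * φ f)
          ∎
        where
        maximal : ¬ Extends (T ⊕ e) f
        maximal Tef = ℕ.1+n≰n (subst (_≤ n) (trans (Tef .proj₂) (cong suc (card≡n Te))) (rank (Tef .proj₁)))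
      value f (no ¬Tf) = begin
        φ e * φ e * (w f * β (T ⊕ f))
          ≡⟨ cong (λ q → φ e * φ e * (w f * q)) (𝟙-no (basis? (T ⊕ f)) λ b → ¬Tf
               (b .proj₁ , trans (b .proj₂) (trans (sym fits) (ℕ.+-comm (card T) 1)))) ⟩
        φ e * φ e * (w f * 0ℚ)
          ≡⟨ solve 2 (λ p w → p :* (w :* con 0ℚ) := w :* (con 0ℚ :* con 0ℚ)) refl (φ e * φ e) (w f) ⟩
        w f * (0ℚ * 0ℚ)
          ≡⟨ cong (λ p → w f * (p * p)) (nonextending-vanishes ind ¬Tf Fφ φ≡0) ⟨
        w f * (φ f * φ f)
          ∎

    -- By symmetry of `D` the colours can be contracted first, until only `w` is left.
    D-w≡0 : ∀ cs S → card S ℕ.+ suc (length cs) ≤ n → D (w ∷ χs cs) S ≡ 0ℚ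
    D-w≡0 [] S c≤n with dichotomy 1 S c≤n
    ... | inj₁ (ind , fits) = corank-one S ind fits
    ... | inj₂ D≡0 = D≡0 (w ∷ []) refl
    D-w≡0 (b ∷ cs) S c≤n = trans (D-swap w (χ b) (χs cs) S) (trans (D-∷ (χ b) (w ∷ χs cs) S) (∑-zero λ e → trans
      (cong (χ b e *_) (D-w≡0 cs (S ⊕ e) (ℕ.≤-trans (ℕ.+-monoˡ-≤ (suc (length cs)) (card-⊕-≤ S e))
        (ℕ.≤-trans (ℕ.≤-reflexive (sym (ℕ.+-suc (card S) (suc (length cs))))) c≤n))))
      (ℚ.*-zeroʳ (χ b e))))

    proportional : ∀ cs → suc (length cs) ≤ n → D (χ true ∷ χs cs) ∅ ≡ c * D (χ false ∷ χs cs) ∅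
    proportional cs c≤n = begin
      Dt ≡⟨ solve 3 (λ t c f → t := (t :+ (:- c) :* f) :+ c :* f) refl Dt c Df ⟩
      Dt + (- c) * Df + c * Df ≡⟨ cong (_+ c * Df) (D-linear (χ true) (χ false) (- c) (χs cs) ∅) ⟨
      D (w ∷ χs cs) ∅ + c * Df ≡⟨ cong (_+ c * Df) (D-w≡0 cs ∅ (subst (λ k → k ℕ.+ suc (length cs) ≤ n) (sym (Sub.∣⊥∣≡0 m)) c≤n)) ⟩
      0ℚ + c * Df ≡⟨ ℚ.+-identityˡ (c * Df) ⟩
      c * Df ∎
      where
      Dt = D (χ true ∷ χs cs) ∅
      Df = D (χ false ∷ χs cs) ∅

-- From real to rational representations

module Ring {c ℓ} (K : CommutativeRing c ℓ) where

  open CommutativeRing K hiding (zero; _-_) renaming (refl to ≈-refl; sym to ≈-sym; trans to ≈-trans; _+_ to _⊹_; _*_ to _·_)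
  import Algebra.Properties.Semiring.Sum semiring as Sum
  open Matrices K using (det)

  sum-cong : ∀ {n} {f g : Fin n → Carrier} → (∀ i → f i ≈ g i) → Sum.sum f ≈ Sum.sum g
  sum-cong {zero} f≈g = ≈-refl
  sum-cong {suc n} f≈g = +-cong (f≈g zero) (sum-cong λ i → f≈g (suc i))

  sum-single : ∀ {n} {f : Fin n → Carrier} i → (∀ j → i ≢ j → f j ≈ 0#) → Sum.sum f ≈ f i
  sum-single {suc n} {f} zero z = ≈-trans (+-congˡ (≈-trans (sum-cong λ j → z (suc j) λ ()) (Sum.sum-replicate-zero n))) (+-identityʳ (f zero))
  sum-single {f = f} (suc i) z = ≈-trans (+-cong (z zero λ ()) (sum-single i λ j i≢j → z (suc j) (i≢j ∘ Fin.suc-injective))) (+-identityˡ (f (suc i)))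

  relation-row : ∀ {r m} (A : Fin r → Fin m → Carrier) (y : Fin r → Carrier) (a : Fin m → Carrier) →
    (∀ i → Sum.sum (λ e → a e · A i e) ≈ 0#) → Sum.sum (λ e → a e · Sum.sum (λ i → y i · A i e)) ≈ 0#
  relation-row {r} {m} A y a rel = ≈-trans
    (sum-cong λ e → Sum.*-distribˡ-sum (a e) (λ i → y i · A i e)) (≈-trans
    (Sum.∑-comm (λ e i → a e · (y i · A i e))) (≈-trans
    (sum-cong λ i → ≈-trans (sum-cong λ e → move (a e) (y i) (A i e)) (≈-sym (Sum.*-distribˡ-sum (y i) (λ e → a e · A i e)))) (≈-trans
    (sum-cong λ i → ≈-trans (*-congˡ (rel i)) (zeroʳ (y i)))
    (Sum.sum-replicate-zero r))))
    where
    move : ∀ p q s → p · (q · s) ≈ q · (p · s)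
    move p q s = ≈-trans (≈-sym (*-assoc p q s)) (≈-trans (*-congʳ (*-comm p q)) (*-assoc q p s))

  det-1×1 : ∀ (A : Fin 1 → Fin 1 → Carrier) → det A ≈ A zero zero
  det-1×1 A = ≈-trans (+-identityʳ _) (≈-trans (*-identityˡ _) (*-identityʳ _))

record Embedding {c ℓ} (K : CommutativeRing c ℓ) : Set (c ⊔ ℓ) where
  open CommutativeRing K using (Carrier; _≈_; 0#; 1#) renaming (_+_ to _⊹_; _*_ to _·_; -_ to ~_)
  field
    ι : ℚ → Carrier
    ι-+ : ∀ p q → ι p ⊹ ι q ≈ ι (p + q)
    ι-* : ∀ p q → ι p · ι q ≈ ι (p * q)
    ι-0 : 0# ≈ ι 0ℚ
    ι-1 : 1# ≈ ι 1ℚ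
    ι--1 : ~ 1# ≈ ι (- 1ℚ)
    ι-injective : ∀ {p q} → ι p ≈ ι q → p ≡ q

-- Everything is proved for a ring into which ℚ embeds rather than for ℝ, whose
-- operations unfold to Cauchy moduli.
module Rationality {c ℓ} (K : CommutativeRing c ℓ) (embedding : Embedding K) where

  open Embedding embedding
  open CommutativeRing K hiding (zero; _-_)
    renaming (refl to ≈-refl; sym to ≈-sym; trans to ≈-trans; _+_ to _⊹_; _*_ to _·_; -_ to ~_)
  open Determinant using (Det≡det)
  open Ring K using (sum-single; relation-row; det-1×1)
  open import Algebra.Properties.Semiring.Sum semiring using () renaming (sum to sumᴷ)
  open import Algebra.Properties.Semiring.Exp semiring using () renaming (_^_ to _^ᴷ_)
  module Matᴷ = Matrices K
  module Matℚ = Matrices ℚ.+-*-commutativeRing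

  ι-cong : ∀ {p q} → p ≡ q → ι p ≈ ι q
  ι-cong refl = ≈-refl

  ≈ι-+ : ∀ {x y p q} → x ≈ ι p → y ≈ ι q → x ⊹ y ≈ ι (p + q)
  ≈ι-+ {p = p} {q} x≈p y≈q = ≈-trans (+-cong x≈p y≈q) (ι-+ p q)

  ≈ι-* : ∀ {x y p q} → x ≈ ι p → y ≈ ι q → x · y ≈ ι (p * q)
  ≈ι-* {p = p} {q} x≈p y≈q = ≈-trans (*-cong x≈p y≈q) (ι-* p q)

  ≈ι-sum : ∀ {k} (f : Fin k → Carrier) (g : Fin k → ℚ) → (∀ i → f i ≈ ι (g i)) → sumᴷ f ≈ ι (sum g)
  ≈ι-sum {zero} f g f≈g = ι-0
  ≈ι-sum {suc k} f g f≈g = ≈ι-+ (f≈g zero) (≈ι-sum (λ i → f (suc i)) (λ i → g (suc i)) λ i → f≈g (suc i))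

  ≈ι-∑ : ∀ {k} (f : Fin k → Carrier) (g : Fin k → ℚ) → (∀ i → f i ≈ ι (g i)) → sumᴷ f ≈ ι (∑ g)
  ≈ι-∑ f g f≈g = ≈-trans (≈ι-sum f g f≈g) (ι-cong (sym (∑≡sum g)))

  ≈ι-sgn : ∀ k → (~ 1#) ^ᴷ k ≈ ι ((- 1ℚ) ^ k)
  ≈ι-sgn zero = ι-1
  ≈ι-sgn (suc k) = ≈ι-* ι--1 (≈ι-sgn k)

  ≈ι-det : ∀ {k} (A : Matᴷ.Matrix k k) (B : Matℚ.Matrix k k) → (∀ i j → A i j ≈ ι (B i j)) →
    Matᴷ.det A ≈ ι (Matℚ.det B)
  ≈ι-det {zero} A B A≈B = ι-1
  ≈ι-det {suc k} A B A≈B = ≈ι-sum _ (λ j → (- 1ℚ) ^ toℕ j * (B zero j * Matℚ.det (Matℚ.minor B j))) λ j →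
    ≈ι-* (≈ι-sgn (toℕ j)) (≈ι-* (A≈B zero j)
      (≈ι-det (Matᴷ.minor A j) (Matℚ.minor B j) λ i l → A≈B (suc i) (punchIn j l)))

  module _ {m : ℕ} (M : Matroid m) (r : ℕ) (A : Matᴷ.Matrix r m) (tu : Matᴷ.TotallyUnimodular A)
    (indep⇔ : ∀ S → Matroid.Indep M S ⇔ Matᴷ.ColumnsIndependent A S) where

    open Matroid M

    private
      -- The `1 × 1` minors of a totally unimodular matrix are its entries.
      entry : ∀ i e → Σ[ q ∈ ℚ ] Integral q × A i e ≈ ι q
      entry i e = by-cases (tu {1} (λ _ → i) (λ _ → e) (λ { {zero} {zero} () }) (λ { {zero} {zero} () }))
        where
        a = Matᴷ.det {1} (λ _ _ → A i e)
        a≈ : A i e ≈ a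
        a≈ = ≈-sym (det-1×1 (λ _ _ → A i e))
        by-cases : a ≈ 0# ⊎ a ≈ 1# ⊎ a ≈ ~ 1# → Σ[ q ∈ ℚ ] Integral q × A i e ≈ ι q
        by-cases (inj₁ a≈0) = 0ℚ , integral-0 , ≈-trans a≈ (≈-trans a≈0 ι-0)
        by-cases (inj₂ (inj₁ a≈1)) = 1ℚ , integral-1 , ≈-trans a≈ (≈-trans a≈1 ι-1)
        by-cases (inj₂ (inj₂ a≈-1)) = - 1ℚ , integral--1 , ≈-trans a≈ (≈-trans a≈-1 ι--1)

      B : Fin r → Fin m → ℚ
      B i e = entry i e .proj₁

      A≈B : ∀ i e → A i e ≈ ι (B i e)
      A≈B i e = entry i e .proj₂ .proj₂

      rational-tu : ∀ {k} (ρ : Fin k → Fin r) (κ : Fin k → Fin m) → Monotone ρ → Monotone κ →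
        Determinant.Det (λ i j → B (ρ i) (κ j)) ≡ 0ℚ ⊎ Unit (Determinant.Det (λ i j → B (ρ i) (κ j)))
      rational-tu {k} ρ κ mono-ρ mono-κ = by-cases (tu ρ κ mono-ρ mono-κ)
        where
        d = Matᴷ.det (λ i j → A (ρ i) (κ j))
        d≈ : d ≈ ι (Matℚ.det (λ i j → B (ρ i) (κ j)))
        d≈ = ≈ι-det (λ i j → A (ρ i) (κ j)) (λ i j → B (ρ i) (κ j)) λ i j → A≈B (ρ i) (κ j)
        value : ∀ {q} → d ≈ ι q → Determinant.Det (λ i j → B (ρ i) (κ j)) ≡ q
        value d≈q = trans (Det≡det (λ i j → B (ρ i) (κ j))) (ι-injective (≈-trans (≈-sym d≈) d≈q))
        by-cases : d ≈ 0# ⊎ d ≈ 1# ⊎ d ≈ ~ 1# →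
          Determinant.Det (λ i j → B (ρ i) (κ j)) ≡ 0ℚ ⊎ Unit (Determinant.Det (λ i j → B (ρ i) (κ j)))
        by-cases (inj₁ d≈0) = inj₁ (value (≈-trans d≈0 ι-0))
        by-cases (inj₂ (inj₁ d≈1)) = inj₂ (inj₁ (value (≈-trans d≈1 ι-1)))
        by-cases (inj₂ (inj₂ d≈-1)) = inj₂ (inj₂ (value (≈-trans d≈-1 ι--1)))

      independent : ∀ {S} → Indep S → ∀ a → (∀ e → e ∉ S → a e ≡ 0ℚ) → Relation B a → ∀ e → a e ≡ 0ℚ
      independent {S} ind a support rel e = ι-injective (≈-trans (Equivalence.to (indep⇔ S) ind (λ f → ι (a f))
        (λ f f∉S → ≈-trans (ι-cong (support f f∉S)) (≈-sym ι-0))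
        (λ i → ≈-trans (≈ι-∑ _ (λ f → a f * B i f) λ f → ≈ι-* ≈-refl (A≈B i f)) (≈-trans (ι-cong (rel i)) (≈-sym ι-0))) e) ι-0)

      -- Pairing a relation over `K` on `S ⊕ e` with the rational functional leaves only the term at
      -- `e`, whose coefficient vanishes because a nonzero rational is invertible in `K`. The
      -- relation then lives on `S`.
      detects : ∀ {S e} → Indep S → ∀ (y : Fin r → ℚ) → (∀ f → f ∈ S → ∑ (λ i → y i * B i f) ≡ 0ℚ) →
        ∑ (λ i → y i * B i e) ≢ 0ℚ → Indep (S ⊕ e)
      detects {S} {e} ind y y≡0 ye≢0 = Equivalence.from (indep⇔ (S ⊕ e)) λ a support rel →
        Equivalence.to (indep⇔ S) ind a (restrict a support rel) rel
        where
        φ : Fin m → ℚ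
        φ f = ∑ (λ i → y i * B i f)
        rowᴷ : Fin m → Carrier
        rowᴷ f = sumᴷ (λ i → ι (y i) · A i f)
        row≈ : ∀ f → rowᴷ f ≈ ι (φ f)
        row≈ f = ≈ι-∑ _ (λ i → y i * B i f) λ i → ≈ι-* ≈-refl (A≈B i f)
        module _ (a : Fin m → Carrier) (support : ∀ f → f ∉ S ⊕ e → a f ≈ 0#)
          (rel : ∀ i → sumᴷ (λ f → a f · A i f) ≈ 0#) where
          others : ∀ f → e ≢ f → a f · rowᴷ f ≈ 0#
          others f e≢f with f Sub.∈? S
          ... | yes f∈S = ≈-trans (*-congˡ (≈-trans (row≈ f) (≈-trans (ι-cong (y≡0 f f∈S)) (≈-sym ι-0)))) (zeroʳ (a f))
          ... | no f∉S = ≈-trans (*-congʳ (support f (∉-⊕ f∉S (e≢f ∘ sym)))) (zeroˡ (rowᴷ f))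
          ae-row : a e · ι (φ e) ≈ 0#
          ae-row = ≈-trans (*-congˡ (≈-sym (row≈ e))) (≈-trans
            (≈-sym (sum-single {f = λ f → a f · rowᴷ f} e others)) (relation-row A (λ i → ι (y i)) a rel))
          ae≈0 : a e ≈ 0#
          ae≈0 = ≈-trans (≈-sym (*-identityʳ (a e))) (≈-trans
            (*-congˡ (≈-trans ι-1 (≈-trans (ι-cong (sym (inverse ye≢0 .proj₂))) (≈-sym (ι-* (φ e) v))))) (≈-trans
            (≈-sym (*-assoc (a e) (ι (φ e)) (ι v))) (≈-trans
            (*-congʳ ae-row) (zeroˡ (ι v)))))
            where
            v = inverse ye≢0 .proj₁
          restrict : ∀ f → f ∉ S → a f ≈ 0#
          restrict f f∉S with e ≟ f
          ... | yes refl = ae≈0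
          ... | no e≢f = support f (∉-⊕ f∉S (e≢f ∘ sym))

    representation : Representation M
    representation = record
      { r = r
      ; B = B
      ; entries = λ i e → entry i e .proj₂ .proj₁
      ; totally-unimodular = rational-tu
      ; independent = independent
      ; detects = detects
      }

module RealEmbedding where

  open Real using (_≈_; mk≈; close; fromℚ; ℝ-commutativeRing)

  pointwise : ∀ {x y} → (∀ k → Real.seq x k ≡ Real.seq y k) → x ≈ y
  pointwise {x} {y} eq = mk≈ λ ε 0<ε → 0 , λ k _ →
    subst (λ z → ℚ.∣ z ∣ <ℚ ε) (sym (trans (cong (_- Real.seq y k) (eq k)) (ℚ.+-inverseʳ (Real.seq y k)))) 0<ε

  fromℚ-injective : ∀ {p q} → fromℚ p ≈ fromℚ q → p ≡ q
  fromℚ-injective {p} {q} p≈q with p ℚ.≟ q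
  ... | yes p≡q = p≡q
  -- With ε = |p - q| the two constant sequences would be closer than their distance.
  ... | no p≢q = contradiction (close p≈q ℚ.∣ p - q ∣ 0<∣p-q∣ .proj₂ _ ≤-refl) (ℚ.<-irrefl refl)
    where
    0<∣p-q∣ : 0ℚ <ℚ ℚ.∣ p - q ∣
    0<∣p-q∣ = ≤∧≢⇒< (ℚ.0≤∣p∣ (p - q)) λ eq → p≢q (begin
      p ≡⟨ solve 2 (λ p q → p := (p :- q) :+ q) refl p q ⟩
      (p - q) + q ≡⟨ cong (_+ q) (ℚ.∣p∣≡0⇒p≡0 (p - q) (sym eq)) ⟩
      0ℚ + q ≡⟨ ℚ.+-identityˡ q ⟩
      q ∎)
      where open ≡-Reasoning

  embedding : Embedding ℝ-commutativeRing
  embedding = record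
    { ι = fromℚ
    ; ι-+ = λ _ _ → pointwise λ _ → refl
    ; ι-* = λ _ _ → pointwise λ _ → refl
    ; ι-0 = pointwise λ _ → refl
    ; ι-1 = pointwise λ _ → refl
    ; ι--1 = pointwise λ _ → refl
    ; ι-injective = fromℚ-injective
    }

  representation : ∀ {m} (M : Matroid m) → Regular M → Representation M
  representation M (r , A , tu , indep⇔) =
    Rationality.representation ℝ-commutativeRing embedding M r A tu indep⇔

-- Counting bases

𝟙-cong : ∀ {a b} {A : Set a} {B : Set b} (p : Dec A) (q : Dec B) → (A → B) → (B → A) → 𝟙 p ≡ 𝟙 q
𝟙-cong (yes a) q A→B B→A = sym (𝟙-yes q (A→B a))
𝟙-cong (no ¬a) q A→B B→A = sym (𝟙-no q (¬a ∘ B→A))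

sumₗ : ∀ {a} {A : Set a} → List A → (A → ℚ) → ℚ
sumₗ [] f = 0ℚ
sumₗ (x ∷ xs) f = f x + sumₗ xs f

module _ {a} {A : Set a} where

  sumₗ-cong : ∀ (xs : List A) {f g} → (∀ x → f x ≡ g x) → sumₗ xs f ≡ sumₗ xs g
  sumₗ-cong [] f≡g = refl
  sumₗ-cong (x ∷ xs) f≡g = cong₂ _+_ (f≡g x) (sumₗ-cong xs f≡g)

  sumₗ-0 : ∀ (xs : List A) {f} → (∀ x → f x ≡ 0ℚ) → sumₗ xs f ≡ 0ℚ
  sumₗ-0 [] f≡0 = refl
  sumₗ-0 (x ∷ xs) {f} f≡0 = trans (cong₂ _+_ (f≡0 x) (sumₗ-0 xs f≡0)) (ℚ.+-identityˡ 0ℚ)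

  sumₗ-++ : ∀ (xs ys : List A) f → sumₗ (xs ++ ys) f ≡ sumₗ xs f + sumₗ ys f
  sumₗ-++ [] ys f = sym (ℚ.+-identityˡ (sumₗ ys f))
  sumₗ-++ (x ∷ xs) ys f = trans (cong (f x +_) (sumₗ-++ xs ys f)) (sym (ℚ.+-assoc (f x) (sumₗ xs f) (sumₗ ys f)))

  sumₗ-map : ∀ {b} {B : Set b} (g : B → A) xs f → sumₗ (map g xs) f ≡ sumₗ xs (λ x → f (g x))
  sumₗ-map g [] f = refl
  sumₗ-map g (x ∷ xs) f = cong (f (g x) +_) (sumₗ-map g xs f)

  *-sumₗ : ∀ t (xs : List A) f → t * sumₗ xs f ≡ sumₗ xs (λ x → t * f x)
  *-sumₗ t [] f = ℚ.*-zeroʳ t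
  *-sumₗ t (x ∷ xs) f = trans (ℚ.*-distribˡ-+ t (f x) (sumₗ xs f)) (cong (t * f x +_) (*-sumₗ t xs f))

  ∑-sumₗ : ∀ {m} (xs : List A) (f : Fin m → A → ℚ) → ∑ (λ e → sumₗ xs (f e)) ≡ sumₗ xs (λ x → ∑ (λ e → f e x))
  ∑-sumₗ {m} [] f = ∑-0 m
  ∑-sumₗ (x ∷ xs) f = trans (∑-+ (λ e → f e x) (λ e → sumₗ xs (f e))) (cong (∑ (λ e → f e x) +_) (∑-sumₗ xs f))

ν : ℕ → ℚ
ν zero = 0ℚ
ν (suc k) = 1ℚ + ν k

ν-+ : ∀ j k → ν (j ℕ.+ k) ≡ ν j + ν k
ν-+ zero k = sym (ℚ.+-identityˡ (ν k))
ν-+ (suc j) k = trans (cong (1ℚ +_) (ν-+ j k)) (sym (ℚ.+-assoc 1ℚ (ν j) (ν k)))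

ν-* : ∀ j k → ν (j ℕ.* k) ≡ ν j * ν k
ν-* zero k = sym (ℚ.*-zeroˡ (ν k))
ν-* (suc j) k = trans (ν-+ k (j ℕ.* k)) (trans (cong (ν k +_) (ν-* j k))
  (solve 2 (λ a b → b :+ a :* b := (con 1ℚ :+ a) :* b) refl (ν j) (ν k)))

0≤ν : ∀ k → 0ℚ ≤ℚ ν k
0≤ν zero = ℚ.≤-refl
0≤ν (suc k) = 0≤+ (ℚ.<⇒≤ 0<1) (0≤ν k)

ν-mono-< : ∀ {j k} → j < k → ν j <ℚ ν k
ν-mono-< {zero} {suc k} _ = ℚ.+-mono-<-≤ 0<1 (0≤ν k)
ν-mono-< {suc j} {suc k} (s≤s j<k) = ℚ.+-monoʳ-< 1ℚ (ν-mono-< j<k)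

length-filter : ∀ {a p} {A : Set a} {P : A → Set p} (P? : ∀ x → Dec (P x)) xs →
  ν (length (filter P? xs)) ≡ sumₗ xs (λ x → 𝟙 (P? x))
length-filter P? [] = refl
length-filter P? (x ∷ xs) with P? x
... | yes _ = cong (1ℚ +_) (length-filter P? xs)
... | no _ = trans (length-filter P? xs) (sym (ℚ.+-identityˡ _))

toℚᵘ-ν : ∀ k → ℚ.toℚᵘ (ν k) ℚᵘ.≃ ℚᵘ.mkℚᵘ (ℤ.+ k) 0
toℚᵘ-ν zero = ℚᵘ.≃-refl
toℚᵘ-ν (suc k) = ℚᵘ.≃-trans (ℚ.toℚᵘ-homo-+ 1ℚ (ν k)) (ℚᵘ.≃-trans (ℚᵘ.+-cong ℚᵘ.≃-refl (toℚᵘ-ν k))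
  (ℚᵘ.≃-reflexive (cong (λ i → ℚᵘ.mkℚᵘ (ℤ.+ 1 ℤ.+ i) 0) (ℤ.*-identityʳ (ℤ.+ k)))))

/-* : ∀ j k .{{_ : ℕ.NonZero k}} → (ℤ.+ j) ℚ./ k * ν k ≡ ν j
/-* j (suc k) = ℚ.toℚᵘ-injective (ℚᵘ.≃-trans (ℚ.toℚᵘ-homo-* ((ℤ.+ j) ℚ./ suc k) (ν (suc k)))
  (ℚᵘ.≃-trans (ℚᵘ.*-cong (ℚ.toℚᵘ-fromℚᵘ (ℚᵘ.mkℚᵘ (ℤ.+ j) k)) (toℚᵘ-ν (suc k)))
  (ℚᵘ.≃-trans (ℚᵘ.*≡* (trans (ℤ.*-identityʳ (ℤ.+ j ℤ.* ℤ.+ suc k)) (cong (λ i → ℤ.+ j ℤ.* ℤ.+ i) (sym (ℕ.*-identityʳ (suc k))))))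
  (ℚᵘ.≃-sym (toℚᵘ-ν j)))))

_≟ₛ_ : ∀ {m} (S T : Subset m) → Dec (S ≡ T)
_≟ₛ_ = Vec.≡-dec Bool._≟_

sumₗ-subsets : ∀ {m} (f : Subset m → ℚ) S → sumₗ (subsets m) (λ B → f B * 𝟙 (S ≟ₛ B)) ≡ f S
sumₗ-subsets {zero} f Vec.[] = solve 1 (λ a → a :* con 1ℚ :+ con 0ℚ := a) refl (f Vec.[])
sumₗ-subsets {suc m} f (s Vec.∷ S) = begin
  sumₗ (map (true Vec.∷_) (subsets m) ++ map (false Vec.∷_) (subsets m)) g
    ≡⟨ sumₗ-++ (map (true Vec.∷_) (subsets m)) (map (false Vec.∷_) (subsets m)) g ⟩
  sumₗ (map (true Vec.∷_) (subsets m)) g + sumₗ (map (false Vec.∷_) (subsets m)) g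
    ≡⟨ cong₂ _+_ (sumₗ-map (true Vec.∷_) (subsets m) g) (sumₗ-map (false Vec.∷_) (subsets m) g) ⟩
  half true + half false
    ≡⟨ select s refl ⟩
  f (s Vec.∷ S)
    ∎
  where
  open ≡-Reasoning
  g : Subset (suc m) → ℚ
  g B = f B * 𝟙 ((s Vec.∷ S) ≟ₛ B)
  half : Bool → ℚ
  half b = sumₗ (subsets m) (λ B → g (b Vec.∷ B))
  same : ∀ b → s ≡ b → half b ≡ f (b Vec.∷ S)
  same b refl = trans (sumₗ-cong (subsets m) λ B → cong (f (b Vec.∷ B) *_)
      (𝟙-cong ((b Vec.∷ S) ≟ₛ (b Vec.∷ B)) (S ≟ₛ B) Vec.∷-injectiveʳ (cong (b Vec.∷_))))
    (sumₗ-subsets (λ B → f (b Vec.∷ B)) S)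
  other : ∀ b → s ≢ b → half b ≡ 0ℚ
  other b s≢b = sumₗ-0 (subsets m) λ B → *-≡0ʳ (f (b Vec.∷ B)) (𝟙-no ((s Vec.∷ S) ≟ₛ (b Vec.∷ B)) (s≢b ∘ Vec.∷-injectiveˡ))
  select : ∀ b → s ≡ b → half true + half false ≡ f (s Vec.∷ S)
  select true refl = trans (cong₂ _+_ (same true refl) (other false λ ())) (ℚ.+-identityʳ (f (true Vec.∷ S)))
  select false refl = trans (cong₂ _+_ (other true λ ()) (same false refl)) (ℚ.+-identityˡ (f (false Vec.∷ S)))

∑-card : ∀ {m} (S : Subset m) → ∑ (λ e → 𝟙 (e Sub.∈? S)) ≡ ν (card S)
∑-card Vec.[] = ∑-empty _
∑-card (s Vec.∷ S) = begin
  ∑ (λ e → 𝟙 (e Sub.∈? (s Vec.∷ S)))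
    ≡⟨ ∑-suc (λ e → 𝟙 (e Sub.∈? (s Vec.∷ S))) ⟩
  𝟙 (zero Sub.∈? (s Vec.∷ S)) + ∑ (λ e → 𝟙 (suc e Sub.∈? (s Vec.∷ S)))
    ≡⟨ cong (𝟙 (zero Sub.∈? (s Vec.∷ S)) +_) (trans
         (∑-cong λ e → 𝟙-cong (suc e Sub.∈? (s Vec.∷ S)) (e Sub.∈? S) Sub.drop-there Vec.there) (∑-card S)) ⟩
  𝟙 (zero Sub.∈? (s Vec.∷ S)) + ν (card S)
    ≡⟨ head s ⟩
  ν (card (s Vec.∷ S))
    ∎
  where
  open ≡-Reasoning
  head : ∀ s → 𝟙 (zero Sub.∈? (s Vec.∷ S)) + ν (card S) ≡ ν (card (s Vec.∷ S))
  head true = refl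
  head false = ℚ.+-identityˡ (ν (card S))

module Counting {m : ℕ} (M : Matroid m) (R : Subset m) (n : ℕ)
  (extend : ∀ b {S} → Matroid.Indep M S → card S < n →
            ∃[ e ] lookup R e ≡ b × e ∉ S × Matroid.Indep M (S ⊕ e)) where

  open Matroid M
  open Mixed M n
  open Lorentzian M R n extend
  open ≡-Reasoning

  -- The contribution of a single set `B` to `D`: the terminal weight `β` is replaced by the
  -- indicator of `B`.
  E : List (Fin m → ℚ) → Subset m → Subset m → ℚ
  E [] S B = 𝟙 (S ≟ₛ B)
  E (x ∷ xs) S B = ∑ λ e → x e * E xs (S ⊕ e) B

  D≡sum : ∀ xs S → D xs S ≡ sumₗ (subsets m) (λ B → β B * E xs S B)
  D≡sum [] S = trans (D-[] S) (sym (sumₗ-subsets β S))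
  D≡sum (x ∷ xs) S = begin
    D (x ∷ xs) S
      ≡⟨ D-∷ x xs S ⟩
    ∑ (λ e → x e * D xs (S ⊕ e))
      ≡⟨ ∑-cong (λ e → trans (cong (x e *_) (D≡sum xs (S ⊕ e))) (*-sumₗ (x e) (subsets m) (λ B → β B * E xs (S ⊕ e) B))) ⟩
    ∑ (λ e → sumₗ (subsets m) (λ B → x e * (β B * E xs (S ⊕ e) B)))
      ≡⟨ ∑-sumₗ (subsets m) (λ e B → x e * (β B * E xs (S ⊕ e) B)) ⟩
    sumₗ (subsets m) (λ B → ∑ (λ e → x e * (β B * E xs (S ⊕ e) B)))
      ≡⟨ sumₗ-cong (subsets m) (λ B → trans
           (∑-cong λ e → solve 3 (λ x b d → x :* (b :* d) := b :* (x :* d)) refl (x e) (β B) (E xs (S ⊕ e) B))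
           (sym (*-∑ (β B) (λ e → x e * E xs (S ⊕ e) B)))) ⟩
    sumₗ (subsets m) (λ B → β B * E (x ∷ xs) S B)
      ∎

  Remaining : Bool → Subset m → Subset m → Fin m → Set
  Remaining b S B e = lookup R e ≡ b × e ∈ B × e ∉ S

  remaining? : ∀ b S B e → Dec (Remaining b S B e)
  remaining? b S B e = (lookup R e Bool.≟ b) ×-dec ((e Sub.∈? B) ×-dec ¬? (e Sub.∈? S))

  rem : Bool → Subset m → Subset m → ℚ
  rem b S B = ∑ λ e → 𝟙 (remaining? b S B e)

  cnt : Bool → List Bool → ℚ
  cnt b [] = 0ℚ
  cnt b (c ∷ cs) = 𝟙 (c Bool.≟ b) + cnt b cs

  -- The number of ways to order a set whose colour counts match those of the list, following its
  -- colour pattern: each factor is the number of choices for the next element. For `k` elements of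
  -- one colour and `l` of the other this is k! l!.
  val : List Bool → ℚ
  val [] = 1ℚ
  val (c ∷ cs) = cnt c (c ∷ cs) * val cs

  colour : Bool → Fin m → ℚ
  colour b e = 𝟙 (lookup R e Bool.≟ b)

  rem-⊕ : ∀ b S B e → e ∈ B → e ∉ S → rem b S B ≡ rem b (S ⊕ e) B + colour b e
  rem-⊕ b S B e e∈B e∉S = trans (∑-cong λ f → by-cases f (e ≟ f)) (trans
    (∑-+ (λ f → 𝟙 (remaining? b (S ⊕ e) B f)) (λ f → δ e f * colour b e))
    (cong (rem b (S ⊕ e) B +_) (∑-δ (λ _ → colour b e) e)))
    where
    by-cases : ∀ f → Dec (e ≡ f) → 𝟙 (remaining? b S B f) ≡ 𝟙 (remaining? b (S ⊕ e) B f) + δ e f * colour b e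
    by-cases f (yes refl) = begin
      𝟙 (remaining? b S B e)
        ≡⟨ 𝟙-cong (remaining? b S B e) (lookup R e Bool.≟ b) proj₁ (λ eq → eq , e∈B , e∉S) ⟩
      colour b e
        ≡⟨ solve 1 (λ x → x := con 0ℚ :+ con 1ℚ :* x) refl (colour b e) ⟩
      0ℚ + 1ℚ * colour b e
        ≡⟨ cong₂ (λ p q → p + q * colour b e) (𝟙-no (remaining? b (S ⊕ e) B e) λ r → r .proj₂ .proj₂ self-∈-⊕) (δ-refl e) ⟨
      𝟙 (remaining? b (S ⊕ e) B e) + δ e e * colour b e
        ∎
    by-cases f (no e≢f) = begin
      𝟙 (remaining? b S B f)
        ≡⟨ 𝟙-cong (remaining? b S B f) (remaining? b (S ⊕ e) B f)
             (λ r → r .proj₁ , r .proj₂ .proj₁ , ∉-⊕ (r .proj₂ .proj₂) (e≢f ∘ sym))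
             (λ r → r .proj₁ , r .proj₂ .proj₁ , r .proj₂ .proj₂ ∘ ⊆-⊕) ⟩
      𝟙 (remaining? b (S ⊕ e) B f)
        ≡⟨ solve 2 (λ x y → x := x :+ con 0ℚ :* y) refl (𝟙 (remaining? b (S ⊕ e) B f)) (colour b e) ⟩
      𝟙 (remaining? b (S ⊕ e) B f) + 0ℚ * colour b e
        ≡⟨ cong (λ q → 𝟙 (remaining? b (S ⊕ e) B f) + q * colour b e) (δ-≢ e≢f) ⟨
      𝟙 (remaining? b (S ⊕ e) B f) + δ e f * colour b e
        ∎

  rem-≤ : ∀ b S B e → rem b S B ≤ℚ rem b (S ⊕ e) B + colour b e
  rem-≤ b S B e = by-cases ((e Sub.∈? B) ×-dec ¬? (e Sub.∈? S))
    where
    by-cases : Dec (e ∈ B × e ∉ S) → rem b S B ≤ℚ rem b (S ⊕ e) B + colour b e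
    by-cases (yes (e∈B , e∉S)) = ℚ.≤-reflexive (rem-⊕ b S B e e∈B e∉S)
    by-cases (no ¬e) = subst (_≤ℚ rem b (S ⊕ e) B + colour b e)
      (trans (ℚ.+-identityʳ (rem b (S ⊕ e) B)) (∑-cong λ f → 𝟙-cong (remaining? b (S ⊕ e) B f) (remaining? b S B f)
        (λ r → r .proj₁ , r .proj₂ .proj₁ , r .proj₂ .proj₂ ∘ ⊆-⊕)
        (λ r → r .proj₁ , r .proj₂ .proj₁ , ∉-⊕ (r .proj₂ .proj₂) λ { refl → ¬e (r .proj₂) })))
      (ℚ.+-monoʳ-≤ (rem b (S ⊕ e) B) (0≤𝟙 (lookup R e Bool.≟ b)))

  E-row : ∀ c cs S B → (∀ e → lookup R e ≡ c → E (χs cs) (S ⊕ e) B ≡ 0ℚ) → E (χs (c ∷ cs)) S B ≡ 0ℚ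
  E-row c cs S B row = ∑-zero λ e → by-cases e (lookup R e Bool.≟ c)
    where
    by-cases : ∀ e → Dec (lookup R e ≡ c) → χ c e * E (χs cs) (S ⊕ e) B ≡ 0ℚ
    by-cases e (yes Re≡c) = *-≡0ʳ (χ c e) (row e Re≡c)
    by-cases e (no Re≢c) = *-≡0ˡ (E (χs cs) (S ⊕ e) B) (χ≡0 Re≢c)

  E-⊈ : ∀ cs {S B e} → e ∈ S → e ∉ B → E (χs cs) S B ≡ 0ℚ
  E-⊈ [] {S} {B} e∈S e∉B = 𝟙-no (S ≟ₛ B) λ { refl → e∉B e∈S }
  E-⊈ (c ∷ cs) {S} {B} e∈S e∉B = E-row c cs S B λ f _ → E-⊈ cs (⊆-⊕ e∈S) e∉B

  -- A step reduces the number of missing elements of colour `b` by at most one, and only if it has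
  -- that colour, so `B` is never completed.
  E-few : ∀ b cs S B → cnt b cs <ℚ rem b S B → E (χs cs) S B ≡ 0ℚ
  E-few b [] S B 0<rem = 𝟙-no (S ≟ₛ B) λ { refl → ℚ.<⇒≢ 0<rem (sym (∑-zero λ e →
    𝟙-no (remaining? b S S e) λ r → r .proj₂ .proj₂ (r .proj₂ .proj₁))) }
  E-few b (c ∷ cs) S B cnt<rem = E-row c cs S B λ e Re≡c → E-few b cs (S ⊕ e) B (0<q-p⇒p<q (subst (0ℚ <ℚ_)
    (solve 3 (λ r i k → (r :+ i) :- (i :+ k) := r :- k) refl (rem b (S ⊕ e) B) (𝟙 (c Bool.≟ b)) (cnt b cs))
    (p<q⇒0<q-p (ℚ.<-≤-trans cnt<rem (subst (λ x → rem b S B ≤ℚ rem b (S ⊕ e) B + 𝟙 (x Bool.≟ b)) Re≡c (rem-≤ b S B e))))))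

  E-exact : ∀ cs S B → S ⊆ B → (∀ b → rem b S B ≡ cnt b cs) → E (χs cs) S B ≡ val cs
  E-exact [] S B S⊆B rem≡0 = 𝟙-yes (S ≟ₛ B) (Sub.⊆-antisym S⊆B B⊆S)
    where
    B⊆S : B ⊆ S
    B⊆S {e} e∈B with e Sub.∈? S
    ... | yes e∈S = e∈S
    ... | no e∉S = contradiction
      (trans (sym (𝟙-yes (remaining? b S B e) (refl , e∈B , e∉S)))
        (∑-nonNeg≤0 (λ f → 0≤𝟙 (remaining? b S B f)) (ℚ.≤-reflexive (rem≡0 b)) e)) λ ()
      where
      b = lookup R e
  E-exact (c ∷ cs) S B S⊆B rem≡cnt = begin
    ∑ (λ e → χ c e * E (χs cs) (S ⊕ e) B)
      ≡⟨ ∑-cong (λ e → by-cases e (lookup R e Bool.≟ c) (e Sub.∈? B) (e Sub.∈? S)) ⟩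
    ∑ (λ e → val cs * 𝟙 (remaining? c S B e))
      ≡⟨ *-∑ (val cs) (λ e → 𝟙 (remaining? c S B e)) ⟨
    val cs * rem c S B
      ≡⟨ trans (ℚ.*-comm (val cs) (rem c S B)) (cong (_* val cs) (rem≡cnt c)) ⟩
    cnt c (c ∷ cs) * val cs
      ∎
    where
    cnt-suc : ∀ b → b ≡ c → cnt b (c ∷ cs) ≡ 1ℚ + cnt b cs
    cnt-suc b refl = cong (_+ cnt b cs) (𝟙-yes (c Bool.≟ c) refl)
    Goal : Fin m → Set
    Goal e = χ c e * E (χs cs) (S ⊕ e) B ≡ val cs * 𝟙 (remaining? c S B e)
    zeros : ∀ e → χ c e * E (χs cs) (S ⊕ e) B ≡ 0ℚ → ¬ Remaining c S B e → Goal e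
    zeros e left ¬r = trans left (sym (*-≡0ʳ (val cs) (𝟙-no (remaining? c S B e) ¬r)))
    by-cases : ∀ e → Dec (lookup R e ≡ c) → Dec (e ∈ B) → Dec (e ∈ S) → Goal e
    by-cases e (no Re≢c) _ _ = zeros e (*-≡0ˡ (E (χs cs) (S ⊕ e) B) (χ≡0 Re≢c)) (Re≢c ∘ proj₁)
    by-cases e (yes Re≡c) (no e∉B) _ = zeros e (*-≡0ʳ (χ c e) (E-⊈ cs self-∈-⊕ e∉B))
      λ r → e∉B (r .proj₂ .proj₁)
    -- Repeating an element of `S` wastes a step of colour `c`, and the remaining ones are one too
    -- few.
    by-cases e (yes Re≡c) (yes e∈B) (yes e∈S) = zeros e (*-≡0ʳ (χ c e) (trans (cong (λ T → E (χs cs) T B) (⊕-absorb e∈S))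
        (E-few c cs S B (subst (cnt c cs <ℚ_) (trans (sym (cnt-suc c refl)) (sym (rem≡cnt c)))
          (subst (_<ℚ 1ℚ + cnt c cs) (ℚ.+-identityˡ (cnt c cs)) (ℚ.+-monoˡ-< (cnt c cs) 0<1))))))
      λ r → r .proj₂ .proj₂ e∈S
    by-cases e (yes Re≡c) (yes e∈B) (no e∉S) = begin
      χ c e * E (χs cs) (S ⊕ e) B
        ≡⟨ cong₂ _*_ (χ≡1 Re≡c) (E-exact cs (S ⊕ e) B ⊕⊆B rem≡) ⟩
      1ℚ * val cs
        ≡⟨ ℚ.*-comm 1ℚ (val cs) ⟩
      val cs * 1ℚ
        ≡⟨ cong (val cs *_) (𝟙-yes (remaining? c S B e) (Re≡c , e∈B , e∉S)) ⟨
      val cs * 𝟙 (remaining? c S B e)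
        ∎
      where
      ⊕⊆B : S ⊕ e ⊆ B
      ⊕⊆B f∈ with ∈-⊕ f∈
      ... | inj₁ f∈S = S⊆B f∈S
      ... | inj₂ refl = e∈B
      rem≡ : ∀ b → rem b (S ⊕ e) B ≡ cnt b cs
      rem≡ b = begin
        rem b (S ⊕ e) B
          ≡⟨ solve 2 (λ r i → r := (r :+ i) :- i) refl (rem b (S ⊕ e) B) (colour b e) ⟩
        (rem b (S ⊕ e) B + colour b e) - colour b e
          ≡⟨ cong₂ _-_ (trans (sym (rem-⊕ b S B e e∈B e∉S)) (rem≡cnt b)) (cong (λ x → 𝟙 (x Bool.≟ b)) Re≡c) ⟩
        (𝟙 (c Bool.≟ b) + cnt b cs) - 𝟙 (c Bool.≟ b)
          ≡⟨ solve 2 (λ i k → (i :+ k) :- i := k) refl (𝟙 (c Bool.≟ b)) (cnt b cs) ⟩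
        cnt b cs
          ∎

  colours : ℕ → ℕ → List Bool
  colours k l = replicate k true ++ replicate l false

  cnt-colours : ∀ k l → cnt true (colours k l) ≡ ν k × cnt false (colours k l) ≡ ν l
  cnt-colours zero zero = refl , refl
  cnt-colours zero (suc l) = trans (ℚ.+-identityˡ _) (cnt-colours zero l .proj₁) , cong (1ℚ +_) (cnt-colours zero l .proj₂)
  cnt-colours (suc k) l = cong (1ℚ +_) (cnt-colours k l .proj₁) , trans (ℚ.+-identityˡ _) (cnt-colours k l .proj₂)

  val-colours : ∀ k l → val (colours k l) ≡ ν (k ℕ.! ℕ.* l ℕ.!)
  val-colours zero zero = refl
  val-colours zero (suc l) = begin
    cnt false (colours zero (suc l)) * val (colours zero l) ≡⟨ cong₂ _*_ (cnt-colours zero (suc l) .proj₂) (val-colours zero l) ⟩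
    ν (suc l) * ν (1 ℕ.* l ℕ.!) ≡⟨ ν-* (suc l) (1 ℕ.* l ℕ.!) ⟨
    ν (suc l ℕ.* (1 ℕ.* l ℕ.!)) ≡⟨ cong ν (trans (cong (suc l ℕ.*_) (ℕ.*-identityˡ (l ℕ.!))) (sym (ℕ.*-identityˡ (suc l ℕ.* l ℕ.!)))) ⟩
    ν (1 ℕ.* (suc l ℕ.* l ℕ.!)) ∎
  val-colours (suc k) l = begin
    cnt true (colours (suc k) l) * val (colours k l) ≡⟨ cong₂ _*_ (cnt-colours (suc k) l .proj₁) (val-colours k l) ⟩
    ν (suc k) * ν (k ℕ.! ℕ.* l ℕ.!) ≡⟨ ν-* (suc k) (k ℕ.! ℕ.* l ℕ.!) ⟨
    ν (suc k ℕ.* (k ℕ.! ℕ.* l ℕ.!)) ≡⟨ cong ν (ℕ.*-assoc (suc k) (k ℕ.!) (l ℕ.!)) ⟨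
    ν (suc k ℕ.* k ℕ.! ℕ.* l ℕ.!) ∎

  rem-true : ∀ B → rem true ∅ B ≡ ν (card (B ∩ R))
  rem-true B = trans (∑-cong λ e → 𝟙-cong (remaining? true ∅ B e) (e Sub.∈? (B ∩ R))
      (λ r → Sub.x∈p∩q⁺ (r .proj₂ .proj₁ , Vec.lookup⇒[]= e R (r .proj₁)))
      (λ e∈ → let e∈B , e∈R = Sub.x∈p∩q⁻ B R e∈ in Vec.[]=⇒lookup e∈R , e∈B , Sub.∉⊥))
    (∑-card (B ∩ R))

  rem-total : ∀ B → rem true ∅ B + rem false ∅ B ≡ ν (card B)
  rem-total B = trans (sym (∑-+ (λ e → 𝟙 (remaining? true ∅ B e)) (λ e → 𝟙 (remaining? false ∅ B e))))
    (trans (∑-cong λ e → by-cases e (lookup R e) refl) (∑-card B))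
    where
    by-cases : ∀ e b → lookup R e ≡ b → 𝟙 (remaining? true ∅ B e) + 𝟙 (remaining? false ∅ B e) ≡ 𝟙 (e Sub.∈? B)
    by-cases e true Re≡ = trans (cong₂ _+_
        (𝟙-cong (remaining? true ∅ B e) (e Sub.∈? B) (λ r → r .proj₂ .proj₁) (λ e∈B → Re≡ , e∈B , Sub.∉⊥))
        (𝟙-no (remaining? false ∅ B e) λ r → contradiction (trans (sym Re≡) (r .proj₁)) λ ()))
      (ℚ.+-identityʳ (𝟙 (e Sub.∈? B)))
    by-cases e false Re≡ = trans (cong₂ _+_
        (𝟙-no (remaining? true ∅ B e) λ r → contradiction (trans (sym Re≡) (r .proj₁)) λ ())
        (𝟙-cong (remaining? false ∅ B e) (e Sub.∈? B) (λ r → r .proj₂ .proj₁) (λ e∈B → Re≡ , e∈B , Sub.∉⊥)))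
      (ℚ.+-identityˡ (𝟙 (e Sub.∈? B)))

  module _ (k l : ℕ) (k+l≡n : k ℕ.+ l ≡ n)
    (basis⇔ : ∀ B → IsBasis M B ⇔ (Indep B × card B ≡ n)) where

    private
      counted? : ∀ B → Dec (IsBasis M B × card (B ∩ R) ≡ k)
      counted? B = isBasis? M B ×-dec card (B ∩ R) ℕ.≟ k

      rem-false : ∀ {B} → card B ≡ n → rem false ∅ B ≡ ν n - ν (card (B ∩ R))
      rem-false {B} cB = trans (solve 2 (λ a b → b := (a :+ b) :- a) refl (rem true ∅ B) (rem false ∅ B))
        (cong₂ _-_ (trans (rem-total B) (cong ν cB)) (rem-true B))

      νn : ν n ≡ ν k + ν l
      νn = trans (cong ν (sym k+l≡n)) (ν-+ k l)

      summand : ∀ B → β B * E (χs (colours k l)) ∅ B ≡ val (colours k l) * 𝟙 (counted? B)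
      summand B = by-cases (basis? B) (ℕ.<-cmp (card (B ∩ R)) k)
        where
        zeros : β B * E (χs (colours k l)) ∅ B ≡ 0ℚ → ¬ (IsBasis M B × card (B ∩ R) ≡ k) →
          β B * E (χs (colours k l)) ∅ B ≡ val (colours k l) * 𝟙 (counted? B)
        zeros left ¬c = trans left (sym (*-≡0ʳ (val (colours k l)) (𝟙-no (counted? B) ¬c)))
        by-cases : Dec (Indep B × card B ≡ n) → Tri (card (B ∩ R) < k) (card (B ∩ R) ≡ k) (k < card (B ∩ R)) →
          β B * E (χs (colours k l)) ∅ B ≡ val (colours k l) * 𝟙 (counted? B)
        by-cases (no ¬b) _ = zeros (*-≡0ˡ (E (χs (colours k l)) ∅ B) (𝟙-no (basis? B) ¬b))
          λ c → ¬b (Equivalence.to (basis⇔ B) (c .proj₁))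
        by-cases (yes b) (tri> _ c≢k k<c) = zeros (*-≡0ʳ (β B) (E-few true (colours k l) ∅ B
            (subst₂ _<ℚ_ (sym (cnt-colours k l .proj₁)) (sym (rem-true B)) (ν-mono-< k<c))))
          (c≢k ∘ proj₂)
        -- Fewer than `k` elements in `R` means more than `l` outside it, so here it is colour
        -- `false` that runs out.
        by-cases (yes b) (tri< c<k c≢k _) = zeros (*-≡0ʳ (β B) (E-few false (colours k l) ∅ B
            (subst₂ _<ℚ_ (sym (cnt-colours k l .proj₂)) (sym (rem-false (b .proj₂)))
              (0<q-p⇒p<q (subst (0ℚ <ℚ_)
                (trans (solve 3 (λ k l c → k :- c := (k :+ l) :- c :- l) refl (ν k) (ν l) (ν (card (B ∩ R))))
                  (cong (λ x → x - ν (card (B ∩ R)) - ν l) (sym νn)))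
                (p<q⇒0<q-p (ν-mono-< c<k)))))))
          (c≢k ∘ proj₂)
        by-cases (yes b) (tri≈ _ c≡k _) = begin
          β B * E (χs (colours k l)) ∅ B
            ≡⟨ cong₂ _*_ (𝟙-yes (basis? B) b) (E-exact (colours k l) ∅ B Sub.⊥⊆ rem≡) ⟩
          1ℚ * val (colours k l)
            ≡⟨ ℚ.*-comm 1ℚ (val (colours k l)) ⟩
          val (colours k l) * 1ℚ
            ≡⟨ cong (val (colours k l) *_) (𝟙-yes (counted? B) (Equivalence.from (basis⇔ B) b , c≡k)) ⟨
          val (colours k l) * 𝟙 (counted? B)
            ∎
          where
          rem≡ : ∀ b → rem b ∅ B ≡ cnt b (colours k l)
          rem≡ true = trans (rem-true B) (trans (cong ν c≡k) (sym (cnt-colours k l .proj₁)))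
          rem≡ false = begin
            rem false ∅ B ≡⟨ rem-false (b .proj₂) ⟩
            ν n - ν (card (B ∩ R)) ≡⟨ cong₂ _-_ νn (cong ν c≡k) ⟩
            (ν k + ν l) - ν k ≡⟨ solve 2 (λ k l → (k :+ l) :- k := l) refl (ν k) (ν l) ⟩
            ν l ≡⟨ cnt-colours k l .proj₂ ⟨
            cnt false (colours k l) ∎

    D-colours : D (χs (colours k l)) ∅ ≡ ν (k ℕ.! ℕ.* l ℕ.!) * ν (N M R k)
    D-colours = begin
      D (χs (colours k l)) ∅
        ≡⟨ D≡sum (χs (colours k l)) ∅ ⟩
      sumₗ (subsets m) (λ B → β B * E (χs (colours k l)) ∅ B)
        ≡⟨ sumₗ-cong (subsets m) summand ⟩
      sumₗ (subsets m) (λ B → val (colours k l) * 𝟙 (counted? B))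
        ≡⟨ *-sumₗ (val (colours k l)) (subsets m) (λ B → 𝟙 (counted? B)) ⟨
      val (colours k l) * sumₗ (subsets m) (λ B → 𝟙 (counted? B))
        ≡⟨ cong₂ _*_ (val-colours k l) (sym (length-filter counted? (subsets m))) ⟩
      ν (k ℕ.! ℕ.* l ℕ.!) * ν (N M R k)
        ∎

-- The sequence Ñ

module LogConcave (t : ℕ → ℚ) (n : ℕ) (pos : ∀ {k} → k ≤ n → 0ℚ <ℚ t k)
  (newton : ∀ {k} → suc (suc k) ≤ n → t (suc (suc k)) * t k ≤ℚ t (suc k) * t (suc k)) where

  *-monoʳ : ∀ r {p q} → 0ℚ <ℚ r → p ≤ℚ q → p * r ≤ℚ q * r
  *-monoʳ r 0<r = ℚ.*-monoʳ-≤-nonNeg r {{ℚ.nonNegative (ℚ.<⇒≤ 0<r)}}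

  -- Consecutive ratios of a log-concave sequence decrease, so each is at most the first;
  -- cross-multiplied to avoid division.
  ratio-≤ : ∀ k → suc k ≤ n → t (suc k) * t 0 ≤ℚ t k * t 1
  ratio-≤ zero _ = ℚ.≤-reflexive (ℚ.*-comm (t 1) (t 0))
  ratio-≤ (suc k) 2+k≤n = ℚ.*-cancelʳ-≤-pos (t k) {{ℚ.positive (pos k≤n)}} (ℚ.≤-trans
    (subst₂ _≤ℚ_
      (solve 3 (λ a b c → a :* b :* c := a :* c :* b) refl (t (suc (suc k))) (t k) (t 0))
      (solve 2 (λ a c → a :* a :* c := a :* c :* a) refl (t (suc k)) (t 0))
      (*-monoʳ (t 0) (pos z≤n) (newton 2+k≤n)))
    (subst (t (suc k) * t 0 * t (suc k) ≤ℚ_)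
      (solve 3 (λ a b c → a :* b :* c := c :* b :* a) refl (t k) (t 1) (t (suc k)))
      (*-monoʳ (t (suc k)) (pos 1+k≤n) (ratio-≤ k 1+k≤n))))
    where
    1+k≤n = ≤-trans (ℕ.n≤1+n (suc k)) 2+k≤n
    k≤n = ≤-trans (ℕ.n≤1+n k) 1+k≤n

  ^-pos : ∀ {q} → 0ℚ <ℚ q → ∀ k → 0ℚ <ℚ q ^ k
  ^-pos 0<q zero = 0<1
  ^-pos 0<q (suc k) = 0<* 0<q (^-pos 0<q k)

  -- The quotient of `t (suc (suc k))` by `t 0` is a product of consecutive ratios, none above the
  -- first; strictness in the second ratio therefore makes the whole product strictly smaller.
  strict : t 2 * t 0 <ℚ t 1 * t 1 → ∀ k → suc (suc k) ≤ n → t (suc (suc k)) * t 0 ^ suc k <ℚ t 1 ^ suc (suc k)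
  strict lt zero _ = subst₂ _<ℚ_
    (cong (t 2 *_) (sym (ℚ.*-identityʳ (t 0)))) (cong (t 1 *_) (sym (ℚ.*-identityʳ (t 1)))) lt
  strict lt (suc k) 3+k≤n = ℚ.≤-<-trans
    (subst (_≤ℚ t (suc (suc k)) * t 1 * t 0 ^ suc k)
      (ℚ.*-assoc (t (suc (suc (suc k)))) (t 0) (t 0 ^ suc k))
      (*-monoʳ (t 0 ^ suc k) (^-pos (pos z≤n) (suc k)) (ratio-≤ (suc (suc k)) 3+k≤n)))
    (subst (_<ℚ t 1 * t 1 ^ suc (suc k))
      (solve 3 (λ a b c → b :* (a :* c) := a :* b :* c) refl (t (suc (suc k))) (t 1) (t 0 ^ suc k))
      (ℚ.*-monoʳ-<-pos (t 1) {{ℚ.positive (pos 1≤n)}} (strict lt k 2+k≤n)))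
    where
    2+k≤n = ≤-trans (ℕ.n≤1+n (suc (suc k))) 3+k≤n
    1≤n = ≤-trans (s≤s z≤n) 3+k≤n

  power-equality⇒newton-equality : 2 ≤ n → t 1 ^ n ≡ t 0 ^ (n ∸ 1) * t n → t 1 * t 1 ≡ t 0 * t 2
  power-equality⇒newton-equality 2≤n@(s≤s (s≤s {n = k} _)) eq with ℚ.<-cmp (t 2 * t 0) (t 1 * t 1)
  ... | tri< lt _ _ = contradiction (trans (ℚ.*-comm (t (suc (suc k))) (t 0 ^ suc k)) (sym eq)) (ℚ.<⇒≢ (strict lt k ≤-refl))
  ... | tri≈ _ t₂t₀≡t₁t₁ _ = trans (sym t₂t₀≡t₁t₁) (ℚ.*-comm (t 2) (t 0))
  ... | tri> _ _ gt = contradiction (ℚ.<-≤-trans gt (newton 2≤n)) (ℚ.<-irrefl refl)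

  geometric⇒power-equality : ∀ {c} → 1 ≤ n → (∀ k → suc k ≤ n → t (suc k) ≡ c * t k) → t 1 ^ n ≡ t 0 ^ (n ∸ 1) * t n
  geometric⇒power-equality {c} (s≤s {n = k} _) geometric = sym (trans (ℚ.*-comm (t 0 ^ k) (t (suc k))) (telescope k ≤-refl))
    where
    open ≡-Reasoning
    telescope : ∀ j → suc j ≤ suc k → t (suc j) * t 0 ^ j ≡ t 1 ^ suc j
    telescope zero _ = refl
    telescope (suc j) 2+j≤ = begin
      t (suc (suc j)) * (t 0 * t 0 ^ j) ≡⟨ cong (_* (t 0 * t 0 ^ j)) (geometric (suc j) 2+j≤) ⟩
      c * t (suc j) * (t 0 * t 0 ^ j) ≡⟨ solve 4 (λ c a b p → c :* a :* (b :* p) := c :* b :* (a :* p)) refl c (t (suc j)) (t 0) (t 0 ^ j) ⟩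
      c * t 0 * (t (suc j) * t 0 ^ j) ≡⟨ cong₂ _*_ (sym (geometric 0 (s≤s z≤n))) (telescope j (≤-trans (ℕ.n≤1+n (suc j)) 2+j≤)) ⟩
      t 1 * t 1 ^ suc j ∎

-- Bases and the rank

module Rank {m : ℕ} (M : Matroid m) (n : ℕ) (hasRank : HasRank M n) where

  open Matroid M

  private
    B₀ = hasRank .proj₁
    B₀-basis = hasRank .proj₂ .proj₁
    B₀-card = hasRank .proj₂ .proj₂

  ⊂-⊕ : ∀ {S : Subset m} {e} → e ∉ S → S ⊂ S ⊕ e
  ⊂-⊕ {e = e} e∉S = ⊆-⊕ , e , self-∈-⊕ , e∉S

  rank : ∀ {S} → Indep S → card S ≤ n
  rank {S} ind = ℕ.≮⇒≥ λ n<S →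
    let e , _ , e∉B₀ , ind⊕ = augmentation (B₀-basis .proj₁) ind (subst (_< card S) (sym B₀-card) n<S)
    in B₀-basis .proj₂ (B₀ ⊕ e , ind⊕ , ⊂-⊕ e∉B₀)

  basis⇔ : ∀ B → IsBasis M B ⇔ (Indep B × card B ≡ n)
  basis⇔ B = mk⇔
    (λ { (ind , maximal) → ind , ℕ.≤-antisym (rank ind) (ℕ.≮⇒≥ λ B<n →
      let e , _ , e∉B , ind⊕ = augmentation ind (B₀-basis .proj₁) (subst (card B <_) (sym B₀-card) B<n)
      in maximal (B ⊕ e , ind⊕ , ⊂-⊕ e∉B)) })
    (λ { (ind , cB) → ind , λ { (J , indJ , B⊂J) →
      ℕ.<⇒≱ (subst (_< card J) cB (Sub.p⊂q⇒∣p∣<∣q∣ B⊂J)) (rank indJ) } })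

  extend-from : ∀ {B} → Indep B × card B ≡ n → ∀ {S} → Indep S → card S < n → ∃[ e ] e ∈ B × e ∉ S × Indep (S ⊕ e)
  extend-from (indB , cB) {S} ind S<n = augmentation ind indB (subst (card S <_) (sym cB) S<n)

  basis-with : ∀ R k → N M R k ≢ 0 → ∃[ B ] (Indep B × card B ≡ n) × card (B ∩ R) ≡ k
  basis-with R k N≢0 = first (filter counted? (subsets m)) (All.all-filter counted? (subsets m)) N≢0
    where
    counted? : ∀ B → Dec (IsBasis M B × card (B ∩ R) ≡ k)
    counted? B = isBasis? M B ×-dec card (B ∩ R) ℕ.≟ k
    first : ∀ Bs → All.All (λ B → IsBasis M B × card (B ∩ R) ≡ k) Bs → length Bs ≢ 0 →
            ∃[ B ] (Indep B × card B ≡ n) × card (B ∩ R) ≡ k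
    first [] _ l≢0 = contradiction refl l≢0
    first (B ∷ Bs) ((basis , c) All.∷ _) _ = B , Equivalence.to (basis⇔ B) basis , c

-- From mixed discriminants back to basis counts

module Final {m : ℕ} (M : Matroid m) (R : Subset m) (n : ℕ) (regular : Regular M) (hasRank : HasRank M n)
  (0<Ñ₀ : 0ℚ <ℚ Ñ M R n 0 z≤n) (0<Ñₙ : 0ℚ <ℚ Ñ M R n n ≤-refl) where

  open Matroid M
  open Rank M n hasRank
  open ≡-Reasoning

  Ñ-choose : ∀ k (k≤n : k ≤ n) → Ñ M R n k k≤n * ν (n choose k) ≡ ν (N M R k)
  Ñ-choose k k≤n = /-* (N M R k) (n choose k) {{nCk-nonZero k≤n}}

  positive⇒N≢0 : ∀ k (k≤n : k ≤ n) → 0ℚ <ℚ Ñ M R n k k≤n → N M R k ≢ 0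
  positive⇒N≢0 k k≤n 0<Ñ N≡0 = pos⇒≢0 0<Ñ (*-cancel-0
    (pos⇒≢0 (ν-mono-< (ℕ.>-nonZero⁻¹ (n choose k) {{nCk-nonZero k≤n}})))
    (trans (ℚ.*-comm (ν (n choose k)) (Ñ M R n k k≤n)) (trans (Ñ-choose k k≤n) (cong ν N≡0))))

  Monochromatic : Bool → Set
  Monochromatic b = ∃[ B ] (Indep B × card B ≡ n) × (∀ {e} → e ∈ B → lookup R e ≡ b)

  all-inside : ∃[ B ] (Indep B × card B ≡ n) × card (B ∩ R) ≡ n → Monochromatic true
  all-inside (B , (ind , cB) , c) = B , (ind , cB) , inside-R
    where
    inside-R : ∀ {e} → e ∈ B → lookup R e ≡ true
    inside-R {e} e∈B = by-cases (e Sub.∈? R)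
      where
      by-cases : Dec (e ∈ R) → lookup R e ≡ true
      by-cases (yes e∈R) = Vec.[]=⇒lookup e∈R
      by-cases (no e∉R) = contradiction (trans c (sym cB)) (ℕ.<⇒≢ (Sub.p⊂q⇒∣p∣<∣q∣
        (Sub.p∩q⊆p B R , e , e∈B , λ e∈ → e∉R (Sub.x∈p∩q⁻ B R e∈ .proj₂))))

  all-outside : ∃[ B ] (Indep B × card B ≡ n) × card (B ∩ R) ≡ 0 → Monochromatic false
  all-outside (B , basis , c) = B , basis , outside-R
    where
    outside-R : ∀ {e} → e ∈ B → lookup R e ≡ false
    outside-R {e} e∈B = by-cases (lookup R e) refl
      where
      by-cases : ∀ b → lookup R e ≡ b → b ≡ false
      by-cases false _ = refl
      by-cases true eq = contradiction
        (ℕ.≤-trans (ℕ.≤-reflexive (sym (Sub.∣⁅x⁆∣≡1 e))) (ℕ.≤-trans (Sub.p⊆q⇒∣p∣≤∣q∣ singleton) (ℕ.≤-reflexive c))) λ ()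
        where
        singleton : ⁅ e ⁆ ⊆ B ∩ R
        singleton f∈ = subst (_∈ B ∩ R) (sym (Sub.x∈⁅y⁆⇒x≡y e f∈)) (Sub.x∈p∩q⁺ (e∈B , Vec.lookup⇒[]= e R eq))

  opaque

    monochromatic : ∀ b → Monochromatic b
    monochromatic true = all-inside (basis-with R n (positive⇒N≢0 n ≤-refl 0<Ñₙ))
    monochromatic false = all-outside (basis-with R 0 (positive⇒N≢0 0 z≤n 0<Ñ₀))

  -- Augmentation from a basis of a single colour can only add an element of that colour.
  extend-by : ∀ {b} → Monochromatic b → ∀ {S} → Indep S → card S < n → ∃[ e ] lookup R e ≡ b × e ∉ S × Indep (S ⊕ e)
  extend-by (B , basis , colour) ind S<n with extend-from basis ind S<n
  ... | e , e∈B , e∉S , ind⊕ = e , colour e∈B , e∉S , ind⊕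

  extend : ∀ b {S} → Indep S → card S < n → ∃[ e ] lookup R e ≡ b × e ∉ S × Indep (S ⊕ e)
  extend b = extend-by (monochromatic b)

  open Mixed M n
  open Lorentzian M R n extend
  open HodgeRiemann M R n extend
  open Counting M R n extend using (colours; D-colours)

  a : ℕ → ℕ → ℚ
  a k l = D (χs (colours k l)) ∅

  a-suc : ∀ k l → a k (suc l) ≡ D (χ false ∷ χs (colours k l)) ∅
  a-suc k l = D-↭ (Perm.map⁺ χ (Perm.shift false (replicate k true) (replicate l false))) ∅

  length-colours : ∀ k l → length (colours k l) ≡ k ℕ.+ l
  length-colours k l = trans (List.length-++ (replicate k true)) (cong₂ ℕ._+_ (List.length-replicate k) (List.length-replicate l))

  ∅+ : ∀ k → card (∅ {m}) ℕ.+ k ≡ k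
  ∅+ k = cong (ℕ._+ k) (Sub.∣⊥∣≡0 m)

  a≡ : ∀ k (k≤n : k ≤ n) → a k (n ∸ k) ≡ ν (n ℕ.!) * Ñ M R n k k≤n
  a≡ k k≤n = begin
    a k (n ∸ k)
      ≡⟨ D-colours k (n ∸ k) (ℕ.m+[n∸m]≡n k≤n) basis⇔ ⟩
    ν (k ℕ.! ℕ.* (n ∸ k) ℕ.!) * ν (N M R k)
      ≡⟨ cong (ν (k ℕ.! ℕ.* (n ∸ k) ℕ.!) *_) (Ñ-choose k k≤n) ⟨
    ν (k ℕ.! ℕ.* (n ∸ k) ℕ.!) * (Ñ M R n k k≤n * ν (n choose k))
      ≡⟨ solve 3 (λ f x c → f :* (x :* c) := c :* f :* x) refl (ν (k ℕ.! ℕ.* (n ∸ k) ℕ.!)) (Ñ M R n k k≤n) (ν (n choose k)) ⟩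
    ν (n choose k) * ν (k ℕ.! ℕ.* (n ∸ k) ℕ.!) * Ñ M R n k k≤n
      ≡⟨ cong (_* Ñ M R n k k≤n) (trans (sym (ν-* (n choose k) (k ℕ.! ℕ.* (n ∸ k) ℕ.!))) (cong ν choose-factorial)) ⟩
    ν (n ℕ.!) * Ñ M R n k k≤n
      ∎
    where
    instance
      _ = k ℕ.!* n ∸ k !≢0
    choose-factorial : (n choose k) ℕ.* (k ℕ.! ℕ.* (n ∸ k) ℕ.!) ≡ n ℕ.!
    choose-factorial = trans (cong (ℕ._* (k ℕ.! ℕ.* (n ∸ k) ℕ.!)) (nCk≡n!/k![n-k]! k≤n)) (m/n*n≡m (k![n∸k]!∣n! k≤n))

  0<n! : 0ℚ <ℚ ν (n ℕ.!)
  0<n! = ν-mono-< (ℕ.n≢0⇒n>0 (ℕ.≢-nonZero⁻¹ (n ℕ.!) {{n ℕ.!≢0}}))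

  1/n! : ℚ
  1/n! = positive-inverse 0<n! .proj₁

  0<1/n! : 0ℚ <ℚ 1/n!
  0<1/n! = positive-inverse 0<n! .proj₂ .proj₁

  -- A version of `Ñ` that is total in `k`, so that the inequalities for sequences carry no bounds
  -- inside their terms.
  t : ℕ → ℚ
  t k = 1/n! * a k (n ∸ k)

  t≡Ñ : ∀ k (k≤n : k ≤ n) → t k ≡ Ñ M R n k k≤n
  t≡Ñ k k≤n = begin
    1/n! * a k (n ∸ k) ≡⟨ cong (1/n! *_) (a≡ k k≤n) ⟩
    1/n! * (ν (n ℕ.!) * Ñ M R n k k≤n) ≡⟨ solve 3 (λ i f x → i :* (f :* x) := f :* i :* x) refl 1/n! (ν (n ℕ.!)) (Ñ M R n k k≤n) ⟩
    ν (n ℕ.!) * 1/n! * Ñ M R n k k≤n ≡⟨ cong (_* Ñ M R n k k≤n) (positive-inverse 0<n! .proj₂ .proj₂) ⟩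
    1ℚ * Ñ M R n k k≤n ≡⟨ ℚ.*-identityˡ (Ñ M R n k k≤n) ⟩
    Ñ M R n k k≤n ∎

  t-pos : ∀ {k} → k ≤ n → 0ℚ <ℚ t k
  t-pos {k} k≤n = 0<* 0<1/n! (0<Dχ (colours k (n ∸ k)) ∅ indep-⊥
    (trans (∅+ _) (trans (length-colours k (n ∸ k)) (ℕ.m+[n∸m]≡n k≤n))))

  module Middle (k : ℕ) (2+k≤n : suc (suc k) ≤ n) where

    l : ℕ
    l = n ∸ suc (suc k)

    cs : List Bool
    cs = colours k l

    H : Bool → Bool → ℚ
    H b c = D (χ b ∷ χ c ∷ χs cs) ∅

    n∸[1+k] : n ∸ suc k ≡ suc l
    n∸[1+k] = ℕ.+-∸-assoc 1 {n} {suc (suc k)} 2+k≤n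

    n∸k : n ∸ k ≡ suc (suc l)
    n∸k = trans (ℕ.+-∸-assoc 1 {n} {suc k} (≤-trans (ℕ.n≤1+n (suc k)) 2+k≤n)) (cong suc n∸[1+k])

    t₁≡ : t (suc k) ≡ 1/n! * H true false
    t₁≡ = cong (1/n! *_) (trans (cong (a (suc k)) n∸[1+k]) (trans (a-suc (suc k) l) (D-swap (χ false) (χ true) (χs cs) ∅)))

    t₀≡ : t k ≡ 1/n! * H false false
    t₀≡ = cong (1/n! *_) (trans (cong (a k) n∸k) (trans (a-suc k (suc l))
      (D-cons (χ false) (χs (colours k (suc l))) (χ false ∷ χs cs) (λ S → D-↭ (Perm.map⁺ χ (Perm.shift false (replicate k true) (replicate l false))) S) ∅)))

    fits : 2 ℕ.+ length cs ≡ n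
    fits = trans (cong (2 ℕ.+_) (length-colours k l)) (ℕ.m+[n∸m]≡n 2+k≤n)

    fits-∅ : card (∅ {m}) ℕ.+ (2 ℕ.+ length cs) ≡ n
    fits-∅ = trans (∅+ _) fits

    rescale : ∀ p q → 1/n! * p * (1/n! * q) ≡ 1/n! * 1/n! * (p * q)
    rescale p q = solve 3 (λ i p q → i :* p :* (i :* q) := i :* i :* (p :* q)) refl 1/n! p q

    newton : t (suc (suc k)) * t k ≤ℚ t (suc k) * t (suc k)
    newton = subst₂ _≤ℚ_
      (trans (sym (rescale (H true true) (H false false))) (cong (1/n! * H true true *_) (sym t₀≡)))
      (trans (sym (rescale (H true false) (H true false))) (sym (cong₂ _*_ t₁≡ t₁≡)))
      (ℚ.*-monoˡ-≤-nonNeg (1/n! * 1/n!) {{ℚ.nonNegative (ℚ.<⇒≤ (0<* 0<1/n! 0<1/n!))}}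
        (reverseCS cs ∅ (ℕ.≤-reflexive fits-∅) false (χ true)))

    0<H : ∀ b c → 0ℚ <ℚ H b c
    0<H b c = 0<Dχ (b ∷ c ∷ cs) ∅ indep-⊥ fits-∅

    -- The ratio `c` is forced by requiring `w` to be orthogonal to `χ false`; the assumed equality
    -- then says that the two-by-two matrix `H` is singular, which is orthogonality to `χ true`.
    geometric : t (suc k) * t (suc k) ≡ t k * t (suc (suc k)) →
      Σ[ c ∈ ℚ ] (∀ j → suc j ≤ n → t (suc j) ≡ c * t j)
    geometric eq = c , step
      where
      r = positive-inverse (0<H false false) .proj₁
      r-inv = positive-inverse (0<H false false) .proj₂ .proj₂
      c = H true false * r
      c≢0 : c ≢ 0ℚ
      c≢0 = pos⇒≢0 (0<* (0<H true false) (positive-inverse (0<H false false) .proj₂ .proj₁))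
      open Equality M R n extend rank (RealEmbedding.representation M regular) c≢0
      H-eq : H true false * H true false ≡ H true true * H false false
      H-eq = *-cancelˡ (pos⇒≢0 (0<* 0<1/n! 0<1/n!)) (begin
        1/n! * 1/n! * (H true false * H true false) ≡⟨ rescale (H true false) (H true false) ⟨
        1/n! * H true false * (1/n! * H true false) ≡⟨ cong₂ _*_ t₁≡ t₁≡ ⟨
        t (suc k) * t (suc k) ≡⟨ eq ⟩
        t k * t (suc (suc k)) ≡⟨ ℚ.*-comm (t k) (t (suc (suc k))) ⟩
        t (suc (suc k)) * t k ≡⟨ cong (1/n! * H true true *_) t₀≡ ⟩
        1/n! * H true true * (1/n! * H false false) ≡⟨ rescale (H true true) (H false false) ⟩
        1/n! * 1/n! * (H true true * H false false) ∎)
      expand : ∀ b → D (w ∷ χ b ∷ χs cs) ∅ ≡ H true b + (- c) * H false b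
      expand b = D-linear (χ true) (χ false) (- c) (χ b ∷ χs cs) ∅
      isotropic : Isotropic ∅ cs
      isotropic false = trans (expand false) (eliminate (H true false) r-inv)
      isotropic true = trans (expand true) (begin
        H true true + (- (H true false * r)) * H false true
          ≡⟨ cong (λ x → H true true + (- (H true false * r)) * x) (D-swap (χ false) (χ true) (χs cs) ∅) ⟩
        H true true + (- (H true false * r)) * H true false
          ≡⟨ solve 3 (λ p q r → p :+ (:- (q :* r)) :* q := p :- q :* q :* r) refl (H true true) (H true false) r ⟩
        H true true - H true false * H true false * r
          ≡⟨ cong (λ x → H true true - x * r) H-eq ⟩
        H true true - H true true * H false false * r
          ≡⟨ solve 3 (λ p q r → p :- p :* q :* r := p :- p :* (q :* r)) refl (H true true) (H false false) r ⟩
        H true true - H true true * (H false false * r)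
          ≡⟨ cong (λ x → H true true - H true true * x) r-inv ⟩
        H true true - H true true * 1ℚ
          ≡⟨ solve 1 (λ p → p :- p :* con 1ℚ := con 0ℚ) refl (H true true) ⟩
        0ℚ
          ∎)
      step : ∀ j → suc j ≤ n → t (suc j) ≡ c * t j
      step j 1+j≤n = begin
        1/n! * D (χ true ∷ χs (colours j (n ∸ suc j))) ∅
          ≡⟨ cong (1/n! *_) (proportional (annihilates cs ∅ indep-⊥ fits-∅ isotropic) (colours j (n ∸ suc j))
               (ℕ.≤-reflexive (trans (cong suc (length-colours j (n ∸ suc j))) (ℕ.m+[n∸m]≡n 1+j≤n)))) ⟩
        1/n! * (c * D (χ false ∷ χs (colours j (n ∸ suc j))) ∅)
          ≡⟨ solve 3 (λ i c d → i :* (c :* d) := c :* (i :* d)) refl 1/n! c (D (χ false ∷ χs (colours j (n ∸ suc j))) ∅) ⟩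
        c * (1/n! * D (χ false ∷ χs (colours j (n ∸ suc j))) ∅)
          ≡⟨ cong (λ d → c * (1/n! * d)) (trans (sym (a-suc j (n ∸ suc j))) (cong (a j) (sym (ℕ.+-∸-assoc 1 {n} {suc j} 1+j≤n)))) ⟩
        c * t j
          ∎

  open LogConcave t n t-pos (λ {k} 2+k≤n → Middle.newton k 2+k≤n)
    using (power-equality⇒newton-equality; geometric⇒power-equality)

  square : ∀ x → x ^ 2 ≡ x * x
  square x = cong (x *_) (ℚ.*-identityʳ x)

  theorem : (2≤n : 2 ≤ n) →
    (Ñ M R n 1 (<⇒≤ 2≤n) ^ n ≡ Ñ M R n 0 z≤n ^ (n ∸ 1) * Ñ M R n n ≤-refl)
      ⇔
    (Σ[ k ∈ ℕ ] Σ[ 1≤k ∈ 1 ≤ k ] Σ[ k<n ∈ k < n ]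
      (Ñ M R n k (<⇒≤ k<n) ^ 2
        ≡ Ñ M R n (k ∸ 1) (≤-trans (m∸n≤m k 1) (<⇒≤ k<n)) * Ñ M R n (suc k) k<n))
  theorem 2≤n = mk⇔ forward backward
    where
    forward : _ → _
    forward eq = 1 , ≤-refl , 2≤n , (begin
      Ñ M R n 1 (<⇒≤ 2≤n) ^ 2 ≡⟨ square (Ñ M R n 1 (<⇒≤ 2≤n)) ⟩
      Ñ M R n 1 (<⇒≤ 2≤n) * Ñ M R n 1 (<⇒≤ 2≤n) ≡⟨ cong₂ _*_ (t≡Ñ 1 (<⇒≤ 2≤n)) (t≡Ñ 1 (<⇒≤ 2≤n)) ⟨
      t 1 * t 1 ≡⟨ power-equality⇒newton-equality 2≤n power ⟩
      t 0 * t 2 ≡⟨ cong₂ _*_ (t≡Ñ 0 z≤n) (t≡Ñ 2 2≤n) ⟩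
      Ñ M R n 0 z≤n * Ñ M R n 2 2≤n ∎)
      where
      power : t 1 ^ n ≡ t 0 ^ (n ∸ 1) * t n
      power = begin
        t 1 ^ n ≡⟨ cong (_^ n) (t≡Ñ 1 (<⇒≤ 2≤n)) ⟩
        Ñ M R n 1 (<⇒≤ 2≤n) ^ n ≡⟨ eq ⟩
        Ñ M R n 0 z≤n ^ (n ∸ 1) * Ñ M R n n ≤-refl ≡⟨ cong₂ (λ x y → x ^ (n ∸ 1) * y) (t≡Ñ 0 z≤n) (t≡Ñ n ≤-refl) ⟨
        t 0 ^ (n ∸ 1) * t n ∎
    backward : _ → _
    backward (suc k , _ , 1+k<n , eq) = begin
      Ñ M R n 1 (<⇒≤ 2≤n) ^ n ≡⟨ cong (_^ n) (t≡Ñ 1 (<⇒≤ 2≤n)) ⟨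
      t 1 ^ n ≡⟨ geometric⇒power-equality {ratio .proj₁} (<⇒≤ 2≤n) (ratio .proj₂) ⟩
      t 0 ^ (n ∸ 1) * t n ≡⟨ cong₂ (λ x y → x ^ (n ∸ 1) * y) (t≡Ñ 0 z≤n) (t≡Ñ n ≤-refl) ⟩
      Ñ M R n 0 z≤n ^ (n ∸ 1) * Ñ M R n n ≤-refl ∎
      where
      Ñ₁ = Ñ M R n (suc k) (<⇒≤ 1+k<n)
      k≤n : k ≤ n
      k≤n = ≤-trans (m∸n≤m (suc k) 1) (<⇒≤ 1+k<n)
      ratio : Σ[ c ∈ ℚ ] (∀ j → suc j ≤ n → t (suc j) ≡ c * t j)
      ratio = Middle.geometric k 1+k<n (begin
        t (suc k) * t (suc k) ≡⟨ cong₂ _*_ (t≡Ñ (suc k) (<⇒≤ 1+k<n)) (t≡Ñ (suc k) (<⇒≤ 1+k<n)) ⟩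
        Ñ₁ * Ñ₁ ≡⟨ square Ñ₁ ⟨
        Ñ₁ ^ 2 ≡⟨ eq ⟩
        Ñ M R n k k≤n * Ñ M R n (suc (suc k)) 1+k<n ≡⟨ cong₂ _*_ (t≡Ñ k k≤n) (t≡Ñ (suc (suc k)) 1+k<n) ⟨
        t k * t (suc (suc k)) ∎)

lemma3p3p8 : ∀ {m} (M : Matroid m) (R : Subset m) (n : ℕ) (2≤n : 2 ≤ n) →
    Regular M → Loopless M → HasRank M n →
    0ℚ <ℚ Ñ M R n 0 z≤n → 0ℚ <ℚ Ñ M R n n ≤-refl →
    (Ñ M R n 1 (<⇒≤ 2≤n) ^ n ≡ Ñ M R n 0 z≤n ^ (n ∸ 1) * Ñ M R n n ≤-refl)
    ⇔
    (Σ[ k ∈ ℕ ] Σ[ 1≤k ∈ 1 ≤ k ] Σ[ k<n ∈ k < n ]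
    (Ñ M R n k (<⇒≤ k<n) ^ 2
    ≡ Ñ M R n (k ∸ 1) (≤-trans (m∸n≤m k 1) (<⇒≤ k<n)) * Ñ M R n (suc k) k<n))
lemma3p3p8 M R n 2≤n regular _ hasRank 0<Ñ₀ 0<Ñₙ = Final.theorem M R n regular hasRank 0<Ñ₀ 0<Ñₙ 2≤n
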